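{- Consider the following setting. (i) There is a deterministic algorithm that solves the gossiping problem in the model described in the context when the agents initially know a common upper bound $N\ge 2$ on the number of nodes of the graph, and its time complexity is bounded by a polynomial in $N$, in the length $\ell$ of the binary representation of the smallest label among the agents, and in the length of the largest message to be transmitted. (ii) There is a deterministic algorithm that solves the gossiping problem in the same model when the agents initially know no upper bound on the number of nodes of the graph.
   Context: Model: the network is an undirected connected graph with $n$ nodes whose nodes are anonymous (unlabeled); at each node $v$ of degree $d$, the incident edges carry distinct port numbers $0,\dots,d-1$ (port numbering is local, with no relation between the two port numbers of an edge). A team of at least two mobile agents starts at pairwise distinct nodes. Agents have distinct labels which are positive integers; each agent knows its own label but not the labels of others, and all agents execute the same deterministic algorithm, parameterized by the agent's label (and its message). Time proceeds in synchronous rounds. An adversary wakes up some agents in possibly different rounds; a dormant agent is woken up when another agent first visits its starting node. Starting from its wake-up round, in each round an agent performs local computation and then either stays at its current node or moves to a neighbor through a chosen port. Upon entering a node, an agent learns its degree and the port of entry. Agents cannot mark nodes or edges, and agents crossing each other on an edge do not notice it. Agents have unlimited memory. Crucially, agents cannot communicate: co-located agents cannot see each other's labels nor exchange any information; the only information an agent gets about other agents is, in every round, the number of agents (including itself) present at the node it currently occupies. Agents see nothing outside their current node. The time complexity is the worst-case number of rounds from the wake-up of the earliest agent until completion. Gossiping problem: each agent initially has a message, which is a binary string (messages of different agents need not be distinct), and the goal is that all agents learn all messages. -}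

module Defs where

open import Data.Nat using (ℕ; zero; suc; _+_; _*_; _^_; _≤_; _<_; _<?_; _⊔_)
open import Data.Nat.Logarithm using (⌊log₂_⌋)
open import Data.Fin using (Fin; toℕ; fromℕ<)
import Data.Fin as F
open import Data.Bool using (Bool; true; false; _∨_)
open import Data.List using (List; []; _∷_; _++_; length; filter; foldr; map)
open import Data.List.Membership.Propositional using (_∈_)
open import Data.Maybe using (Maybe; just; nothing)
open import Data.Product using (Σ; ∃; _×_; _,_)
open import Data.Sum using (_⊎_)
open import Function.Bundles using (_⇔_)
open import Relation.Nullary using (¬_; yes; no)
open import Relation.Nullary.Decidable using (isYes; ⌊_⌋)
open import Relation.Binary.PropositionalEquality using (_≡_; _≢_)
open import Data.Vec.Functional using () 
open import Data.List using (allFin)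

data Walk {n : ℕ} (deg : Fin n → ℕ) (nbr : (v : Fin n) → Fin (deg v) → Fin n)
          : Fin n → Fin n → Set where
  here : ∀ {u} → Walk deg nbr u u
  step : ∀ {u v} (p : Fin (deg u)) → Walk deg nbr (nbr u p) v → Walk deg nbr u v

-- A simple undirected connected graph on nodes Fin n, with local port
-- numbers 0 .. deg v - 1 at every node v.  nbr v p is the node reached
-- through port p of v, and back v p is the port number of the same edge
-- at the other endpoint.
record PortGraph (n : ℕ) : Set where
  field
    deg       : Fin n → ℕ
    nbr       : (v : Fin n) → Fin (deg v) → Fin n
    back      : (v : Fin n) (p : Fin (deg v)) → Fin (deg (nbr v p))
    back-nbr  : ∀ v p → nbr (nbr v p) (back v p) ≡ v
    back-back : ∀ v p → toℕ (back (nbr v p) (back v p)) ≡ toℕ p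
    no-loop   : ∀ v p → nbr v p ≢ v
    no-multi  : ∀ v p q → nbr v p ≡ nbr v q → p ≡ q
    connected : ∀ u v → Walk deg nbr u v

Message : Set
Message = List Bool

-- What an agent perceives in a round: degree of the current node, the
-- port by which it entered this node in the previous round (nothing if it
-- did not just move, e.g. at wake-up or after staying), and the number of
-- agents (including itself) currently at the node.
record Obs : Set where
  constructor obs
  field
    degree : ℕ
    entry  : Maybe ℕ
    count  : ℕ

-- Decision of an agent in a round.  'stop out' = the agent terminates
-- (remains at its node forever) declaring the list 'out' of messages it
-- has learned.  A move through a non-existent port is treated as staying.
data Action : Set where
  stay : Action
  go   : ℕ → Action
  stop : List Message → Action

-- A deterministic algorithm, parameterized by the agent's label and its
-- message, maps the history of observations since wake-up (oldest first,
-- including the current round) to an action.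
Algorithm : Set
Algorithm = (label : ℕ) → (msg : Message) → List Obs → Action

data AgentState (n : ℕ) : Set where
  dormant : AgentState n
  active  : (pos : Fin n) (entry : Maybe ℕ) (hist : List Obs) → AgentState n
  done    : (pos : Fin n) (out : List Message) → AgentState n

-- Team of k agents: starting nodes, labels, messages.
-- wake i = just t : the adversary wakes agent i in round t (if still dormant);
-- wake i = nothing : the adversary never wakes agent i.
module Execution {n k : ℕ} (G : PortGraph n) (A : Algorithm)
                 (start : Fin k → Fin n) (label : Fin k → ℕ)
                 (msg : Fin k → Message) (wake : Fin k → Maybe ℕ) where
  open PortGraph G

  position : Fin k → AgentState n → Fin n
  position i dormant         = start i
  position i (active p _ _)  = p
  position i (done p _)      = p

  countAt : (Fin k → AgentState n) → Fin n → ℕ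
  countAt st v = length (filter (λ i → position i (st i) F.≟ v) (allFin k))

  act : Fin k → (Fin k → AgentState n) → Fin n → Maybe ℕ → List Obs → AgentState n
  act i st pos e h with label i | msg i
  ... | l | m with A l m (h ++ (obs (deg pos) e (countAt st pos) ∷ []))
  ... | stay     = active pos nothing (h ++ (obs (deg pos) e (countAt st pos) ∷ []))
  ... | stop out = done pos out
  ... | go p with p <? deg pos
  ...   | yes p<d = active (nbr pos (fromℕ< p<d)) (just (toℕ (back pos (fromℕ< p<d))))
                           (h ++ (obs (deg pos) e (countAt st pos) ∷ []))
  ...   | no _    = active pos nothing (h ++ (obs (deg pos) e (countAt st pos) ∷ []))

  wakeNow : (Fin k → AgentState n) → ℕ → Fin k → Bool
  wakeNow st r i = isYes (Data.Maybe.Properties.≡-dec Data.Nat._≟_ (wake i) (just r))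
                   ∨ isYes (2 Data.Nat.≤? countAt st (start i))
    where import Data.Maybe.Properties
          import Data.Nat

  roundStep : ℕ → (Fin k → AgentState n) → Fin k → AgentState n
  roundStep r st i with st i
  ... | dormant with wakeNow st r i
  ...   | true  = act i st (start i) nothing []
  ...   | false = dormant
  roundStep r st i | active pos e h = act i st pos e h
  roundStep r st i | done pos out   = done pos out

  -- states at time t (i.e. before round t is executed)
  stateAt : ℕ → Fin k → AgentState n
  stateAt zero    i = dormant
  stateAt (suc r) i = roundStep r (stateAt r) i

CorrectlyDone : ∀ {n k} → (Fin k → Message) → AgentState n → Set
CorrectlyDone msg dormant          = Data.Empty.⊥ where import Data.Empty
CorrectlyDone msg (active _ _ _)   = Data.Empty.⊥ where import Data.Empty
CorrectlyDone {k = k} msg (done _ out) = ∀ (m : Message) → (m ∈ out ⇔ ∃ λ (j : Fin k) → msg j ≡ m)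

binLength : ℕ → ℕ
binLength x = suc ⌊log₂ x ⌋

maxMsgLength : ∀ {k} → (Fin k → Message) → ℕ
maxMsgLength {k} msg = foldr _⊔_ 0 (map (λ i → length (msg i)) (allFin k))

Injective : ∀ {A B : Set} → (A → B) → Set
Injective f = ∀ x y → f x ≡ f y → x ≡ y

record Instance {n k : ℕ} (start : Fin k → Fin n) (label : Fin k → ℕ)
                (wake : Fin k → Maybe ℕ) (i0 : Fin k) (t0 : ℕ) : Set where
  field
    two-agents : 2 ≤ k
    start-inj  : Injective start
    label-inj  : Injective label
    label-pos  : ∀ i → 1 ≤ label i
    i0-wakes   : wake i0 ≡ just t0
    t0-min     : ∀ i t → wake i ≡ just t → t0 ≤ t

AllDoneAt : ∀ {n k} (G : PortGraph n) (A : Algorithm) (start : Fin k → Fin n)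
            (label : Fin k → ℕ) (msg : Fin k → Message) (wake : Fin k → Maybe ℕ)
            → ℕ → Set
AllDoneAt G A start label msg wake t =
  ∀ i → CorrectlyDone msg (Execution.stateAt G A start label msg wake t i)

KnownBoundPoly : Set
KnownBoundPoly =
  Σ (ℕ → Algorithm) λ A → Σ ℕ λ c →
    ∀ (N : ℕ) → 2 ≤ N →
    ∀ {n k} (G : PortGraph n) → n ≤ N →
    ∀ (start : Fin k → Fin n) (label : Fin k → ℕ) (msg : Fin k → Message)
      (wake : Fin k → Maybe ℕ) (i0 : Fin k) (t0 : ℕ) →
    Instance start label wake i0 t0 →
    ∀ (imin : Fin k) → (∀ j → label imin ≤ label j) →
    Σ ℕ λ T →
      T ≤ c * (1 + N + binLength (label imin) + maxMsgLength msg) ^ c ×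
      AllDoneAt G (A N) start label msg wake (t0 + T)

UnknownBound : Set
UnknownBound =
  Σ Algorithm λ A →
    ∀ {n k} (G : PortGraph n) →
    ∀ (start : Fin k → Fin n) (label : Fin k → ℕ) (msg : Fin k → Message)
      (wake : Fin k → Maybe ℕ) (i0 : Fin k) (t0 : ℕ) →
    Instance start label wake i0 t0 →
    Σ ℕ λ T → AllDoneAt G A start label msg wake (t0 + T)

{-# OPTIONS --safe #-}
-- Agents never gather.  Every agent keeps its starting node as its home, all
-- homes being distinct, and cuts its time into slots.  In a slot an agent
-- either tours the graph and comes back, or stays at home; an agent at home
-- sees a second agent iff somebody tours.  If the clocks differ by less than a
-- guard time and the tours visit all nodes, every slot tells everybody whether
-- some agent has a given property, and a search of the tree of binary words
-- finds the set of all messages.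
--
-- With a known bound N the tours follow a universal traversal sequence of
-- polynomial length.  Reading ports not below the degree as loops makes the
-- random walk doubly stochastic, so by Kac's formula a walk from a neighbour
-- of v avoids v for t steps with probability at most N²/t; a union bound along
-- a path, repetition and conditional expectations over all transition tables
-- yield the sequence.
--
-- Without a bound, slot q is slower than all earlier slots together, and every
-- third slot sweeps the ball of radius q.  In the slot of a fact (b , w) the
-- agent labelled b walks along the trace w and pauses at its end.  A listener
-- that sees nobody, then a visitor for two phases, then nobody, has seen b
-- pausing: agents in later slots move at most once during the slot, those in
-- earlier slots were woken by the preceding sweep and have caught up.  Hence
-- w leads from the home of b to the own home.  Such facts identify nodes, and
-- a list of nodes closed under neighbours bounds the size.  Agents that know
-- no bound tour in another slot; once that slot is silent, everybody knows a
-- bound, hence that all are synchronised, and the search for the messages starts.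
module Submission where

open import Defs
open import Data.Product using (_×_)
open import Data.Bool using (Bool; true; false; if_then_else_; not; _∨_)
import Data.Bool.Properties as Bool
open import Data.Bool.Properties using (∨-zeroʳ)
open import Data.Empty using (⊥)
open import Data.Fin using (Fin; zero; suc; toℕ; fromℕ<; inject≤; finToFun; funToFin)
import Data.Fin as F
import Data.Fin.Properties as F
open import Data.List using (List; []; _∷_; _++_; _∷ʳ_; length; lookup; map; foldr; foldl; take; drop; replicate; concatMap; upTo; tabulate; allFin)
open import Data.List.Membership.Propositional using (_∈_; find; lose)
open import Data.List.Membership.Propositional.Properties using (∈-lookup; ∈-filter⁺; ∈-filter⁻; ∈-allFin; ∈-map⁺; ∈-concatMap⁺; ∈-upTo⁺)
import Data.List.Properties as List
open import Data.List.Properties using (length-++; length-map; length-replicate; length-tabulate; ++-assoc)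
open import Data.List.Relation.Unary.All as All using (All; []; _∷_)
import Data.List.Relation.Unary.All.Properties as All
open import Data.List.Relation.Unary.AllPairs using ([]; _∷_)
open import Data.List.Relation.Unary.Any as Any using (Any; here; there)
import Data.List.Relation.Unary.Any.Properties as Any
open import Data.List.Relation.Unary.Unique.Propositional using (Unique)
open import Data.List.Relation.Unary.Unique.Propositional.Properties using (allFin⁺; filter⁺)
open import Data.Maybe using (Maybe; just; nothing)
open import Data.Nat
open import Data.Nat.DivMod using (_/_; m*n/n≡m; m/n≡1+[m∸n]/n; m<n⇒m/n≡0; m<n*o⇒m/o<n; /-monoˡ-≤)
open import Data.Nat.Properties
open import Data.Nat.Tactic.RingSolver using (solve-∀)
open import Data.Product using (Σ; ∃; _,_; proj₁; proj₂)
import Data.Product.Properties as Product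
open import Data.Sum using (_⊎_; inj₁; inj₂)
open import Data.Unit using (⊤; tt)
open import Data.Vec using (Vec; []; _∷_)
open import Function using (_∘_)
open import Function.Bundles using (_⇔_; mk⇔; Equivalence)
open import Relation.Binary.Definitions using (tri<; tri≈; tri>)
open import Relation.Binary.PropositionalEquality
open import Relation.Nullary using (¬_; Dec; yes; no; does; contradiction; ¬?)
open import Relation.Nullary.Decidable using (_×-dec_; dec-true; dec-false)

open import Algebra.Properties.Semiring.Sum +-*-semiring using (sum; sum-cong-≗; ∑-distrib-+; ∑-comm; *-distribˡ-sum; *-distribʳ-sum)

-- The only signal in the model is a count, and it is informative only at a home: homes are
-- distinct, so a second agent there is on a tour. An agent on tour cannot listen, but then it knows
-- the answer itself. Without a bound two things are unknown at once, how far a tour must go and how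
-- far the clocks are apart, so the early slots cannot be trusted. Hence an asymmetry: whatever is
-- recorded must be true in every slot, while true facts need to be recorded only eventually, which
-- is why facts recur. That guard time and phase of slot q both outlast everything before slot q
-- serves both ends: it helps to tell agents in different slots apart, and every clock difference
-- finally drops below the guard. Starting the search together is the delicate point, as silence is
-- unreliable while the clocks may be far apart. It works because the unreliable listeners speak
-- anyway: an agent that knows no bound goes on whatever it hears, and one that knows a bound has
-- proof that a complete sweep has taken place, so that it may trust the silence.

-- Hitting times of random walks, by counting words

module RandomWalks where

  open ≤-Reasoning

  sum-mono : ∀ {n} {f g : Fin n → ℕ} → (∀ i → f i ≤ g i) → sum f ≤ sum g
  sum-mono {zero}  h = z≤n
  sum-mono {suc n} h = +-mono-≤ (h zero) (sum-mono (h ∘ suc))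

  sum-const : ∀ n c → sum {n} (λ _ → c) ≡ n * c
  sum-const zero    c = refl
  sum-const (suc n) c = cong (c +_) (sum-const n c)

  sum-bound : ∀ {n} {f : Fin n → ℕ} {c} → (∀ i → f i ≤ c) → sum f ≤ n * c
  sum-bound {n} {f} {c} h = ≤-trans (sum-mono h) (≤-reflexive (sum-const n c))

  term≤sum : ∀ {n} (f : Fin n → ℕ) i → f i ≤ sum f
  term≤sum f zero    = m≤m+n _ _
  term≤sum f (suc i) = ≤-trans (term≤sum (f ∘ suc) i) (m≤n+m _ _)

  below-average : ∀ {n} (f : Fin n → ℕ) c → sum f < n * c → ∃ λ i → f i < c
  below-average {suc n} f c h with f zero <? c
  ... | yes p = zero , p
  ... | no ¬p with below-average (f ∘ suc) c
                     (+-cancelˡ-< c _ _ (≤-<-trans (+-monoˡ-≤ _ (≮⇒≥ ¬p)) h))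
  ... | i , q = suc i , q

  δ : ∀ {n} → Fin n → Fin n → ℕ
  δ a b = if does (a F.≟ b) then 1 else 0

  δ-refl : ∀ {n} (a : Fin n) → δ a a ≡ 1
  δ-refl a with a F.≟ a
  ... | yes _ = refl
  ... | no a≢a = contradiction refl a≢a

  δ-≢ : ∀ {n} {a b : Fin n} → a ≢ b → δ a b ≡ 0
  δ-≢ {a = a} {b} a≢b with a F.≟ b
  ... | yes a≡b = contradiction a≡b a≢b
  ... | no _ = refl

  sum-zero : ∀ {n} {f : Fin n → ℕ} → (∀ i → f i ≡ 0) → sum f ≡ 0
  sum-zero {n} h = trans (sum-cong-≗ h) (trans (sum-const n 0) (*-zeroʳ n))

  sum-single : ∀ {n} {f : Fin n → ℕ} (j : Fin n) → (∀ i → i ≢ j → f i ≡ 0) → sum f ≡ f j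
  sum-single {f = f} zero    h =
    trans (cong (f zero +_) (sum-zero (λ i → h (suc i) λ ()))) (+-identityʳ _)
  sum-single {f = f} (suc j) h =
    cong₂ _+_ (h zero λ ()) (sum-single j (λ i i≢j → h (suc i) (i≢j ∘ F.suc-injective)))

  sum-δ : ∀ {n} (a : Fin n) (g : Fin n → ℕ) → sum (λ v → δ a v * g v) ≡ g a
  sum-δ a g = trans (sum-single a (λ i i≢a → cong (_* g i) (δ-≢ (i≢a ∘ sym))))
                    (trans (cong (_* g a) (δ-refl a)) (+-identityʳ _))

  -- A walk reads letters from Fin N.  misses t u counts the words of length t
  -- along which the walk started in u avoids the target at times 0, …, t.
  module Missing {n N : ℕ} (move : Fin n → Fin N → Fin n) (target : Fin n) where

    off : Fin n → ℕ
    off u = if does (u F.≟ target) then 0 else 1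

    off≤1 : ∀ u → off u ≤ 1
    off≤1 u with does (u F.≟ target)
    ... | true  = z≤n
    ... | false = ≤-refl

    off-target : off target ≡ 0
    off-target with target F.≟ target
    ... | yes _ = refl
    ... | no ¬p = contradiction refl ¬p

    off-cases : ∀ u → (u ≡ target × off u ≡ 0) ⊎ (u ≢ target × off u ≡ 1)
    off-cases u with u F.≟ target
    ... | yes p = inj₁ (p , refl)
    ... | no p  = inj₂ (p , refl)

    misses : ℕ → Fin n → ℕ
    misses zero    u = off u
    misses (suc t) u = off u * sum (λ x → misses t (move u x))

    missesWord : ∀ {t} → Fin n → Vec (Fin N) t → ℕ
    missesWord u []      = off u
    missesWord u (x ∷ w) = off u * missesWord (move u x) w

    misses-target : ∀ t → misses t target ≡ 0
    misses-target zero    = off-target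
    misses-target (suc t) = cong (_* sum (λ x → misses t (move target x))) off-target

    off*≤ : ∀ u m → off u * m ≤ m
    off*≤ u m = ≤-trans (*-monoˡ-≤ m (off≤1 u)) (≤-reflexive (+-identityʳ m))

    misses≤ : ∀ t u → misses t u ≤ N ^ t
    misses≤ zero    u = off≤1 u
    misses≤ (suc t) u = ≤-trans (off*≤ u _) (sum-bound (λ x → misses≤ t (move u x)))

    misses-suc≤ : ∀ t u → misses (suc t) u ≤ N * misses t u
    misses-suc≤ zero u = begin
      off u * sum (λ x → off (move u x)) ≤⟨ *-monoʳ-≤ (off u) (sum-bound {N} (λ x → off≤1 (move u x))) ⟩
      off u * (N * 1) ≡⟨ cong (off u *_) (*-identityʳ N) ⟩
      off u * N ≡⟨ *-comm (off u) N ⟩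
      N * off u ∎
    misses-suc≤ (suc t) u = begin
      off u * sum (λ x → misses (suc t) (move u x)) ≤⟨ *-monoʳ-≤ (off u) (sum-mono (λ x → misses-suc≤ t (move u x))) ⟩
      off u * sum (λ x → N * misses t (move u x)) ≡⟨ cong (off u *_) (sym (*-distribˡ-sum N (λ x → misses t (move u x)))) ⟩
      off u * (N * S) ≡⟨ swap (off u) N S ⟩
      N * (off u * S) ∎
      where
      S = sum (λ x → misses t (move u x))
      swap : ∀ a b c → a * (b * c) ≡ b * (a * c)
      swap = solve-∀

    misses-+≤ : ∀ s t u → misses (s + t) u ≤ N ^ s * misses t u
    misses-+≤ zero    t u = ≤-reflexive (sym (+-identityʳ _))
    misses-+≤ (suc s) t u = begin
      misses (suc (s + t)) u ≤⟨ misses-suc≤ (s + t) u ⟩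
      N * misses (s + t) u ≤⟨ *-monoʳ-≤ N (misses-+≤ s t u) ⟩
      N * (N ^ s * misses t u) ≡⟨ sym (*-assoc N _ _) ⟩
      N * N ^ s * misses t u ∎

    -- Markov property: the hypothesis bounds the failures of the last t letters uniformly in the
    -- node where the first s letters end.
    misses-prefix : ∀ c M t → (∀ u → c * misses t u ≤ M) → ∀ s u → c * misses (s + t) u ≤ misses s u * M
    misses-prefix c M t h zero u with off-cases u
    ... | inj₁ (refl , p) rewrite misses-target t = ≤-trans (≤-reflexive (*-zeroʳ c)) z≤n
    ... | inj₂ (_ , p) rewrite p = ≤-trans (h u) (≤-reflexive (sym (+-identityʳ M)))
    misses-prefix c M t h (suc s) u = begin
      c * (off u * sum (λ x → misses (s + t) (move u x))) ≡⟨ swap c (off u) _ ⟩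
      off u * (c * sum (λ x → misses (s + t) (move u x))) ≡⟨ cong (off u *_) (*-distribˡ-sum c (λ x → misses (s + t) (move u x))) ⟩
      off u * sum (λ x → c * misses (s + t) (move u x)) ≤⟨ *-monoʳ-≤ (off u) (sum-mono (λ x → misses-prefix c M t h s (move u x))) ⟩
      off u * sum (λ x → misses s (move u x) * M) ≡⟨ cong (off u *_) (sym (*-distribʳ-sum M (λ x → misses s (move u x)))) ⟩
      off u * (sum (λ x → misses s (move u x)) * M) ≡⟨ sym (*-assoc (off u) _ M) ⟩
      off u * sum (λ x → misses s (move u x)) * M ∎
      where
      swap : ∀ a b c → a * (b * c) ≡ b * (a * c)
      swap = solve-∀

    -- One segment of t letters fails with probability at most 1/2 from every node, so k segments in
    -- a row fail with probability at most 2 ^ -k.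
    misses-amplify : ∀ t → (∀ u → 2 * misses t u ≤ N ^ t) → ∀ k u → 2 ^ k * misses (k * t) u ≤ N ^ (k * t)
    misses-amplify t h zero    u = ≤-trans (≤-reflexive (+-identityʳ _)) (off≤1 u)
    misses-amplify t h (suc k) u = begin
      2 * 2 ^ k * misses (t + k * t) u ≡⟨ *-assoc 2 (2 ^ k) _ ⟩
      2 * (2 ^ k * misses (t + k * t) u) ≤⟨ *-monoʳ-≤ 2 (misses-prefix (2 ^ k) (N ^ (k * t)) (k * t) (misses-amplify t h k) t u) ⟩
      2 * (misses t u * N ^ (k * t)) ≡⟨ sym (*-assoc 2 (misses t u) _) ⟩
      2 * misses t u * N ^ (k * t) ≤⟨ *-monoˡ-≤ (N ^ (k * t)) (h u) ⟩
      N ^ t * N ^ (k * t) ≡⟨ sym (^-distribˡ-+-* N t (k * t)) ⟩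
      N ^ (t + k * t) ∎

    -- Invariance of the uniform distribution under one step, tested against functions: every node
    -- has N incoming letters.
    Balanced : Set
    Balanced = ∀ (g : Fin n → ℕ) → sum (λ u → sum (λ x → g (move u x))) ≡ N * sum g

    -- Kac's formula for the mean return time, in a finite horizon: words are
    -- extended at the front, and balance makes the total telescope.
    module Kac (balanced : Balanced) where

      returns : ℕ → ℕ
      returns t = sum (λ x → misses t (move target x))

      total : ℕ → ℕ
      total t = sum (misses t)

      -- Two counts of the words of length t + 1 whose walk avoids the target at times 1 to t + 1.
      -- Balance gives the right side; on the left the words are sorted by whether the walk starts
      -- at the target.
      telescope : ∀ t → returns t + total (suc t) ≡ N * total t
      telescope t = trans (sym split) (balanced (misses t))
        where
        R : Fin n → ℕ
        R u = sum (λ x → misses t (move u x))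
        pointwise : ∀ u → R u ≡ δ target u * R u + off u * R u
        pointwise u with off-cases u
        ... | inj₁ (refl , p) rewrite p | δ-refl target = sym (trans (+-identityʳ _) (+-identityʳ _))
        ... | inj₂ (q , p) rewrite p | δ-≢ (q ∘ sym) = sym (+-identityʳ _)
        split : sum R ≡ returns t + total (suc t)
        split = trans (sum-cong-≗ pointwise)
                  (trans (∑-distrib-+ (λ u → δ target u * R u) (λ u → off u * R u))
                         (cong (_+ total (suc t)) (sum-δ target R)))

      returns-suc≤ : ∀ t → returns (suc t) ≤ N * returns t
      returns-suc≤ t = ≤-trans (sum-mono (λ x → misses-suc≤ t (move target x)))
                               (≤-reflexive (sym (*-distribˡ-sum N (λ x → misses t (move target x)))))

      -- After division by powers of N, `telescope` sums up to at most n, and the terms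
      -- `returns t / N ^ t` do not increase, so each of the t + 1 terms is at least the last.
      returns≤ : ∀ t → suc t * returns t + total (suc t) ≤ N ^ suc t * n
      returns≤ zero = begin
        returns 0 + 0 + total 1 ≡⟨ cong (_+ total 1) (+-identityʳ (returns 0)) ⟩
        returns 0 + total 1 ≡⟨ telescope 0 ⟩
        N * total 0 ≤⟨ *-monoʳ-≤ N (sum-bound off≤1) ⟩
        N * (n * 1) ≡⟨ reorder N n ⟩
        N * 1 * n ∎
        where
        reorder : ∀ a b → a * (b * 1) ≡ a * 1 * b
        reorder = solve-∀
      returns≤ (suc t) = begin
        suc (suc t) * r′ + total (suc (suc t)) ≡⟨ regroup (suc t) r′ (total (suc (suc t))) ⟩
        suc t * r′ + (r′ + total (suc (suc t))) ≡⟨ cong (suc t * r′ +_) (telescope (suc t)) ⟩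
        suc t * r′ + N * total (suc t) ≤⟨ +-monoˡ-≤ _ (*-monoʳ-≤ (suc t) (returns-suc≤ t)) ⟩
        suc t * (N * returns t) + N * total (suc t) ≡⟨ factor (suc t) N (returns t) (total (suc t)) ⟩
        N * (suc t * returns t + total (suc t)) ≤⟨ *-monoʳ-≤ N (returns≤ t) ⟩
        N * (N ^ suc t * n) ≡⟨ sym (*-assoc N _ n) ⟩
        N ^ suc (suc t) * n ∎
        where
        r′ = returns (suc t)
        regroup : ∀ a b c → suc a * b + c ≡ a * b + (b + c)
        regroup = solve-∀
        factor : ∀ a b c d → a * (b * c) + b * d ≡ b * (a * c + d)
        factor = solve-∀

      misses-neighbour : ∀ t x → suc t * misses t (move target x) ≤ N ^ suc t * n
      misses-neighbour t x = ≤-trans (*-monoʳ-≤ (suc t) (term≤sum (λ y → misses t (move target y)) x))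
                                     (≤-trans (m≤m+n _ _) (returns≤ t))

  module _ {n N : ℕ} (move : Fin n → Fin N → Fin n) where
    open Missing move

    -- A walk that avoids v either avoids w for the first t steps, or avoids v
    -- for at least s steps after its first visit to w.
    misses-via : ∀ s v w t u → misses v (t + s) u ≤ misses w t u * N ^ s + N ^ t * misses v s w
    misses-via s v w t u with off-cases w u
    ... | inj₁ (refl , p) = ≤-trans (misses-+≤ v t s w) (m≤n+m _ _)
    misses-via s v w zero u | inj₂ (_ , p) = begin
      misses v s u ≤⟨ misses≤ v s u ⟩
      N ^ s ≡⟨ sym (+-identityʳ _) ⟩
      1 * N ^ s ≡⟨ cong (_* N ^ s) (sym p) ⟩
      off w u * N ^ s ≤⟨ m≤m+n _ _ ⟩
      off w u * N ^ s + (misses v s w + 0) ∎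
    misses-via s v w (suc t) u | inj₂ (_ , p) = begin
      off v u * sum (λ x → misses v (t + s) (move u x)) ≤⟨ off*≤ v u _ ⟩
      sum (λ x → misses v (t + s) (move u x)) ≤⟨ sum-mono (λ x → misses-via s v w t (move u x)) ⟩
      sum (λ x → misses w t (move u x) * N ^ s + N ^ t * misses v s w) ≡⟨ ∑-distrib-+ (λ x → misses w t (move u x) * N ^ s) (λ x → N ^ t * misses v s w) ⟩
      sum (λ x → misses w t (move u x) * N ^ s) + sum {N} (λ x → N ^ t * misses v s w)
        ≡⟨ cong₂ _+_ (sym (*-distribʳ-sum (N ^ s) (λ x → misses w t (move u x)))) (sum-const N _) ⟩
      S * N ^ s + N * (N ^ t * misses v s w) ≡⟨ cong₂ _+_ (cong (_* N ^ s) (trans (sym (+-identityʳ S)) (cong (_* S) (sym p)))) (sym (*-assoc N (N ^ t) _)) ⟩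
      off w u * S * N ^ s + N * N ^ t * misses v s w ∎
      where S = sum (λ x → misses w t (move u x))

    -- A letter leads from `w` to the node before it, against the direction of travel:
    -- `misses-neighbour` bounds the time to hit `w` from a node that one letter reaches from `w`.
    data Path (v : Fin n) : ℕ → Fin n → Set where
      path-end : Path v 0 v
      path-via : ∀ {l} w x → Path v l w → Path v (suc l) (move w x)

    -- Each edge is allotted t steps and fails with probability at most N n / (t + 1) by
    -- `misses-neighbour`; `misses-via` adds the failures.
    misses-path : (∀ v → Balanced v) → ∀ t {v l u} → Path v l u →
                  suc t * misses v (l * t) u ≤ l * (N ^ (l * t) * (N * n))
    misses-path bal t {v} path-end = ≤-trans (≤-reflexive (trans (cong (suc t *_) (misses-target v 0)) (*-zeroʳ (suc t)))) z≤n
    misses-path bal t {v} {suc l} (path-via w x p) = begin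
      suc t * misses v (t + l * t) u ≤⟨ *-monoʳ-≤ (suc t) (misses-via (l * t) v w t u) ⟩
      suc t * (misses w t u * A + N ^ t * misses v (l * t) w) ≡⟨ expand (suc t) (misses w t u) A (N ^ t) (misses v (l * t) w) ⟩
      suc t * misses w t u * A + N ^ t * (suc t * misses v (l * t) w)
        ≤⟨ +-mono-≤ (*-monoˡ-≤ A (Kac.misses-neighbour w (bal w) t x)) (*-monoʳ-≤ (N ^ t) (misses-path bal t p)) ⟩
      N * N ^ t * n * A + N ^ t * (l * (A * (N * n))) ≡⟨ collect N (N ^ t) n A l ⟩
      suc l * (N ^ t * A * (N * n)) ≡⟨ cong (λ z → suc l * (z * (N * n))) (sym (^-distribˡ-+-* N t (l * t))) ⟩
      suc l * (N ^ (t + l * t) * (N * n)) ∎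
      where
      u = move w x
      A = N ^ (l * t)
      expand : ∀ a b c d e → a * (b * c + d * e) ≡ a * b * c + d * (a * e)
      expand = solve-∀
      collect : ∀ a b c d e → a * b * c * d + b * (e * (d * (a * c))) ≡ suc e * (b * d * (a * c))
      collect = solve-∀

  sumWords : ∀ {N} L → (Vec (Fin N) L → ℕ) → ℕ
  sumWords zero    f = f []
  sumWords (suc L) f = sum (λ x → sumWords L (λ w → f (x ∷ w)))

  sumWords-* : ∀ {N} L c (f : Vec (Fin N) L → ℕ) → sumWords L (λ w → c * f w) ≡ c * sumWords L f
  sumWords-* zero    c f = refl
  sumWords-* (suc L) c f = trans (sum-cong-≗ (λ x → sumWords-* L c (λ w → f (x ∷ w))))
                                 (sym (*-distribˡ-sum c (λ x → sumWords L (λ w → f (x ∷ w)))))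

  sumWords-sum : ∀ {N m} L (f : Fin m → Vec (Fin N) L → ℕ) →
                 sumWords L (λ w → sum (λ i → f i w)) ≡ sum (λ i → sumWords L (f i))
  sumWords-sum zero    f = refl
  sumWords-sum (suc L) f = trans (sum-cong-≗ (λ x → sumWords-sum L (λ i w → f i (x ∷ w))))
                                 (∑-comm (λ x i → sumWords L (λ w → f i (x ∷ w))))

  -- The method of conditional expectations.
  word-below-average : ∀ {N} L (f : Vec (Fin N) L → ℕ) → sumWords L f < N ^ L → ∃ λ w → f w ≡ 0
  word-below-average zero    f h = [] , n<1⇒n≡0 h
  word-below-average {N} (suc L) f h with below-average (λ x → sumWords L (λ w → f (x ∷ w))) (N ^ L) h
  ... | x , q with word-below-average L (λ w → f (x ∷ w)) q
  ... | w , e = x ∷ w , e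

  sumWords-misses : ∀ {n N} (move : Fin n → Fin N → Fin n) v L u →
                    sumWords L (Missing.missesWord move v u) ≡ Missing.misses move v L u
  sumWords-misses move v zero    u = refl
  sumWords-misses move v (suc L) u =
    trans (sum-cong-≗ (λ x → trans (sumWords-* L (off u) _) (cong (off u *_) (sumWords-misses move v L (move u x)))))
          (sym (*-distribˡ-sum (off u) (λ x → misses L (move u x))))
    where open Missing move v

open RandomWalks

-- Universal traversal sequences of polynomial length

module UniversalTraversal where

  open ≤-Reasoning

  lookup-injective : ∀ {A : Set} {xs : List A} → Unique xs → ∀ i j → lookup xs i ≡ lookup xs j → i ≡ j
  lookup-injective (px ∷ u) zero    zero    e = refl
  lookup-injective {xs = x ∷ xs} (px ∷ u) zero (suc j) e = contradiction e (All.lookup px (∈-lookup j))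
  lookup-injective {xs = x ∷ xs} (px ∷ u) (suc i) zero e = contradiction (sym e) (All.lookup px (∈-lookup i))
  lookup-injective (px ∷ u) (suc i) (suc j) e = cong suc (lookup-injective u i j e)

  unique-length≤ : ∀ {n} {xs : List (Fin n)} → Unique xs → length xs ≤ n
  unique-length≤ u = F.injective⇒≤ (λ {i} {j} → lookup-injective u i j)

  sum-δ-unique : ∀ {n N} (f : Fin N → Fin n) v x₀ → f x₀ ≡ v → (∀ x → f x ≡ v → x ≡ x₀) →
                 sum (λ x → δ (f x) v) ≡ 1
  sum-δ-unique f v x₀ refl uniq =
    trans (sum-single x₀ (λ x x≢ → δ-≢ (x≢ ∘ uniq x))) (δ-refl (f x₀))

  module _ {n : ℕ} (G : PortGraph n) where
    open PortGraph G
    open import Data.List.Membership.DecPropositional (F._≟_ {n}) using (_∈?_)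

    moveTo : Fin n → ℕ → Fin n
    moveTo u p with p <? deg u
    ... | yes p<d = nbr u (fromℕ< p<d)
    ... | no _    = u

    moveTo-nbr : ∀ u (p : Fin (deg u)) → moveTo u (toℕ p) ≡ nbr u p
    moveTo-nbr u p with toℕ p <? deg u
    ... | yes q = cong (nbr u) (F.fromℕ<-toℕ p q)
    ... | no ¬q = contradiction (F.toℕ<n p) ¬q

    walk : Fin n → List ℕ → Fin n
    walk u []       = u
    walk u (p ∷ ps) = walk (moveTo u p) ps

    deg<n : ∀ v → deg v < n
    deg<n v = F.injective⇒≤ {f = f} inj
      where
      f : Fin (suc (deg v)) → Fin n
      f zero    = v
      f (suc p) = nbr v p
      inj : ∀ {p q} → f p ≡ f q → p ≡ q
      inj {zero}  {zero}  e = refl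
      inj {zero}  {suc q} e = contradiction (sym e) (no-loop v q)
      inj {suc p} {zero}  e = contradiction e (no-loop v p)
      inj {suc p} {suc q} e = cong suc (no-multi v p q e)

    walkLength : ∀ {u v} → Walk deg nbr u v → ℕ
    walkLength here       = 0
    walkLength (step p w) = suc (walkLength w)

    left : ∀ {u v} → Walk deg nbr u v → List (Fin n)
    left here           = []
    left (step {u} p w) = u ∷ left w

    length-left : ∀ {u v} (w : Walk deg nbr u v) → length (left w) ≡ walkLength w
    length-left here       = refl
    length-left (step p w) = cong suc (length-left w)

    cut : ∀ {u v x} (w : Walk deg nbr u v) → Unique (left w) → x ∈ left w →
          Σ (Walk deg nbr x v) λ w′ → Unique (left w′)
    cut (step p w) un (here refl) = step p w , un
    cut (step p w) (_ ∷ un) (there x∈) = cut w un x∈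

    loop-erase : ∀ {u v} → Walk deg nbr u v → Σ (Walk deg nbr u v) λ w → Unique (left w)
    loop-erase here = here , []
    loop-erase (step {u} p w) with loop-erase w
    ... | w′ , un with u ∈? left w′
    ... | yes u∈ = cut w′ un u∈
    ... | no u∉  = step p w′ , All.tabulate (λ y∈ e → u∉ (subst (_∈ left w′) (sym e) y∈)) ∷ un

    short-walk : ∀ u v → Σ (Walk deg nbr u v) λ w → walkLength w ≤ n
    short-walk u v with loop-erase (connected u v)
    ... | w , un = w , subst (_≤ n) (length-left w) (unique-length≤ un)

    module Letters {N : ℕ} (n≤N : n ≤ N) where

      stepN : Fin n → Fin N → Fin n
      stepN u x = moveTo u (toℕ x)

      letter : ∀ u → Fin (deg u) → Fin N
      letter u p = inject≤ p (<⇒≤ (<-≤-trans (deg<n u) n≤N))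

      stepN-letter : ∀ u p → stepN u (letter u p) ≡ nbr u p
      stepN-letter u p = trans (cong (moveTo u) (F.toℕ-inject≤ p _)) (moveTo-nbr u p)

      -- For u ≢ v, the letters leading from u to v number 0 or 1.
      edges : Fin n → Fin n → ℕ
      edges u v = sum (λ x → δ (stepN u x) v)

      stepN-inv : ∀ u v x → u ≢ v → stepN u x ≡ v → Σ (Fin (deg u)) λ p → nbr u p ≡ v × toℕ x ≡ toℕ p
      stepN-inv u v x u≢v e with toℕ x <? deg u
      ... | yes q = fromℕ< q , e , sym (F.toℕ-fromℕ< q)
      ... | no _  = contradiction e u≢v

      edges-one : ∀ u v → u ≢ v → (p : Fin (deg u)) → nbr u p ≡ v → edges u v ≡ 1
      edges-one u v u≢v p e = sum-δ-unique (stepN u) v (letter u p) (trans (stepN-letter u p) e) uniq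
        where
        uniq : ∀ x → stepN u x ≡ v → x ≡ letter u p
        uniq x ex with stepN-inv u v x u≢v ex
        ... | q , eq , exq = F.toℕ-injective
          (trans exq (trans (cong toℕ (no-multi u q p (trans eq (sym e)))) (sym (F.toℕ-inject≤ p _))))

      edges-sym : ∀ u v → edges u v ≡ edges v u
      edges-sym u v with u F.≟ v
      ... | yes refl = refl
      ... | no u≢v with F.any? (λ p → nbr u p F.≟ v)
      ... | yes (p , refl) = trans (edges-one u v u≢v p refl)
                                   (sym (edges-one v u (u≢v ∘ sym) (back u p) (back-nbr u p)))
      ... | no none with F.any? (λ p → nbr v p F.≟ u)
      ... | yes (p , refl) = contradiction (back v p , back-nbr v p) none
      ... | no none′ = trans (sum-zero (λ x → δ-≢ (λ e → absurd u v none u≢v x e)))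
                             (sym (sum-zero (λ x → δ-≢ (λ e → absurd v u none′ (u≢v ∘ sym) x e))))
        where
        absurd : ∀ a b → ¬ (Σ (Fin (deg a)) λ p → nbr a p ≡ b) → a ≢ b → ∀ x → stepN a x ≢ b
        absurd a b non a≢b x e with stepN-inv a b x a≢b e
        ... | p , q , _ = non (p , q)

      edges-total : ∀ v → sum (edges v) ≡ N
      edges-total v = begin-equality
        sum (λ u → sum (λ x → δ (stepN v x) u)) ≡⟨ ∑-comm (λ u x → δ (stepN v x) u) ⟩
        sum (λ x → sum (λ u → δ (stepN v x) u)) ≡⟨ sum-cong-≗ (λ x → trans (sum-cong-≗ (λ u → sym (*-identityʳ (δ (stepN v x) u)))) (sum-δ (stepN v x) (λ _ → 1))) ⟩
        sum {N} (λ x → 1) ≡⟨ sum-const N 1 ⟩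
        N * 1 ≡⟨ *-identityʳ N ⟩
        N ∎

      -- Every edge has one port at either end, so the matrix `edges` is symmetric and its column
      -- sums are its row sums N.
      balanced : ∀ v → Missing.Balanced stepN v
      balanced _ g = begin-equality
        sum (λ u → sum (λ x → g (stepN u x))) ≡⟨ sum-cong-≗ (λ u → sum-cong-≗ (λ x → sym (sum-δ (stepN u x) g))) ⟩
        sum (λ u → sum (λ x → sum (λ v → δ (stepN u x) v * g v))) ≡⟨ sum-cong-≗ (λ u → trans (∑-comm (λ x v → δ (stepN u x) v * g v)) (sum-cong-≗ (λ v → sym (*-distribʳ-sum (g v) (λ x → δ (stepN u x) v))))) ⟩
        sum (λ u → sum (λ v → edges u v * g v)) ≡⟨ ∑-comm (λ u v → edges u v * g v) ⟩
        sum (λ v → sum (λ u → edges u v * g v)) ≡⟨ sum-cong-≗ (λ v → trans (sum-cong-≗ (λ u → cong (_* g v) (edges-sym u v))) (sym (*-distribʳ-sum (g v) (edges v)))) ⟩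
        sum (λ v → sum (edges v) * g v) ≡⟨ sum-cong-≗ (λ v → cong (_* g v) (edges-total v)) ⟩
        sum (λ v → N * g v) ≡⟨ sym (*-distribˡ-sum N g) ⟩
        N * sum g ∎

      toPath : ∀ {u v} (w : Walk deg nbr u v) → Path stepN v (walkLength w) u
      toPath here = path-end
      toPath {v = v} (step {u} p w) =
        subst (Path stepN v _) (trans (stepN-letter (nbr u p) (back u p)) (back-nbr u p))
              -- The port at the far end is taken, since a `Path` reads its edges backwards.
              (path-via (nbr u p) (letter (nbr u p) (back u p)) (toPath w))

  cube : ℕ → ℕ
  cube N = N * (N * N)

  -- Up to N edges with 2 N³ steps for each: in `misses-path` the failures then add up to at most N
  -- * N² / (2 N³), one half.
  segment : ℕ → ℕ
  segment N = N * (2 * cube N)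

  module _ {n N : ℕ} .{{_ : NonZero N}} (G : PortGraph n) (n≤N : n ≤ N) where
    open Letters G n≤N

    misses-half : ∀ v u → 2 * Missing.misses stepN v (segment N) u ≤ N ^ segment N
    misses-half v u with short-walk G u v
    ... | w , l≤n = *-cancelʳ-≤ (2 * m) (N ^ segment N) (cube N) {{cube≢0}} (begin
        2 * m * cube N ≡⟨ reorder 2 m (cube N) ⟩
        t * m ≤⟨ *-monoˡ-≤ m (n≤1+n t) ⟩
        suc t * m ≡⟨ cong (λ z → suc t * misses z u) lengths ⟩
        -- A path with fewer than N edges leaves letters over, and further letters do not raise the
        -- share of failing words.
        suc t * misses ((N ∸ l) * t + l * t) u ≤⟨ *-monoʳ-≤ (suc t) (misses-+≤ ((N ∸ l) * t) (l * t) u) ⟩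
        suc t * (A * misses (l * t) u) ≡⟨ swap (suc t) A _ ⟩
        A * (suc t * misses (l * t) u) ≤⟨ *-monoʳ-≤ A (misses-path stepN balanced t (toPath w)) ⟩
        A * (l * (B * (N * n))) ≡⟨ collect A l B (N * n) ⟩
        A * B * (l * (N * n)) ≤⟨ *-monoʳ-≤ (A * B) (*-mono-≤ l≤N (*-monoʳ-≤ N n≤N)) ⟩
        A * B * cube N ≡⟨ cong (_* cube N) (sym (^-distribˡ-+-* N ((N ∸ l) * t) (l * t))) ⟩
        N ^ ((N ∸ l) * t + l * t) * cube N ≡⟨ cong (λ z → N ^ z * cube N) (sym lengths) ⟩
        N ^ segment N * cube N ∎)
      where
      open Missing stepN v using (misses; misses-+≤)
      cube≢0 : NonZero (cube N)
      cube≢0 = let instance _ = m*n≢0 N N in m*n≢0 N (N * N)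
      t = 2 * cube N
      l = walkLength G w
      l≤N = ≤-trans l≤n n≤N
      m = misses (segment N) u
      A = N ^ ((N ∸ l) * t)
      B = N ^ (l * t)
      lengths : N * t ≡ (N ∸ l) * t + l * t
      lengths = trans (cong (_* t) (sym (m∸n+n≡m l≤N))) (*-distribʳ-+ t (N ∸ l) l)
      reorder : ∀ a b c → a * b * c ≡ a * c * b
      reorder = solve-∀
      swap : ∀ a b c → a * (b * c) ≡ b * (a * c)
      swap = solve-∀
      collect : ∀ a b c d → a * (b * (c * d)) ≡ a * c * (b * d)
      collect = solve-∀

  module _ {n m N : ℕ} (move : Fin n → Fin N → Fin n) (move′ : Fin m → Fin N → Fin m)
           (φ : Fin n → Fin m) (φ-inj : ∀ u v → φ u ≡ φ v → u ≡ v)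
           (φ-move : ∀ u x → move′ (φ u) x ≡ φ (move u x)) (v : Fin n) where
    private
      module M  = Missing move v
      module M′ = Missing move′ (φ v)

    off-embed : ∀ u → M′.off (φ u) ≡ M.off u
    off-embed u with φ u F.≟ φ v | u F.≟ v
    ... | yes _ | yes _    = refl
    ... | yes e | no u≢v   = contradiction (φ-inj u v e) u≢v
    ... | no ne | yes refl = contradiction refl ne
    ... | no _  | no _     = refl

    -- Copied into `Fin N`, the walks on all graphs with at most N nodes belong to one finite family
    -- of transition tables, over which a union bound is possible.
    misses-embed : ∀ t u → M′.misses t (φ u) ≡ M.misses t u
    misses-embed zero    u = off-embed u
    misses-embed (suc t) u = cong₂ _*_ (off-embed u)
      (sum-cong-≗ (λ x → trans (cong (M′.misses t) (φ-move u x)) (misses-embed t (move u x))))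

    missesWord-embed : ∀ {t} (w : Vec (Fin N) t) u → M′.missesWord (φ u) w ≡ M.missesWord u w
    missesWord-embed []      u = off-embed u
    missesWord-embed (x ∷ w) u = cong₂ _*_ (off-embed u)
      (trans (cong (λ z → M′.missesWord z w) (φ-move u x)) (missesWord-embed w (move u x)))

  -- Transition tables on N nodes, encoded as numbers.
  tables : ℕ → ℕ
  tables N = (N ^ N) ^ N

  table : ∀ N → Fin (tables N) → Fin N → Fin N → Fin N
  table N c u x = finToFun (finToFun c u) x

  encode : ∀ N → (Fin N → Fin N → Fin N) → Fin (tables N)
  encode N f = funToFin (λ u → funToFin (f u))

  table-encode : ∀ N f u x → table N (encode N f) u x ≡ f u x
  table-encode N f u x = trans (cong (λ z → finToFun z x) (F.finToFun-funToFin (λ u → funToFin (f u)) u))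
                               (F.finToFun-funToFin (f u) x)

  -- Large enough that 2 ^ `repeats N` exceeds the number of triples of a table, a start and a
  -- target: N ≤ 2 ^ N bounds that number by 2 ^ (N³ + 2 N).
  repeats : ℕ → ℕ
  repeats N = suc (cube N + (N + N))

  utsLength : ℕ → ℕ
  utsLength N = repeats N * segment N

  n<2^n : ∀ n → n < 2 ^ n
  n<2^n zero    = s≤s z≤n
  n<2^n (suc n) = begin-strict
    suc n <⟨ s≤s (n<2^n n) ⟩
    1 + 2 ^ n ≤⟨ +-monoˡ-≤ (2 ^ n) (m^n>0 2 n) ⟩
    2 ^ n + 2 ^ n ≡⟨ cong (2 ^ n +_) (sym (+-identityʳ _)) ⟩
    2 * 2 ^ n ∎

  instances<2^repeats : ∀ N → tables N * (N * N) < 2 ^ repeats N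
  instances<2^repeats N = begin-strict
    (N ^ N) ^ N * (N * N) ≡⟨ cong (_* (N * N)) (^-*-assoc N N N) ⟩
    N ^ (N * N) * (N * N) ≤⟨ *-mono-≤ (^-monoˡ-≤ (N * N) (<⇒≤ (n<2^n N))) (*-mono-≤ (<⇒≤ (n<2^n N)) (<⇒≤ (n<2^n N))) ⟩
    (2 ^ N) ^ (N * N) * (2 ^ N * 2 ^ N) ≡⟨ cong₂ _*_ (^-*-assoc 2 N (N * N)) (sym (^-distribˡ-+-* 2 N N)) ⟩
    2 ^ cube N * 2 ^ (N + N) ≡⟨ sym (^-distribˡ-+-* 2 (cube N) (N + N)) ⟩
    2 ^ (cube N + (N + N)) <⟨ ^-monoʳ-< 2 (s≤s (s≤s z≤n)) (n<1+n (cube N + (N + N))) ⟩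
    2 ^ repeats N ∎

  gated : ∀ a m b (d : Dec (a * m ≤ b)) → a * ((if does d then 1 else 0) * m) ≤ b
  gated a m b (yes p) = ≤-trans (≤-reflexive (cong (a *_) (+-identityʳ m))) p
  gated a m b (no _)  = ≤-trans (≤-reflexive (*-zeroʳ a)) z≤n

  module Universal (N : ℕ) .{{N≢0 : NonZero N}} where
    private
      K = repeats N
      L = utsLength N
      open Missing using (misses; missesWord)

      good? : ∀ c u v → Dec (2 ^ K * misses (table N c) v L u ≤ N ^ L)
      good? c u v = 2 ^ K * misses (table N c) v L u ≤? N ^ L

      -- Many tables come from no graph. Only triples for which failure is rare are charged, a
      -- decidable condition that replaces a description of the tables of port graphs.
      gate : Fin (tables N) → Fin N → Fin N → ℕ
      gate c u v = if does (good? c u v) then 1 else 0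

      cost : Fin (tables N) → Fin N → Fin N → Vec (Fin N) L → ℕ
      cost c u v w = gate c u v * missesWord (table N c) v u w

      total : Vec (Fin N) L → ℕ
      total w = sum (λ c → sum (λ u → sum (λ v → cost c u v w)))

      cost-sum : ∀ c u v → 2 ^ K * sumWords L (cost c u v) ≤ N ^ L
      cost-sum c u v = ≤-trans
        (≤-reflexive (cong (2 ^ K *_) (trans (sumWords-* L (gate c u v) (missesWord (table N c) v u))
                                             (cong (gate c u v *_) (sumWords-misses (table N c) v L u)))))
        (gated (2 ^ K) (misses (table N c) v L u) (N ^ L) (good? c u v))

      total-sum : sumWords L total ≡ sum (λ c → sum (λ u → sum (λ v → sumWords L (cost c u v))))
      total-sum = trans (sumWords-sum L (λ c w → sum (λ u → sum (λ v → cost c u v w))))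
        (sum-cong-≗ (λ c → trans (sumWords-sum L (λ u w → sum (λ v → cost c u v w)))
          (sum-cong-≗ (λ u → sumWords-sum L (λ v w → cost c u v w)))))

      scaled : 2 ^ K * sumWords L total ≤ tables N * (N * N) * N ^ L
      scaled = begin
        2 ^ K * sumWords L total
          ≡⟨ cong (2 ^ K *_) total-sum ⟩
        2 ^ K * sum (λ c → sum (λ u → sum (λ v → sumWords L (cost c u v))))
          ≡⟨ *-distribˡ-sum (2 ^ K) (λ c → sum (λ u → sum (λ v → sumWords L (cost c u v)))) ⟩
        sum (λ c → 2 ^ K * sum (λ u → sum (λ v → sumWords L (cost c u v))))
          ≤⟨ sum-bound {tables N} (λ c → ≤-trans (≤-reflexive (*-distribˡ-sum (2 ^ K) (λ u → sum (λ v → sumWords L (cost c u v)))))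
               (sum-bound {N} (λ u → ≤-trans (≤-reflexive (*-distribˡ-sum (2 ^ K) (λ v → sumWords L (cost c u v))))
                 (sum-bound {N} (λ v → cost-sum c u v))))) ⟩
        tables N * (N * (N * N ^ L))
          ≡⟨ reassoc (tables N) N (N ^ L) ⟩
        tables N * (N * N) * N ^ L ∎
        where
        reassoc : ∀ a b c → a * (b * (b * c)) ≡ a * (b * b) * c
        reassoc = solve-∀

      -- A gated triple fails on a share of at most 2 ^ -K of the words, and there are fewer than 2
      -- ^ K triples, so the average cost is below 1.
      small : sumWords L total < N ^ L
      small = *-cancelˡ-< (2 ^ K) _ _ (≤-<-trans scaled
        (*-monoˡ-< (N ^ L) {{m^n≢0 N L}} (instances<2^repeats N)))

      found : ∃ λ w → total w ≡ 0
      found = word-below-average L total small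

    word : Vec (Fin N) L
    word = proj₁ found

    word-hits : ∀ c u v → 2 ^ K * misses (table N c) v L u ≤ N ^ L → missesWord (table N c) v u word ≡ 0
    word-hits c u v p = trans (sym (+-identityʳ _)) (trans (cong (_* missesWord (table N c) v u word) (sym gate≡1)) cost≡0)
      where
      gate≡1 : gate c u v ≡ 1
      gate≡1 = cong (λ b → if b then 1 else 0) (dec-true (good? c u v) p)
      cost≡0 : cost c u v word ≡ 0
      cost≡0 = n≤0⇒n≡0 (begin
        cost c u v word ≤⟨ term≤sum (λ v → cost c u v word) v ⟩
        sum (λ v → cost c u v word) ≤⟨ term≤sum (λ u → sum (λ v → cost c u v word)) u ⟩
        sum (λ u → sum (λ v → cost c u v word)) ≤⟨ term≤sum (λ c → sum (λ u → sum (λ v → cost c u v word))) c ⟩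
        total word ≡⟨ proj₂ found ⟩
        0 ∎)

  ports : ∀ {N L} → Vec (Fin N) L → List ℕ
  ports []      = []
  ports (x ∷ w) = toℕ x ∷ ports w

  length-ports : ∀ {N L} (w : Vec (Fin N) L) → length (ports w) ≡ L
  length-ports []      = refl
  length-ports (x ∷ w) = cong suc (length-ports w)

  module _ {n N : ℕ} .{{_ : NonZero N}} (G : PortGraph n) (n≤N : n ≤ N) where
    open Letters G n≤N

    private
      φ : Fin n → Fin N
      φ u = inject≤ u n≤N

      extended : Fin N → Fin N → Fin N
      extended u x with toℕ u <? n
      ... | yes q = φ (stepN (fromℕ< q) x)
      -- Nodes outside the copy of the graph stay put; walks that start in the copy remain in it.
      ... | no _  = u

      φ-step : ∀ u x → table N (encode N extended) (φ u) x ≡ φ (stepN u x)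
      φ-step u x = trans (table-encode N extended (φ u) x) lemma
        where
        lemma : extended (φ u) x ≡ φ (stepN u x)
        lemma with toℕ (φ u) <? n
        ... | yes q = cong (λ z → φ (stepN z x))
                        (F.toℕ-injective (trans (F.toℕ-fromℕ< q) (F.toℕ-inject≤ u n≤N)))
        ... | no ¬q = contradiction (subst (_< n) (sym (F.toℕ-inject≤ u n≤N)) (F.toℕ<n u)) ¬q

      φ-inj : ∀ u v → φ u ≡ φ v → u ≡ v
      φ-inj = F.inject≤-injective n≤N n≤N

    missed⇒visited : ∀ {L} v u (w : Vec (Fin N) L) → Missing.missesWord stepN v u w ≡ 0 →
                     ∃ λ j → j ≤ L × walk G u (take j (ports w)) ≡ v
    missed⇒visited v u w e with Missing.off-cases stepN v u
    ... | inj₁ (refl , _) = 0 , z≤n , refl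
    missed⇒visited v u [] e | inj₂ (_ , q) = contradiction (trans (sym q) e) λ ()
    missed⇒visited v u (x ∷ w) e | inj₂ (_ , q)
      with missed⇒visited v (stepN u x) w (trans (sym (+-identityʳ _)) (trans (cong (_* Missing.missesWord stepN v (stepN u x) w) (sym q)) e))
    ... | j , j≤ , r = suc j , s≤s j≤ , r

    word-visits : ∀ u v → ∃ λ j → j ≤ utsLength N × walk G u (take j (ports (Universal.word N))) ≡ v
    word-visits u v = missed⇒visited v u word
      (trans (sym (missesWord-embed stepN (table N c) φ φ-inj φ-step v word u))
        (word-hits c (φ u) (φ v)
          (≤-trans (≤-reflexive (cong (2 ^ repeats N *_) (misses-embed stepN (table N c) φ φ-inj φ-step v (utsLength N) u)))
                   (Missing.misses-amplify stepN v (segment N) (misses-half G n≤N v) (repeats N) u))))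
      where
      c = encode N extended
      open Universal N using (word; word-hits)

  abstract
    uts : ∀ N .{{_ : NonZero N}} → List ℕ
    uts N = ports (Universal.word N)

    length-uts : ∀ N .{{_ : NonZero N}} → length (uts N) ≡ utsLength N
    length-uts N = length-ports (Universal.word N)

    uts-visits : ∀ {n N} .{{_ : NonZero N}} (G : PortGraph n) → n ≤ N → ∀ u v →
                 ∃ λ j → j ≤ utsLength N × walk G u (take j (uts N)) ≡ v
    uts-visits = word-visits

open UniversalTraversal

-- Moving in slots

-- A hop records the degree of the node left, the port taken and the port of
-- entry.  A trace is the stack of hops leading from the home of an agent to
-- its current node, latest hop first.
Hop : Set
Hop = ℕ × ℕ × ℕ

Trace : Set
Trace = List Hop

data Dir : Set where
  wait : Dir
  fwd  : ℕ → Dir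
  undo : Dir

Cmd : Set
Cmd = Trace → ℕ → Dir

idle : Cmd
idle _ _ = wait

retreat : Cmd
retreat _ _ = undo

module Motion {n : ℕ} (G : PortGraph n) where
  open PortGraph G

  Config : Set
  Config = Fin n × Trace

  exec : Config → Dir → Config
  exec c wait = c
  exec (u , tr) (fwd p) with p <? deg u
  ... | yes p<d = nbr u (fromℕ< p<d) , (deg u , p , toℕ (back u (fromℕ< p<d))) ∷ tr
  ... | no _    = u , tr
  exec (u , [])              undo = u , []
  exec (u , (_ , _ , e) ∷ tr) undo = moveTo G u e , tr

  perform : Cmd → Config → Config
  perform c x = exec x (c (proj₂ x) (deg (proj₁ x)))

  conf : List Cmd → ℕ → Config → Config
  conf cs       zero    x = x
  conf []       (suc φ) x = x
  conf (c ∷ cs) (suc φ) x = conf cs φ (perform c x)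

  data Route (home : Fin n) : Trace → Fin n → Set where
    root : Route home [] home
    hop   : ∀ {tr u} → Route home tr u → (p : Fin (deg u)) →
            Route home ((deg u , toℕ p , toℕ (back u p)) ∷ tr) (nbr u p)

  exec-route : ∀ {home u tr} d → Route home tr u →
               Route home (proj₂ (exec (u , tr) d)) (proj₁ (exec (u , tr) d))
  exec-route wait r = r
  exec-route {home} {u} {tr} (fwd p) r with p <? deg u
  ... | yes p<d = subst (λ z → Route home ((deg u , z , toℕ (back u (fromℕ< p<d))) ∷ tr) (nbr u (fromℕ< p<d)))
                        (F.toℕ-fromℕ< p<d) (hop r (fromℕ< p<d))
  ... | no _ = r
  exec-route undo root = root
  exec-route {home} undo (hop {tr} {u} r p) =
    subst (Route home tr) (sym (trans (moveTo-nbr G (nbr u p) (back u p)) (back-nbr u p))) r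

  conf-route : ∀ {home} cs φ {x : Config} → Route home (proj₂ x) (proj₁ x) →
               Route home (proj₂ (conf cs φ x)) (proj₁ (conf cs φ x))
  conf-route cs       zero    r = r
  conf-route []       (suc φ) r = r
  conf-route (c ∷ cs) (suc φ) {u , tr} r = conf-route cs φ (exec-route (c tr (deg u)) r)

  route-[] : ∀ {home u} → Route home [] u → u ≡ home
  route-[] root = refl

  conf-[] : ∀ φ x → conf [] φ x ≡ x
  conf-[] zero    x = refl
  conf-[] (suc φ) x = refl

  conf-++ˡ : ∀ cs ds φ x → φ ≤ length cs → conf (cs ++ ds) φ x ≡ conf cs φ x
  conf-++ˡ cs       ds zero    x _       = refl
  conf-++ˡ (c ∷ cs) ds (suc φ) x (s≤s l) = conf-++ˡ cs ds φ (perform c x) l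

  conf-++ʳ : ∀ cs ds φ x → conf (cs ++ ds) (length cs + φ) x ≡ conf ds φ (conf cs (length cs) x)
  conf-++ʳ []       ds φ x = refl
  conf-++ʳ (c ∷ cs) ds φ x = conf-++ʳ cs ds φ (perform c x)

  conf-beyond : ∀ cs φ x → length cs ≤ φ → conf cs φ x ≡ conf cs (length cs) x
  conf-beyond []       φ       x _       = conf-[] φ x
  conf-beyond (c ∷ cs) (suc φ) x (s≤s l) = conf-beyond cs φ (perform c x) l

  conf-suc : ∀ cs φ x c {ds} → drop φ cs ≡ c ∷ ds → conf cs (suc φ) x ≡ perform c (conf cs φ x)
  conf-suc (c ∷ cs) zero    x .c refl = refl
  conf-suc (b ∷ cs) (suc φ) x c e     = conf-suc cs φ (perform b x) c e

  conf-idle : ∀ a φ x → conf (replicate a idle) φ x ≡ x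
  conf-idle a       zero    x = refl
  conf-idle zero    (suc φ) x = refl
  conf-idle (suc a) (suc φ) x = conf-idle a φ x

  conf-delay : ∀ a cs φ x → conf (replicate a idle ++ cs) φ x ≡ conf cs (φ ∸ a) x
  conf-delay zero    cs φ       x = refl
  conf-delay (suc a) cs zero    x = refl
  conf-delay (suc a) cs (suc φ) x = conf-delay a cs φ x

spread : ℕ → List Cmd → List Cmd
spread p []       = []
spread p (c ∷ cs) = replicate p idle ++ c ∷ spread p cs

length-spread : ∀ p cs → length (spread p cs) ≡ length cs * suc p
length-spread p []       = refl
length-spread p (c ∷ cs) = begin-equality
  length (replicate p idle ++ c ∷ spread p cs) ≡⟨ length-++ (replicate p idle) ⟩
  length (replicate p idle) + suc (length (spread p cs)) ≡⟨ cong₂ (λ a b → a + suc b) (length-replicate p) (length-spread p cs) ⟩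
  p + suc (length cs * suc p) ≡⟨ +-suc p _ ⟩
  suc p + length cs * suc p ∎
  where open ≤-Reasoning

module _ {n : ℕ} (G : PortGraph n) where
  open Motion G

  -- The command comes last in each block of `suc p` rounds, so `φ / suc p` counts the completed
  -- blocks; waiting at the end changes nothing.
  conf-spread : ∀ p b cs φ x → conf (spread p cs ++ replicate b idle) φ x ≡ conf cs (φ / suc p) x
  conf-spread p b [] φ x = trans (conf-idle b φ x) (sym (conf-[] (φ / suc p) x))
  conf-spread p b (c ∷ cs) φ x with φ ≤? p
  ... | yes φ≤p = begin
    conf ((replicate p idle ++ c ∷ spread p cs) ++ replicate b idle) φ x ≡⟨ cong (λ z → conf z φ x) (++-assoc (replicate p idle) _ _) ⟩
    conf (replicate p idle ++ (c ∷ spread p cs) ++ replicate b idle) φ x ≡⟨ conf-delay p _ φ x ⟩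
    conf ((c ∷ spread p cs) ++ replicate b idle) (φ ∸ p) x ≡⟨ cong (λ z → conf ((c ∷ spread p cs) ++ replicate b idle) z x) (m≤n⇒m∸n≡0 φ≤p) ⟩
    conf (c ∷ cs) 0 x ≡⟨ cong (λ z → conf (c ∷ cs) z x) (sym (m<n⇒m/n≡0 (s≤s φ≤p))) ⟩
    conf (c ∷ cs) (φ / suc p) x ∎
    where open ≡-Reasoning
  ... | no φ≰p = begin
    conf ((replicate p idle ++ c ∷ spread p cs) ++ replicate b idle) φ x ≡⟨ cong (λ z → conf z φ x) (++-assoc (replicate p idle) _ _) ⟩
    conf (replicate p idle ++ (c ∷ spread p cs) ++ replicate b idle) φ x ≡⟨ conf-delay p _ φ x ⟩
    conf ((c ∷ spread p cs) ++ replicate b idle) (φ ∸ p) x ≡⟨ cong (λ z → conf ((c ∷ spread p cs) ++ replicate b idle) z x) (+-∸-assoc 1 (≰⇒> φ≰p)) ⟩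
    conf (spread p cs ++ replicate b idle) (φ ∸ suc p) (perform c x) ≡⟨ conf-spread p b cs (φ ∸ suc p) (perform c x) ⟩
    conf cs ((φ ∸ suc p) / suc p) (perform c x) ≡⟨ cong (λ z → conf (c ∷ cs) z x) (sym (m/n≡1+[m∸n]/n (≰⇒> φ≰p))) ⟩
    conf (c ∷ cs) (φ / suc p) x ∎
    where open ≡-Reasoning

-- Every agent cuts its own time into slots.  In slot q it waits for two
-- guard times, performs the commands main q (if moves q says so) or waits as
-- long, each command being preceded by pace q rounds of waiting, and waits
-- for one more guard time.  At the end of the slot the memory is updated from
-- the degree of the home and the counts seen during the slot.
record Protocol : Set₁ where
  field
    Mem     : Set
    init    : ℕ → Message → Mem
    guard   : ℕ → ℕ
    pace    : ℕ → ℕ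
    main    : ℕ → List Cmd
    returns : ∀ q {n} (G : PortGraph n) home →
              proj₂ (Motion.conf G (main q) (length (main q)) (home , [])) ≡ []
    moves   : ℕ → Mem → Bool
    update  : ℕ → Mem → ℕ → List ℕ → Mem
    halted  : Mem → Bool
    out     : Mem → List Message

module Controller (Π : Protocol) where
  open Protocol Π

  D W m : ℕ → ℕ
  D q = suc (guard q)
  W q = suc (pace q)
  m q = length (main q)

  -- With clocks less than `D q` apart, a tour that starts `D q + D q` into its slot and ends `D q`
  -- before the end of it falls into the listener's slot from `D q` on. What is seen before `D q`
  -- may belong to the previous slot.
  T : ℕ → ℕ
  T q = (D q + D q) + (m q * W q + D q)

  D<T : ∀ q → D q < T q
  D<T q = ≤-trans (m<m+n (D q) (s≤s z≤n)) (m≤m+n (D q + D q) _)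

  begins : ℕ → ℕ
  begins zero    = 0
  begins (suc q) = begins q + T q

  commands : ℕ → Mem → List Cmd
  commands q mem = if moves q mem then main q else replicate (m q) idle

  length-commands : ∀ q mem → length (commands q mem) ≡ m q
  length-commands q mem with moves q mem
  ... | true  = refl
  ... | false = length-replicate (m q)

  plan : ℕ → Mem → List Cmd
  plan q mem = replicate (D q + D q) idle ++ spread (pace q) (commands q mem) ++ replicate (D q) idle

  length-plan : ∀ q mem → length (plan q mem) ≡ T q
  length-plan q mem = trans (length-++ (replicate (D q + D q) idle)) (cong₂ _+_ (length-replicate (D q + D q))
    (trans (length-++ (spread (pace q) (commands q mem))) (cong₂ _+_
      (trans (length-spread (pace q) (commands q mem)) (cong (_* W q) (length-commands q mem)))
      (length-replicate (D q)))))

  -- The number of commands performed before time θ of slot q.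
  index : ℕ → ℕ → ℕ
  index q θ = (θ ∸ (D q + D q)) / W q

  -- The empty list encodes halting; a `plan` is never empty.
  planFor : ℕ → Mem → List Cmd
  planFor q mem = if halted mem then [] else plan q mem

  record Phase : Set where
    constructor phase
    field
      slot : ℕ
      mem  : Mem
      todo : List Cmd
      seen : List ℕ

  slotPhase : ℕ → Mem → Phase
  slotPhase q mem = phase q mem (planFor q mem) []

  nextPhase : Phase → ℕ → ℕ → Phase
  nextPhase (phase q mem [] seen)           d c = phase q mem [] seen
  nextPhase (phase q mem (_ ∷ []) seen)     d c = slotPhase (suc q) (update q mem d (seen ∷ʳ c))
  nextPhase (phase q mem (_ ∷ x ∷ xs) seen) d c = phase q mem (x ∷ xs) (seen ∷ʳ c)

  record State : Set where
    constructor state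
    field
      current : Phase
      trace   : Trace
      pending : Maybe (ℕ × ℕ)

  -- The port of entry is observed one round after the move, so the hop of a forward move stays
  -- pending until then.
  settle : Maybe (ℕ × ℕ) → Maybe ℕ → Trace → Trace
  settle (just (d , p)) (just e) tr = (d , p , e) ∷ tr
  settle (just _)       nothing  tr = tr
  settle nothing        _        tr = tr

  decide : Dir → Trace → ℕ → Action × Trace × Maybe (ℕ × ℕ)
  decide wait    tr d = stay , tr , nothing
  decide (fwd p) tr d with p <? d
  ... | yes _ = go p , tr , just (d , p)
  ... | no _  = stay , tr , nothing
  decide undo []                d = stay , [] , nothing
  decide undo ((_ , _ , e) ∷ tr) d = go e , tr , nothing

  directed : Phase → Trace → ℕ → Action × Trace × Maybe (ℕ × ℕ)
  directed (phase q mem [] seen)      tr d = stop (out mem) , tr , nothing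
  directed (phase q mem (c ∷ _) seen) tr d = decide (c tr d) tr d

  react : State → Obs → Action × State
  react (state ph tr pd) (obs d e c) =
    let a , tr′ , pd′ = directed ph (settle pd e tr) d in a , state (nextPhase ph d c) tr′ pd′

  drive : State → List Obs → State
  drive = foldl (λ s o → proj₂ (react s o))

  answer : State → List Obs → Action
  answer s []           = stay
  answer s (o ∷ [])     = proj₁ (react s o)
  answer s (o ∷ p ∷ os) = answer (proj₂ (react s o)) (p ∷ os)

  initial : ℕ → Message → State
  initial l μ = state (slotPhase 0 (init l μ)) [] nothing

  algorithm : Algorithm
  algorithm l μ h = answer (initial l μ) h

  answer-∷ʳ : ∀ s h o → answer s (h ++ o ∷ []) ≡ proj₁ (react (drive s h) o)
  answer-∷ʳ s []           o = refl
  answer-∷ʳ s (x ∷ [])     o = refl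
  answer-∷ʳ s (x ∷ y ∷ h)  o = answer-∷ʳ (proj₂ (react s x)) (y ∷ h) o

  drive-∷ʳ : ∀ s h o → drive s (h ++ o ∷ []) ≡ proj₂ (react (drive s h) o)
  drive-∷ʳ s []      o = refl
  drive-∷ʳ s (x ∷ h) o = drive-∷ʳ (proj₂ (react s x)) h o

-- The life of an agent

length≥2 : ∀ {A : Set} {xs : List A} {a b} → a ∈ xs → b ∈ xs → a ≢ b → 2 ≤ length xs
length≥2 {xs = _ ∷ []}    (here refl) (here refl) a≢b = contradiction refl a≢b
length≥2 {xs = _ ∷ _ ∷ _} _           _           _   = s≤s (s≤s z≤n)

two-members : ∀ {k} {xs : List (Fin k)} → Unique xs → 2 ≤ length xs → ∀ a → ∃ λ b → b ∈ xs × b ≢ a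
two-members {xs = x ∷ y ∷ _} ((x≢y ∷ _) ∷ _) _ a with x F.≟ a
... | no x≢a   = x , here refl , x≢a
... | yes refl = y , there (here refl) , (λ e → x≢y (sym e))
two-members {xs = _ ∷ []} _ (s≤s ()) a

module Run {n k : ℕ} (G : PortGraph n) (A : Algorithm) (start : Fin k → Fin n)
           (label : Fin k → ℕ) (msg : Fin k → Message) (wake : Fin k → Maybe ℕ) where
  open PortGraph G
  open Execution G A start label msg wake

  place : Fin k → ℕ → Fin n
  place i t = position i (stateAt t i)

  sight : Fin k → ℕ → ℕ
  sight i t = countAt (stateAt t) (place i t)

  crowded : ∀ t {a b v} → a ≢ b → place a t ≡ v → place b t ≡ v → 2 ≤ countAt (stateAt t) v
  crowded t {a} {b} a≢b pa pb = length≥2 (∈-filter⁺ _ (∈-allFin a) pa) (∈-filter⁺ _ (∈-allFin b) pb) a≢b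

  company : ∀ t a → 2 ≤ sight a t → ∃ λ b → b ≢ a × place b t ≡ place a t
  company t a h with two-members (filter⁺ (λ i → place i t F.≟ place a t) (allFin⁺ k)) h a
  ... | b , b∈ , b≢a = b , b≢a , proj₂ (∈-filter⁻ (λ i → place i t F.≟ place a t) {xs = allFin k} b∈)

  meeting : ∀ t {a b} → b ≢ a → place b t ≡ place a t → 2 ≤ sight a t
  meeting t b≢a e = crowded t (b≢a ∘ sym) refl e

  outcome : Fin n → List Obs → Action → AgentState n
  outcome u h stay     = active u nothing h
  outcome u h (stop o) = done u o
  outcome u h (go p) with p <? deg u
  ... | yes p<d = active (nbr u (fromℕ< p<d)) (just (toℕ (back u (fromℕ< p<d)))) h
  ... | no _    = active u nothing h

  dormant≢outcome : ∀ u h a → dormant ≢ outcome u h a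
  dormant≢outcome u h stay     ()
  dormant≢outcome u h (stop _) ()
  dormant≢outcome u h (go p) e with p <? deg u
  dormant≢outcome u h (go p) () | yes _
  dormant≢outcome u h (go p) () | no _

  act-outcome : ∀ i st u e h → let h′ = h ++ obs (deg u) e (countAt st u) ∷ [] in
                act i st u e h ≡ outcome u h′ (A (label i) (msg i) h′)
  act-outcome i st u e h with A (label i) (msg i) (h ++ obs (deg u) e (countAt st u) ∷ [])
  ... | stay   = refl
  ... | stop o = refl
  ... | go p with p <? deg u
  ... | yes _ = refl
  ... | no _  = refl

  roundStep-active : ∀ r st i {u e h} → st i ≡ active u e h → roundStep r st i ≡ act i st u e h
  roundStep-active r st i eq with st i
  roundStep-active r st i refl | active _ _ _ = refl

  roundStep-done : ∀ r st i {u o} → st i ≡ done u o → roundStep r st i ≡ done u o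
  roundStep-done r st i eq with st i
  roundStep-done r st i refl | done _ _ = refl

  roundStep-wakes : ∀ r st i → st i ≡ dormant → wakeNow st r i ≡ true → roundStep r st i ≡ act i st (start i) nothing []
  roundStep-wakes r st i eq w with st i
  roundStep-wakes r st i refl w | dormant with wakeNow st r i
  roundStep-wakes r st i refl refl | dormant | true = refl

  roundStep-sleeps : ∀ r st i → st i ≡ dormant → wakeNow st r i ≡ false → roundStep r st i ≡ dormant
  roundStep-sleeps r st i eq w with st i
  roundStep-sleeps r st i refl w | dormant with wakeNow st r i
  roundStep-sleeps r st i refl refl | dormant | false = refl

  done-stays : ∀ {t i u o} x → stateAt t i ≡ done u o → stateAt (x + t) i ≡ done u o
  done-stays zero    eq = eq
  done-stays {t} {i} (suc x) eq = roundStep-done (x + t) (stateAt (x + t)) i (done-stays x eq)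

  wakeNow-count : ∀ st r i → 2 ≤ countAt st (start i) → wakeNow st r i ≡ true
  wakeNow-count st r i h with 2 Data.Nat.≤? countAt st (start i)
  ... | yes _ = ∨-zeroʳ _
  ... | no ¬h = contradiction h ¬h

  wakeNow-adversary : ∀ st r i → wake i ≡ just r → wakeNow st r i ≡ true
  wakeNow-adversary st r i eq with Data.Maybe.Properties.≡-dec Data.Nat._≟_ (wake i) (just r)
    where import Data.Maybe.Properties
  ... | yes _ = refl
  ... | no ne = contradiction eq ne

module Living (Π : Protocol) {n k : ℕ} (G : PortGraph n) (start : Fin k → Fin n)
              (label : Fin k → ℕ) (msg : Fin k → Message) (wake : Fin k → Maybe ℕ) where
  open Protocol Π
  open Controller Π
  open PortGraph G
  open Motion G
  open Execution G algorithm start label msg wake public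
  open Run G algorithm start label msg wake public

  counts : Fin k → ℕ → ℕ → List ℕ
  counts i t zero    = []
  counts i t (suc L) = sight i t ∷ counts i (suc t) L

  -- The invariant that links the controller to the motion `x`. `acts` holds for an active agent and
  -- for one woken in round t alike, so the first round needs no separate treatment; the stored
  -- trace lags behind `x` until it is settled.
  record Ready (t : ℕ) (i : Fin k) (ph : Phase) (x : Config) : Set where
    field
      entry   : Maybe ℕ
      history : List Obs
      trace   : Trace
      pending : Maybe (ℕ × ℕ)
      acts    : roundStep t (stateAt t) i ≡ act i (stateAt t) (proj₁ x) entry history
      placed  : place i t ≡ proj₁ x
      driven  : drive (initial (label i) (msg i)) history ≡ state ph trace pending
      settled : settle pending entry trace ≡ proj₂ x
      route   : Route (start i) (proj₂ x) (proj₁ x)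

  decide-exec : ∀ d u tr h → let a , tr′ , pd = decide d tr (deg u) ; u″ , tr″ = exec (u , tr) d in
                ∃ λ e → outcome u h a ≡ active u″ e h × settle pd e tr′ ≡ tr″
  decide-exec wait u tr h = nothing , refl , refl
  decide-exec (fwd p) u tr h with p <? deg u in eq
  ... | no _ = nothing , refl , refl
  ... | yes _ rewrite eq = _ , refl , refl
  decide-exec undo u [] h = nothing , refl , refl
  decide-exec undo u ((_ , _ , e) ∷ tr) h with e <? deg u
  ... | yes _ = _ , refl , refl
  ... | no _  = nothing , refl , refl

  module _ {t i ph x} (R : Ready t i ph x) where
    open Ready R

    private
      u = proj₁ x
      o = obs (deg u) entry (countAt (stateAt t) u)
      s₀ = initial (label i) (msg i)

    ready-outcome : stateAt (suc t) i ≡ outcome u (history ++ o ∷ []) (proj₁ (directed ph (proj₂ x) (deg u)))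
    ready-outcome = trans acts (trans (act-outcome i (stateAt t) u entry history)
      (cong (outcome u (history ++ o ∷ []))
        (trans (answer-∷ʳ s₀ history o)
          (trans (cong (λ s → proj₁ (react s o)) driven)
                 (cong (λ z → proj₁ (directed ph z (deg u))) settled)))))

    ready-awake : stateAt (suc t) i ≢ dormant
    ready-awake e = dormant≢outcome u (history ++ o ∷ []) (proj₁ (directed ph (proj₂ x) (deg u)))
                      (trans (sym e) ready-outcome)

    ready-drive : let _ , tr′ , pd′ = directed ph (proj₂ x) (deg u) in
                  drive s₀ (history ++ o ∷ []) ≡ state (nextPhase ph (deg u) (sight i t)) tr′ pd′
    ready-drive = trans (drive-∷ʳ s₀ history o)
      (trans (cong (λ s → proj₂ (react s o)) driven)
        (trans (cong (λ z → let _ , tr′ , pd′ = directed ph z (deg u) in state (nextPhase ph (deg u) (countAt (stateAt t) u)) tr′ pd′) settled)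
               (cong (λ z → let _ , tr′ , pd′ = directed ph (proj₂ x) (deg u) in state (nextPhase ph (deg u) (countAt (stateAt t) z)) tr′ pd′) (sym placed))))

  ready-step : ∀ {t i q mem c cs seen x} → Ready t i (phase q mem (c ∷ cs) seen) x →
               Ready (suc t) i (nextPhase (phase q mem (c ∷ cs) seen) (deg (proj₁ x)) (sight i t)) (perform c x)
  ready-step {t} {i} {c = c} {x = x} R
    with decide-exec (c (proj₂ x) (deg (proj₁ x))) (proj₁ x) (proj₂ x)
           (Ready.history R ++ obs (deg (proj₁ x)) (Ready.entry R) (countAt (stateAt t) (proj₁ x)) ∷ [])
  ... | e , out≡ , set≡ = record
    { entry   = e
    ; history = Ready.history R ++ obs (deg (proj₁ x)) (Ready.entry R) (countAt (stateAt t) (proj₁ x)) ∷ []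
    ; trace   = _
    ; pending = _
    ; acts    = roundStep-active (suc t) (stateAt (suc t)) i now
    ; placed  = cong (position i) now
    ; driven  = ready-drive R
    ; settled = set≡
    ; route   = exec-route (c (proj₂ x) (deg (proj₁ x))) (Ready.route R)
    }
    where now = trans (ready-outcome R) out≡

  ready-halt : ∀ {t i q mem seen x} → Ready t i (phase q mem [] seen) x →
               stateAt (suc t) i ≡ done (proj₁ x) (out mem)
  ready-halt = ready-outcome

  ready-during : ∀ {q mem i} θ {t todo seen x} → θ < length todo → Ready t i (phase q mem todo seen) x →
                 place i (θ + t) ≡ proj₁ (conf todo θ x)
  ready-during zero {todo = _ ∷ _} _ R = Ready.placed R
  ready-during (suc θ) {todo = _ ∷ []} (s≤s ()) R
  ready-during {i = i} (suc θ) {t} {_ ∷ _ ∷ _} (s≤s l) R =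
    trans (cong (place i) (sym (+-suc θ t))) (ready-during θ l (ready-step R))

  ready-after : ∀ {q mem i} c cs {t seen x} → Ready t i (phase q mem (c ∷ cs) seen) x →
                Ready (suc (length cs) + t) i
                  (slotPhase (suc q) (update q mem (deg (proj₁ (conf (c ∷ cs) (length cs) x)))
                                             (seen ++ counts i t (suc (length cs)))))
                  (conf (c ∷ cs) (suc (length cs)) x)
  ready-after c [] R = ready-step R
  ready-after {q} {mem} {i} c (d ∷ cs) {t} {seen} {x} R =
    subst₂ (λ a b → Ready a i (slotPhase (suc q) (update q mem (deg (proj₁ (conf (d ∷ cs) (length cs) (perform c x)))) b))
                              (conf (d ∷ cs) (suc (length cs)) (perform c x)))
      (+-suc (suc (length cs)) t) (++-assoc seen (sight i t ∷ []) _)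
      (ready-after d cs (ready-step R))

  home : Fin k → Config
  home i = start i , []

  conf-plan : ∀ q mem θ x → conf (plan q mem) θ x ≡ conf (commands q mem) (index q θ) x
  conf-plan q mem θ x = trans (conf-delay (D q + D q) _ θ x) (conf-spread G (pace q) (D q) (commands q mem) (θ ∸ (D q + D q)) x)

  -- `returns` speaks of the trace only, but the empty trace is a route to the home alone, so it
  -- fixes the node as well.
  conf-home : ∀ q mem i φ → m q ≤ φ → conf (commands q mem) φ (home i) ≡ home i
  conf-home q mem i φ h with moves q mem
  ... | false = conf-idle (m q) φ (home i)
  ... | true  = trans (conf-beyond (main q) φ (home i) h) (cong₂ _,_ (route-[] r) back-home)
    where
    back-home = returns q G (start i)
    r : Route (start i) [] (proj₁ (conf (main q) (m q) (home i)))
    r = subst (λ z → Route (start i) z (proj₁ (conf (main q) (m q) (home i)))) back-home (conf-route (main q) (m q) {home i} root)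

  T-split : ∀ q → T q ≡ suc ((D q + D q) + (m q * W q + guard q))
  T-split q = trans (cong (D q + D q +_) (+-suc (m q * W q) (guard q))) (+-suc (D q + D q) _)

  index-late : ∀ q θ → D q + D q + m q * W q ≤ θ → m q ≤ index q θ
  index-late q θ h = ≤-trans (≤-reflexive (sym (m*n/n≡m (m q) (W q))))
    (/-monoˡ-≤ (W q) (≤-trans (≤-reflexive (sym (m+n∸m≡n (D q + D q) (m q * W q)))) (∸-monoˡ-≤ (D q + D q) h)))

  index-early : ∀ q θ → θ < D q + D q + W q → index q θ ≡ 0
  index-early q θ h = m<n⇒m/n≡0 (m<n+o⇒m∸n<o θ (D q + D q) h)

  index-exact : ∀ q φ → index q (D q + D q + φ * W q) ≡ φ
  index-exact q φ = trans (cong (_/ W q) (m+n∸m≡n (D q + D q) (φ * W q))) (m*n/n≡m φ (W q))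

  begins-mono : ∀ {a b} → a ≤ b → begins a ≤ begins b
  begins-mono {a} {b} a≤b with m≤n⇒m<n∨m≡n a≤b
  begins-mono {a} {suc b} _ | inj₁ (s≤s a≤b) = ≤-trans (begins-mono a≤b) (m≤m+n _ _)
  begins-mono {a} {.a} _ | inj₂ refl = ≤-refl

  module _ {i q mem t} (alive : halted mem ≡ false) (R : Ready t i (slotPhase q mem) (home i)) where
    private
      R′ : Ready t i (phase q mem (plan q mem) []) (home i)
      R′ = subst (λ b → Ready t i (phase q mem (if b then [] else plan q mem) []) (home i)) alive R

    place-slot : ∀ θ → θ < T q → place i (θ + t) ≡ proj₁ (conf (commands q mem) (index q θ) (home i))
    place-slot θ θ<T = trans (ready-during θ (subst (θ <_) (sym (length-plan q mem)) θ<T) R′)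
                             (cong proj₁ (conf-plan q mem θ (home i)))

    next-slot : Ready (T q + t) i (slotPhase (suc q) (update q mem (deg (start i)) (counts i t (T q)))) (home i)
    next-slot = over (plan q mem) refl (length-plan q mem) R′
      where
      over : ∀ cs → cs ≡ plan q mem → length cs ≡ T q → Ready t i (phase q mem cs []) (home i) →
           Ready (T q + t) i (slotPhase (suc q) (update q mem (deg (start i)) (counts i t (T q)))) (home i)
      over (c ∷ cs) eq len Q = subst₂ (λ a b → Ready (a + t) i (slotPhase (suc q) (update q mem (deg (start i)) (counts i t a))) b)
          len (end (suc (length cs)) (≤-trans (≤-trans (m≤m+n _ (D q)) (≤-reflexive (+-assoc (D q + D q) _ (D q)))) (≤-reflexive (sym len))))
        (subst (λ z → Ready (suc (length cs) + t) i (slotPhase (suc q) (update q mem (deg z) (counts i t (suc (length cs))))) (conf (c ∷ cs) (suc (length cs)) (home i)))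
          (cong proj₁ (end (length cs) (≤-trans (m≤m+n _ (guard q)) (≤-reflexive (trans (+-assoc (D q + D q) _ (guard q)) (suc-injective (trans (sym (T-split q)) (sym len))))))))
          (ready-after c cs Q))
        where
        end : ∀ θ → D q + D q + m q * W q ≤ θ → conf (c ∷ cs) θ (home i) ≡ home i
        end θ h = trans (cong (λ z → conf z θ (home i)) eq)
                        (trans (conf-plan q mem θ (home i)) (conf-home q mem i (index q θ) (index-late q θ h)))

  -- States are those before a round: an agent woken in round w is still dormant at time w.
  Woken : Fin k → ℕ → Set
  Woken i w = Ready w i (slotPhase 0 (init (label i) (msg i))) (home i) × (∀ t → t ≤ w → stateAt t i ≡ dormant)

  sleeping-or-woken : ∀ i t → (∀ s → s ≤ t → stateAt s i ≡ dormant) ⊎ (∃ λ w → w < t × Woken i w)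
  sleeping-or-woken i zero = inj₁ λ { zero _ → refl }
  sleeping-or-woken i (suc t) with sleeping-or-woken i t
  ... | inj₂ (w , w<t , W) = inj₂ (w , m<n⇒m<1+n w<t , W)
  ... | inj₁ asleep with wakeNow (stateAt t) t i in eq
  ... | true = inj₂ (t , ≤-refl , record
    { entry   = nothing
    ; history = []
    ; trace   = []
    ; pending = nothing
    ; acts    = roundStep-wakes t (stateAt t) i (asleep t ≤-refl) eq
    ; placed  = cong (position i) (asleep t ≤-refl)
    ; driven  = refl
    ; settled = refl
    ; route   = root
    } , asleep)
  ... | false = inj₁ still
    where
    still : ∀ s → s ≤ suc t → stateAt s i ≡ dormant
    still s s≤ with m≤n⇒m<n∨m≡n s≤
    ... | inj₁ (s≤s s≤t) = asleep s s≤t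
    ... | inj₂ refl      = roundStep-sleeps t (stateAt t) i (asleep t ≤-refl) eq

  woken-by : ∀ i t → wakeNow (stateAt t) t i ≡ true → ∃ λ w → w ≤ t × Woken i w
  woken-by i t wk with sleeping-or-woken i (suc t)
  ... | inj₂ (w , s≤s w≤t , W) = w , w≤t , W
  ... | inj₁ asleep = contradiction (trans (sym (asleep (suc t) ≤-refl))
                        (trans (roundStep-wakes t (stateAt t) i (asleep t (n≤1+n t)) wk)
                               (act-outcome i (stateAt t) (start i) nothing [])))
                        (dormant≢outcome (start i) first (algorithm (label i) (msg i) first))
    where first = obs (deg (start i)) nothing (countAt (stateAt t) (start i)) ∷ []

  woken-≮ : ∀ {i w w′} → Woken i w → Woken i w′ → ¬ (w < w′)
  woken-≮ {i} {w} (R , _) (_ , asleep) w<w′ =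
    ready-awake R (asleep (suc w) w<w′)

  woken-unique : ∀ {i w w′} → Woken i w → Woken i w′ → w ≡ w′
  woken-unique W W′ = ≤-antisym (≮⇒≥ (woken-≮ W′ W)) (≮⇒≥ (woken-≮ W W′))

  module Agent (i : Fin k) (w : ℕ) (woken : Woken i w) where

    slotTime : ℕ → ℕ
    slotTime q = begins q + w

    memory : ℕ → Mem
    memory zero    = init (label i) (msg i)
    memory (suc q) = update q (memory q) (deg (start i)) (counts i (slotTime q) (T q))

    Alive : ℕ → Set
    Alive q = ∀ q′ → q′ < q → halted (memory q′) ≡ false

    ready : ∀ q → Alive q → Ready (slotTime q) i (slotPhase q (memory q)) (home i)
    ready zero    al = proj₁ woken
    ready (suc q) al = subst (λ z → Ready z i (slotPhase (suc q) (memory (suc q))) (home i))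
      (trans (sym (+-assoc (T q) (begins q) w)) (cong (_+ w) (+-comm (T q) (begins q))))
      (next-slot (al q ≤-refl) (ready q (λ q′ l → al q′ (m<n⇒m<1+n l))))

    place-in-slot : ∀ q → Alive (suc q) → ∀ θ → θ < T q →
                    place i (θ + slotTime q) ≡ proj₁ (conf (commands q (memory q)) (index q θ) (home i))
    place-in-slot q al = place-slot (al q ≤-refl) (ready q (λ q′ l → al q′ (m<n⇒m<1+n l)))

    finished : ∀ q → Alive q → halted (memory q) ≡ true → ∀ t → slotTime q < t →
               stateAt t i ≡ done (start i) (out (memory q))
    finished q al h t lt = subst (λ z → stateAt z i ≡ done (start i) (out (memory q))) (m∸n+n≡m lt)
      (done-stays (t ∸ suc (slotTime q))
        (ready-halt (subst (λ b → Ready (slotTime q) i (phase q (memory q) (if b then [] else plan q (memory q)) []) (home i)) h (ready q al))))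

    locate : ∀ t → w ≤ t → ∃ λ q → ∃ λ θ → t ≡ θ + slotTime q × θ < T q
    locate t w≤t = subst (λ z → ∃ λ q → ∃ λ θ → z ≡ θ + slotTime q × θ < T q) (m∸n+n≡m w≤t) (seek (t ∸ w))
      where
      seek : ∀ y → ∃ λ q → ∃ λ θ → y + w ≡ θ + slotTime q × θ < T q
      seek zero = 0 , 0 , refl , s≤s z≤n
      seek (suc y) with seek y
      ... | q , θ , eq , lt with m≤n⇒m<n∨m≡n lt
      ... | inj₁ lt′ = q , suc θ , cong suc eq , lt′
      ... | inj₂ e   = suc q , 0 , trans (cong suc eq) (trans (cong (_+ slotTime q) e)
                         (trans (sym (+-assoc (T q) (begins q) w)) (cong (_+ w) (+-comm (T q) (begins q))))) , s≤s z≤n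

    alive-suc : ∀ {q} → Alive q → halted (memory q) ≡ false → Alive (suc q)
    alive-suc {q} al h q′ q′<  with m≤n⇒m<n∨m≡n q′<
    ... | inj₁ (s≤s l) = al q′ l
    ... | inj₂ refl    = h

    alive-or-halted : ∀ q → Alive q ⊎ (∃ λ q′ → q′ < q × Alive q′ × halted (memory q′) ≡ true)
    alive-or-halted zero = inj₁ λ _ ()
    alive-or-halted (suc q) with alive-or-halted q
    ... | inj₂ (q′ , l , al , h) = inj₂ (q′ , m<n⇒m<1+n l , al , h)
    ... | inj₁ al with halted (memory q) in eq
    ... | true  = inj₂ (q , ≤-refl , al , eq)
    ... | false = inj₁ (alive-suc al eq)

    -- What can be said of an agent seen away from its home. `after` contains `W q` because the
    -- first command takes effect only at the end of its phase.
    record Touring (t : ℕ) : Set where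
      field
        q θ   : ℕ
        time  : t ≡ θ + slotTime q
        θ<T   : θ < T q
        alive : Alive (suc q)
        moving : moves q (memory q) ≡ true
        seat  : place i t ≡ proj₁ (conf (main q) (index q θ) (home i))
        after : D q + D q + W q ≤ θ
        before : θ < D q + D q + m q * W q

    away : ∀ t → place i t ≢ start i → Touring t
    away t not-home with t ≤? w
    ... | yes t≤w = contradiction (cong (position i) (proj₂ woken t t≤w)) not-home
    ... | no t≰w with locate t (<⇒≤ (≰⇒> t≰w))
    ... | q , θ , refl , θ<T with alive-or-halted (suc q)
    ... | inj₂ (q′ , s≤s q′≤q , al , h) with slotTime q′ <? θ + slotTime q
    ... | yes lt = contradiction (cong (position i) (finished q′ al h _ lt)) not-home
    ... | no ≮t = contradiction (trans (cong (place i) now) (Ready.placed (ready q′ al))) not-home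
      where
      now : θ + slotTime q ≡ slotTime q′
      now = ≤-antisym (≮⇒≥ ≮t) (≤-trans (+-monoˡ-≤ w (begins-mono q′≤q)) (m≤n+m _ θ))
    away t not-home | no t≰w | q , θ , refl , θ<T | inj₁ al = record
      { q = q ; θ = θ ; time = refl ; θ<T = θ<T ; alive = al
      ; moving = moving ; seat = seat ; after = after ; before = before }
      where
      here-now : place i (θ + slotTime q) ≡ proj₁ (conf (commands q (memory q)) (index q θ) (home i))
      here-now = place-in-slot q al θ θ<T
      moving : moves q (memory q) ≡ true
      moving with moves q (memory q) | here-now
      ... | true  | _ = refl
      ... | false | e = contradiction (trans e (cong proj₁ (conf-idle (m q) (index q θ) (home i)))) not-home
      seat : place i (θ + slotTime q) ≡ proj₁ (conf (main q) (index q θ) (home i))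
      seat = trans here-now (cong (λ b → proj₁ (conf (if b then main q else replicate (m q) idle) (index q θ) (home i))) moving)
      after : D q + D q + W q ≤ θ
      after with D q + D q + W q ≤? θ
      ... | yes p = p
      ... | no ¬p = contradiction (trans seat (cong (λ z → proj₁ (conf (main q) z (home i))) (index-early q θ (≰⇒> ¬p)))) not-home
      before : θ < D q + D q + m q * W q
      before with θ <? D q + D q + m q * W q
      ... | yes p = p
      ... | no ¬p = contradiction (trans here-now (cong proj₁ (conf-home q (memory q) i (index q θ) (index-late q θ (≮⇒≥ ¬p))))) not-home

-- Several agents

-- The default 1 reads as being alone.
nth : List ℕ → ℕ → ℕ
nth []       _       = 1
nth (c ∷ _)  zero    = c
nth (_ ∷ cs) (suc θ) = nth cs θ

Heard : ℕ → ℕ → List ℕ → Set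
Heard d L cs = ∃ λ θ → θ < L × d ≤ θ × 2 ≤ nth cs θ

abstract
  heard? : ∀ d L cs → Dec (Heard d L cs)
  heard? d L cs = anyUpTo? (λ θ → (d ≤? θ) ×-dec (2 ≤? nth cs θ)) L

bool-iff : ∀ {a b : Bool} → (a ≡ true ⇔ b ≡ true) → a ≡ b
bool-iff {false} {false} _ = refl
bool-iff {true}  {true}  _ = refl
bool-iff {false} {true}  h = Equivalence.from h refl
bool-iff {true}  {false} h = sym (Equivalence.to h refl)

does-iff : ∀ {A : Set} (d : Dec A) → does d ≡ true ⇔ A
does-iff (yes a) = mk⇔ (λ _ → a) (λ _ → refl)
does-iff (no ¬a) = mk⇔ (λ ()) (λ a → contradiction a ¬a)

module World (Π : Protocol) {n k : ℕ} (G : PortGraph n) (start : Fin k → Fin n)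
              (start-inj : Injective start) (label : Fin k → ℕ) (msg : Fin k → Message)
              (wake : Fin k → Maybe ℕ) where
  open Protocol Π
  open Controller Π
  open PortGraph G
  open Motion G
  open Living Π G start label msg wake public

  nth-counts : ∀ i t L θ → θ < L → nth (counts i t L) θ ≡ sight i (θ + t)
  nth-counts i t (suc L) zero    _       = refl
  nth-counts i t (suc L) (suc θ) (s≤s l) = trans (nth-counts i (suc t) L θ l) (cong (sight i) (+-suc θ t))

  tour-time<T : ∀ q φ → φ < m q → D q + D q + φ * W q < T q
  tour-time<T q φ φ<m = +-monoʳ-< (D q + D q) (≤-<-trans (*-monoˡ-≤ (W q) (<⇒≤ φ<m)) (m<m+n _ (s≤s z≤n)))

  module _ {i w} (woken : Woken i w) where
    open Agent i w woken

    tour-place : ∀ q → Alive (suc q) → moves q (memory q) ≡ true → ∀ φ → φ < m q →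
                 place i (D q + D q + φ * W q + slotTime q) ≡ proj₁ (conf (main q) φ (home i))
    tour-place q al mv φ φ<m = trans (place-in-slot q al _ (tour-time<T q φ φ<m))
      (cong₂ (λ b z → proj₁ (conf (if b then main q else replicate (m q) idle) z (home i))) mv (index-exact q φ))

    -- Either the agent is awake by the time the tour reaches its home, or it sleeps there and the
    -- visitor raises the count to two.
    arouses : ∀ q → Alive (suc q) → moves q (memory q) ≡ true → ∀ φ → φ < m q →
              ∀ j → proj₁ (conf (main q) φ (home i)) ≡ start j →
              ∃ λ w′ → w′ ≤ D q + D q + φ * W q + slotTime q × Woken j w′
    arouses q al mv φ φ<m j e with i F.≟ j
    ... | yes refl = w , ≤-trans (m≤n+m w (begins q)) (m≤n+m (slotTime q) (D q + D q + φ * W q)) , woken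
    ... | no i≢j with sleeping-or-woken j (D q + D q + φ * W q + slotTime q)
    ... | inj₂ (w′ , w′<t , W′) = w′ , <⇒≤ w′<t , W′
    ... | inj₁ asleep = woken-by j t (wakeNow-count (stateAt t) t j
            (crowded t i≢j (trans (tour-place q al mv φ φ<m) e) (cong (position j) (asleep t ≤-refl))))
      where t = D q + D q + φ * W q + slotTime q

  Explores : ℕ → Set
  Explores q = ∀ i v → ∃ λ φ → φ < m q × proj₁ (conf (main q) φ (home i)) ≡ v

  module Together (w : Fin k → ℕ) (woken : ∀ i → Woken i (w i)) where
    module Of (i : Fin k) = Agent i (w i) (woken i)

    listening : ∀ a q → Of.Alive a (suc q) → moves q (Of.memory a q) ≡ false →
                ∀ θ → θ < T q → place a (θ + Of.slotTime a q) ≡ start a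
    listening a q al mv θ θ<T = trans (Of.place-in-slot a q al θ θ<T)
      (trans (cong (λ b → proj₁ (conf (if b then main q else replicate (m q) idle) (index q θ) (home a))) mv)
             (cong proj₁ (conf-idle (m q) (index q θ) (home a))))

    visitor : ∀ a t → place a t ≡ start a → 2 ≤ sight a t →
              ∃ λ z → z ≢ a × place z t ≡ start a × Of.Touring z t
    visitor a t at-home h with company t a h
    ... | z , z≢a , e = z , z≢a , trans e at-home ,
                        Of.away z t (λ e′ → z≢a (start-inj z a (trans (sym e′) (trans e at-home))))

    Sync : ℕ → Set
    Sync q = ∀ i j → w i < w j + D q

    module _ (D-mono : ∀ {q r} → q ≤ r → D q ≤ D r) where

      -- With wake-up times less than a guard time apart, what a listener
      -- sees from the guard time on happens in the same slot.
      same-slot : ∀ {q} → Sync q → ∀ a z θ → D q ≤ θ → θ < T q →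
                  (tz : Of.Touring z (θ + Of.slotTime a q)) → Of.Touring.q tz ≡ q
      same-slot {q} sync a z θ D≤θ θ<T tz with <-cmp (Of.Touring.q tz) q
      ... | tri≈ _ e _ = e
      ... | tri< r<q _ _ = contradiction (begin-strict
        Of.Touring.θ tz + (begins r + w z) <⟨ +-monoˡ-< _ (Of.Touring.θ<T tz) ⟩
        T r + (begins r + w z) ≡⟨ sym (+-assoc (T r) (begins r) (w z)) ⟩
        T r + begins r + w z ≡⟨ cong (_+ w z) (+-comm (T r) (begins r)) ⟩
        begins (suc r) + w z ≤⟨ +-monoˡ-≤ (w z) (begins-mono r<q) ⟩
        begins q + w z ≤⟨ +-monoʳ-≤ (begins q) (<⇒≤ (sync z a)) ⟩
        begins q + (w a + D q) ≡⟨ rot (begins q) (w a) (D q) ⟩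
        D q + (begins q + w a) ≤⟨ +-monoˡ-≤ _ D≤θ ⟩
        θ + (begins q + w a) ≡⟨ Of.Touring.time tz ⟩
        Of.Touring.θ tz + (begins r + w z) ∎) (<-irrefl refl)
        where
        open ≤-Reasoning
        r = Of.Touring.q tz
        rot : ∀ a b c → a + (b + c) ≡ c + (a + b)
        rot = solve-∀
      ... | tri> _ _ q<r = contradiction (begin-strict
        θ + (begins q + w a) ≡⟨ sym (+-assoc θ (begins q) (w a)) ⟩
        θ + begins q + w a <⟨ +-monoˡ-< (w a) (+-monoˡ-< (begins q) θ<T) ⟩
        T q + begins q + w a ≡⟨ cong (_+ w a) (+-comm (T q) (begins q)) ⟩
        begins (suc q) + w a ≤⟨ +-mono-≤ (begins-mono q<r) (<⇒≤ (sync a z)) ⟩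
        begins r + (w z + D q) ≡⟨ rot (begins r) (w z) (D q) ⟩
        D q + (begins r + w z) ≤⟨ +-monoˡ-≤ _ (≤-trans (D-mono (<⇒≤ q<r)) (≤-trans (m≤m+n (D r) _) (≤-trans (m≤m+n (D r + D r) _) (Of.Touring.after tz)))) ⟩
        Of.Touring.θ tz + (begins r + w z) ≡⟨ sym (Of.Touring.time tz) ⟩
        θ + (begins q + w a) ∎) (<-irrefl refl)
        where
        open ≤-Reasoning
        r = Of.Touring.q tz
        rot : ∀ a b c → a + (b + c) ≡ c + (a + b)
        rot = solve-∀

      shifted : ∀ {q} → Sync q → ∀ a z φ → φ < m q →
                ∃ λ θ → D q ≤ θ × θ < T q × θ + Of.slotTime a q ≡ D q + D q + φ * W q + Of.slotTime z q
      shifted {q} sync a z φ φ<m = θ , lower , upper , m∸n+n≡m fits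
        where
        open ≤-Reasoning
        t = D q + D q + φ * W q + (begins q + w z)
        θ = t ∸ (begins q + w a)
        early : D q + (begins q + w a) ≤ t
        early = begin
          D q + (begins q + w a) ≤⟨ +-monoʳ-≤ (D q) (+-monoʳ-≤ (begins q) (<⇒≤ (sync a z))) ⟩
          D q + (begins q + (w z + D q)) ≡⟨ rot (D q) (begins q) (w z) ⟩
          D q + D q + (begins q + w z) ≤⟨ +-monoˡ-≤ _ (m≤m+n (D q + D q) (φ * W q)) ⟩
          t ∎
          where
          rot : ∀ a b c → a + (b + (c + a)) ≡ a + a + (b + c)
          rot = solve-∀
        fits : begins q + w a ≤ t
        fits = ≤-trans (m≤n+m _ (D q)) early
        lower : D q ≤ θ
        lower = m+n≤o⇒m≤o∸n (D q) early
        late : t < T q + (begins q + w a)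
        late = begin-strict
          D q + D q + φ * W q + (begins q + w z) <⟨ +-monoʳ-< (D q + D q + φ * W q) (+-monoʳ-< (begins q) (sync z a)) ⟩
          D q + D q + φ * W q + (begins q + (w a + D q)) ≡⟨ rot (D q + D q) (φ * W q) (begins q) (w a) (D q) ⟩
          D q + D q + (φ * W q + D q) + (begins q + w a) ≤⟨ +-monoˡ-≤ _ (+-monoʳ-≤ (D q + D q) (+-monoˡ-≤ (D q) (*-monoˡ-≤ (W q) (<⇒≤ φ<m)))) ⟩
          T q + (begins q + w a) ∎
          where
          rot : ∀ a b c d e → a + b + (c + (d + e)) ≡ a + (b + e) + (c + d)
          rot = solve-∀
        upper : θ < T q
        upper = +-cancelʳ-< (begins q + w a) θ (T q) (subst (_< T q + (begins q + w a)) (sym (m∸n+n≡m fits)) late)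

      module Query {q : ℕ} (sync : Sync q) (alive : ∀ i → Of.Alive i (suc q)) (explores : Explores q) where

        hears : Fin k → List ℕ
        hears i = counts i (Of.slotTime i q) (T q)

        answer-sound : ∀ i → moves q (Of.memory i q) ≡ false → Heard (D q) (T q) (hears i) →
                       ∃ λ j → moves q (Of.memory j q) ≡ true
        answer-sound i mv (θ , θ<T , D≤θ , two)
          with visitor i (θ + Of.slotTime i q) (listening i q (alive i) mv θ θ<T)
                 (subst (2 ≤_) (nth-counts i (Of.slotTime i q) (T q) θ θ<T) two)
        ... | z , _ , _ , tz = z , subst (λ r → moves r (Of.memory z r) ≡ true)
                                     (same-slot sync i z θ D≤θ θ<T tz) (Of.Touring.moving tz)

        answer-complete : ∀ i j → moves q (Of.memory i q) ≡ false → moves q (Of.memory j q) ≡ true →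
                          Heard (D q) (T q) (hears i)
        answer-complete i j mvi mvj with explores j (start i)
        ... | φ , φ<m , at with shifted sync i j φ φ<m
        ... | θ , D≤θ , θ<T , same = θ , θ<T , D≤θ ,
          subst (2 ≤_) (sym (nth-counts i (Of.slotTime i q) (T q) θ θ<T))
            (meeting (θ + Of.slotTime i q) (λ { refl → contradiction (trans (sym mvi) mvj) λ () })
              (trans (trans (cong (place j) same) (trans (tour-place (woken j) q (alive j) mvj φ φ<m) at))
                     (sym (listening i q (alive i) mvi θ θ<T))))

        -- An agent that moves cannot listen, but its own tour already makes the answer yes; hence
        -- the disjunction.
        or-channel : ∀ i → moves q (Of.memory i q) ∨ does (heard? (D q) (T q) (hears i)) ≡ true ⇔
                       (∃ λ j → moves q (Of.memory j q) ≡ true)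
        or-channel i with moves q (Of.memory i q) in mv
        ... | true  = mk⇔ (λ _ → i , mv) (λ _ → refl)
        ... | false with heard? (D q) (T q) (hears i)
        ... | yes h = mk⇔ (λ _ → answer-sound i mv h) (λ _ → refl)
        ... | no ¬h = mk⇔ (λ ()) (λ { (j , mvj) → contradiction (answer-complete i j mv mvj) ¬h })

        common-answer : ∀ {A : Fin k → Set} (A? : ∀ i → Dec (A i)) →
                        (∀ i → moves q (Of.memory i q) ≡ does (A? i)) →
                        ∀ i → moves q (Of.memory i q) ∨ does (heard? (D q) (T q) (hears i)) ≡ does (F.any? A?)
        common-answer A? mv i = bool-iff (mk⇔
          (λ e → let j , e′ = Equivalence.to (or-channel i) e in
                 Equivalence.from (does-iff (F.any? A?)) (j , Equivalence.to (does-iff (A? j)) (trans (sym (mv j)) e′)))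
          (λ e → let j , a = Equivalence.to (does-iff (F.any? A?)) e in
                 Equivalence.from (or-channel i) (j , trans (mv j) (Equivalence.from (does-iff (A? j)) a))))

      module Echo {q : ℕ} (sync : Sync q) (alive : ∀ i → Of.Alive i (suc q))
                  (a z : Fin k) (listens : moves q (Of.memory a q) ≡ false) (moved : moves q (Of.memory z q) ≡ true) where

        t : ℕ → ℕ
        t θ = θ + Of.slotTime a q

        z≢a : z ≢ a
        z≢a e = contradiction (trans (sym (subst (λ i → moves q (Of.memory i q) ≡ true) e moved)) listens) λ ()

        quiet : ∀ θ → D q ≤ θ → θ < T q →
                (∀ i θ′ → θ + w a ≡ θ′ + w i → D q + D q ≤ θ′ → θ′ < D q + D q + m q * W q → ⊥) → sight a (t θ) < 2
        quiet θ D≤θ θ<T absurd = ≰⇒> (λ two → refute (visitor a (t θ) (listening a q (alive a) listens θ θ<T) two))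
          where
          refute : ¬ (∃ λ i → i ≢ a × place i (t θ) ≡ start a × Of.Touring i (t θ))
          refute (i , _ , _ , ti) = absurd i (Of.Touring.θ ti)
              (+-cancelˡ-≡ (begins q) (θ + w a) (Of.Touring.θ ti + w i)
                (trans (swap (begins q) θ (w a)) (trans (subst (λ r → t θ ≡ Of.Touring.θ ti + (begins r + w i)) e (Of.Touring.time ti)) (sym (swap (begins q) (Of.Touring.θ ti) (w i))))))
              (subst (λ r → D r + D r ≤ Of.Touring.θ ti) e (≤-trans (m≤m+n _ _) (Of.Touring.after ti)))
              (subst (λ r → Of.Touring.θ ti < D r + D r + m r * W r) e (Of.Touring.before ti))
            where
            e = same-slot sync a i θ D≤θ θ<T ti
            swap : ∀ a b c → a + (b + c) ≡ b + (a + c)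
            swap = solve-∀

        -- On every clock this time lies before the tours, which start only after two guard times.
        -- Likewise the last round lies after them on every clock, by the guard time at the end of a
        -- slot.
        quiet-first : sight a (t (D q)) < 2
        quiet-first = quiet (D q) ≤-refl (D<T q) λ i θ′ e lo _ → <-irrefl refl (begin-strict
            D q + w a <⟨ +-monoʳ-< (D q) (sync a i) ⟩
            D q + (w i + D q) ≡⟨ swap (D q) (w i) ⟩
            D q + D q + w i ≤⟨ +-monoˡ-≤ (w i) lo ⟩
            θ′ + w i ≡⟨ sym e ⟩
            D q + w a ∎)
          where
          open ≤-Reasoning
          swap : ∀ a b → a + (b + a) ≡ a + a + b
          swap = solve-∀

        quiet-last : sight a (t (pred (T q))) < 2
        quiet-last = quiet (pred (T q)) (≤-pred (D<T q)) ≤-refl λ i θ′ e _ hi → <-irrefl refl (begin-strict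
            θ′ + w i <⟨ +-mono-<-≤ hi (≤-pred (≤-trans (sync i a) (≤-reflexive (+-suc (w a) (guard q))))) ⟩
            D q + D q + m q * W q + (w a + guard q) ≡⟨ swap (D q + D q) (m q * W q) (w a) (guard q) ⟩
            D q + D q + (m q * W q + guard q) + w a ≡⟨ cong (_+ w a) (cong pred (sym (T-split q))) ⟩
            pred (T q) + w a ≡⟨ e ⟩
            θ′ + w i ∎)
          where
          open ≤-Reasoning
          swap : ∀ a b c d → a + b + (c + d) ≡ a + (b + d) + c
          swap = solve-∀

        visited : ∀ φ → φ < m q → proj₁ (conf (main q) φ (home z)) ≡ start a →
                  ∀ θ → θ < T q → t θ ≡ D q + D q + φ * W q + Of.slotTime z q → 2 ≤ sight a (t θ)
        visited φ φ<m at θ θ<T same = meeting (t θ) z≢a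
          (trans (trans (cong (place z) same) (trans (tour-place (woken z) q (alive z) moved φ φ<m) at))
                 (sym (listening a q (alive a) listens θ θ<T)))

        -- Clock differences shift both visits equally, so they remain exactly one phase apart on
        -- the listener's clock.
        echo : ∀ φ → suc φ < m q → proj₁ (conf (main q) φ (home z)) ≡ start a →
               proj₁ (conf (main q) (suc φ) (home z)) ≡ start a →
               ∃ λ θ → D q ≤ θ × W q + θ < T q × 2 ≤ sight a (t θ) × 2 ≤ sight a (t (W q + θ))
        echo φ φ<m at at′ with shifted sync a z φ (<-trans (n<1+n φ) φ<m) | shifted sync a z (suc φ) φ<m
        ... | θ , D≤θ , θ<T , e | θ′ , _ , θ′<T , e′ =
            θ , D≤θ , subst (_< T q) θ′≡ θ′<T , visited φ (<-trans (n<1+n φ) φ<m) at θ θ<T e ,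
            subst (λ x → 2 ≤ sight a (t x)) θ′≡ (visited (suc φ) φ<m at′ θ′ θ′<T e′)
          where
          θ′≡ : θ′ ≡ W q + θ
          θ′≡ = +-cancelʳ-≡ (Of.slotTime a q) θ′ (W q + θ) (trans e′ (trans (swap (D q + D q) (W q) (φ * W q) (Of.slotTime z q))
                   (trans (cong (W q +_) (sym e)) (sym (+-assoc (W q) θ _)))))
            where
            swap : ∀ a b c d → a + (b + c) + d ≡ b + (a + c + d)
            swap = solve-∀

-- Searching for the messages

-- room p m is one more than the length of the rest of m after its prefix p,
-- and 0 if p is not a prefix of m.
room : Message → Message → ℕ
room []          m           = suc (length m)
room (_ ∷ _)     []          = 0
room (false ∷ p) (false ∷ m) = room p m
room (true ∷ p)  (true ∷ m)  = room p m
room (false ∷ p) (true ∷ m)  = 0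
room (true ∷ p)  (false ∷ m) = 0

room-split : ∀ p m → room p m ≡ 0 × room (p ∷ʳ false) m + room (p ∷ʳ true) m ≡ 0 ⊎
                     room p m ≡ suc (room (p ∷ʳ false) m + room (p ∷ʳ true) m)
room-split []          []          = inj₂ refl
room-split []          (false ∷ m) = inj₂ (cong suc (sym (+-identityʳ _)))
room-split []          (true ∷ m)  = inj₂ refl
room-split (b ∷ p)     []          = inj₁ (refl , refl)
room-split (false ∷ p) (false ∷ m) = room-split p m
room-split (true ∷ p)  (true ∷ m)  = room-split p m
room-split (false ∷ p) (true ∷ m)  = inj₁ (refl , refl)
room-split (true ∷ p)  (false ∷ m) = inj₁ (refl , refl)

room-cases : ∀ p m → 0 < room p m → m ≡ p ⊎ 0 < room (p ∷ʳ false) m ⊎ 0 < room (p ∷ʳ true) m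
room-cases []          []          _ = inj₁ refl
room-cases []          (false ∷ m) _ = inj₂ (inj₁ (s≤s z≤n))
room-cases []          (true ∷ m)  _ = inj₂ (inj₂ (s≤s z≤n))
room-cases (false ∷ p) (false ∷ m) h with room-cases p m h
... | inj₁ e = inj₁ (cong (false ∷_) e)
... | inj₂ r = inj₂ r
room-cases (true ∷ p)  (true ∷ m)  h with room-cases p m h
... | inj₁ e = inj₁ (cong (true ∷_) e)
... | inj₂ r = inj₂ r

-- Questions asked on the channel: is there a message starting with p, is
-- there a message equal to p?
data Item : Set where
  starts : Message → Item
  equals : Message → Item

Matches : Item → Message → Set
Matches (starts p) m = 0 < room p m
Matches (equals p) m = m ≡ p

matches? : ∀ x m → Dec (Matches x m)
matches? (starts p) m = 0 <? room p m
matches? (equals p) m = List.≡-dec Bool._≟_ m p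

Search : Set
Search = List Item × List Message

advance : Bool → Search → Search
advance b     ([] , found)              = [] , found
advance false (_ ∷ todo , found)        = todo , found
advance true  (starts p ∷ todo , found) = equals p ∷ starts (p ∷ʳ false) ∷ starts (p ∷ʳ true) ∷ todo , found
advance true  (equals p ∷ todo , found) = todo , p ∷ found

searchStart : Search
searchStart = starts [] ∷ [] , []

module Searching {k : ℕ} (msg : Fin k → Message) where

  record Sound (s : Search) : Set where
    field
      genuine : ∀ p → p ∈ proj₂ s → ∃ λ j → msg j ≡ p
      covered : ∀ j → msg j ∈ proj₂ s ⊎ Any (λ x → Matches x (msg j)) (proj₁ s)

  sound-start : Sound searchStart
  sound-start = record { genuine = λ _ () ; covered = λ j → inj₂ (here (s≤s z≤n)) }

  sound-final : ∀ {found} → Sound ([] , found) → ∀ p → p ∈ found ⇔ (∃ λ j → msg j ≡ p)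
  sound-final {found} s p = mk⇔ (Sound.genuine s p) λ { (j , refl) → in-found j (Sound.covered s j) }
    where
    in-found : ∀ j → msg j ∈ found ⊎ Any (λ x → Matches x (msg j)) [] → msg j ∈ found
    in-found j (inj₁ i) = i

  sound-advance : ∀ b x todo found → (b ≡ true ⇔ (∃ λ j → Matches x (msg j))) →
                  Sound (x ∷ todo , found) → Sound (advance b (x ∷ todo , found))
  sound-advance false x todo found b⇔ s = record { genuine = Sound.genuine s ; covered = λ j → cov j (Sound.covered s j) }
    where
    cov : ∀ j → msg j ∈ found ⊎ Any (λ y → Matches y (msg j)) (x ∷ todo) → msg j ∈ found ⊎ Any (λ y → Matches y (msg j)) todo
    cov j (inj₁ i)         = inj₁ i
    cov j (inj₂ (here h))  = contradiction (Equivalence.from b⇔ (j , h)) λ ()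
    cov j (inj₂ (there a)) = inj₂ a
  sound-advance true (starts p) todo found b⇔ s = record { genuine = Sound.genuine s ; covered = λ j → cov j (Sound.covered s j) }
    where
    cov : ∀ j → msg j ∈ found ⊎ Any (λ y → Matches y (msg j)) (starts p ∷ todo) →
          msg j ∈ found ⊎ Any (λ y → Matches y (msg j)) (equals p ∷ starts (p ∷ʳ false) ∷ starts (p ∷ʳ true) ∷ todo)
    cov j (inj₁ i) = inj₁ i
    cov j (inj₂ (here h)) with room-cases p (msg j) h
    ... | inj₁ e        = inj₂ (here e)
    ... | inj₂ (inj₁ r) = inj₂ (there (here r))
    ... | inj₂ (inj₂ r) = inj₂ (there (there (here r)))
    cov j (inj₂ (there a)) = inj₂ (there (there (there a)))
  sound-advance true (equals p) todo found b⇔ s = record { genuine = gen ; covered = λ j → cov j (Sound.covered s j) }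
    where
    gen : ∀ r → r ∈ p ∷ found → ∃ λ j → msg j ≡ r
    gen r (here refl) = Equivalence.to b⇔ refl
    gen r (there i)   = Sound.genuine s r i
    cov : ∀ j → msg j ∈ found ⊎ Any (λ y → Matches y (msg j)) (equals p ∷ todo) →
          msg j ∈ p ∷ found ⊎ Any (λ y → Matches y (msg j)) todo
    cov j (inj₁ i)         = inj₁ (there i)
    cov j (inj₂ (here e))  = inj₁ (here e)
    cov j (inj₂ (there a)) = inj₂ a

  rooms : Message → ℕ
  rooms p = sum (λ j → room p (msg j))

  -- `room p m` counts the prefixes of m that extend p, and p itself is lost in passing to the two
  -- longer prefixes.
  rooms-split : ∀ p → (∃ λ j → 0 < room p (msg j)) → suc (rooms (p ∷ʳ false) + rooms (p ∷ʳ true)) ≤ rooms p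
  rooms-split p (j , h) = ≤-trans (≤-reflexive (cong suc (sym (∑-distrib-+ (λ j → room (p ∷ʳ false) (msg j)) (λ j → room (p ∷ʳ true) (msg j))))))
                                  (sum-strict _ (λ j → room p (msg j)) le j lt)
    where
    sum-strict : ∀ {k} (f g : Fin k → ℕ) → (∀ i → f i ≤ g i) → ∀ j → f j < g j → sum f < sum g
    sum-strict f g le zero    lt = +-mono-<-≤ lt (sum-mono (le ∘ suc))
    sum-strict f g le (suc j) lt = +-mono-≤-< (le zero) (sum-strict (f ∘ suc) (g ∘ suc) (le ∘ suc) j lt)
    le : ∀ i → room (p ∷ʳ false) (msg i) + room (p ∷ʳ true) (msg i) ≤ room p (msg i)
    le i with room-split p (msg i)
    ... | inj₁ (e , e′) = ≤-reflexive (trans e′ (sym e))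
    ... | inj₂ e = ≤-trans (n≤1+n _) (≤-reflexive (sym e))
    lt : room (p ∷ʳ false) (msg j) + room (p ∷ʳ true) (msg j) < room p (msg j)
    lt with room-split p (msg j)
    ... | inj₁ (e , e′) = contradiction (subst (0 <_) e h) λ ()
    ... | inj₂ e = ≤-reflexive (sym e)

  -- Yes to `starts p` replaces one question by three, and at most `rooms p` such answers occur at p
  -- and its extensions. So each unit of `rooms` pays for three questions, and the 1 for the
  -- question itself.
  weight : Item → ℕ
  weight (starts p) = suc (3 * rooms p)
  weight (equals p) = 1

  work : List Item → ℕ
  work []         = 0
  work (x ∷ todo) = weight x + work todo

  work-advance : ∀ b x todo found → (b ≡ true → ∃ λ j → Matches x (msg j)) →
                 work (proj₁ (advance b (x ∷ todo , found))) < work (x ∷ todo)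
  work-advance false (starts p) todo found h = s≤s (m≤n+m _ _)
  work-advance false (equals p) todo found h = ≤-refl
  work-advance true  (equals p) todo found h = ≤-refl
  work-advance true  (starts p) todo found h = begin-strict
    1 + (suc (3 * a) + (suc (3 * b) + work todo)) <⟨ n<1+n _ ⟩
    suc (1 + (suc (3 * a) + (suc (3 * b) + work todo))) ≡⟨ collect a b (work todo) ⟩
    suc (3 * suc (a + b) + work todo) ≤⟨ s≤s (+-monoˡ-≤ (work todo) (*-monoʳ-≤ 3 (rooms-split p (h refl)))) ⟩
    suc (3 * rooms p) + work todo ∎
    where
    open ≤-Reasoning
    a = rooms (p ∷ʳ false)
    b = rooms (p ∷ʳ true)
    regroup : ∀ x y c → 1 + (1 + (1 + x + (1 + y + c))) ≡ 1 + (3 + (x + y) + c)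
    regroup = solve-∀
    collect : ∀ a b c → suc (1 + (suc (3 * a) + (suc (3 * b) + c))) ≡ suc (3 * suc (a + b) + c)
    collect a b c = trans (regroup (3 * a) (3 * b) c)
      (cong (λ z → suc (z + c)) (trans (cong (3 +_) (sym (*-distribˡ-+ 3 a b))) (sym (*-suc 3 (a + b)))))

-- A known bound on the size

-- A trace gains at most one hop per command, so as many retreats empty it; retreating from home is
-- waiting.
tour : List Cmd → List Cmd
tour cs = cs ++ replicate (length cs) retreat

length-tour : ∀ cs → length (tour cs) ≡ length cs + length cs
length-tour cs = trans (length-++ cs) (cong (length cs +_) (length-replicate (length cs)))

module _ {n : ℕ} (G : PortGraph n) where
  open Motion G
  open PortGraph G

  exec-length : ∀ x d → length (proj₂ (exec x d)) ≤ suc (length (proj₂ x))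
  exec-length x wait = n≤1+n _
  exec-length (u , tr) (fwd p) with p <? deg u
  ... | yes _ = ≤-refl
  ... | no _  = n≤1+n _
  exec-length (u , [])     undo = z≤n
  exec-length (u , _ ∷ tr) undo = ≤-trans (n≤1+n _) (n≤1+n _)

  conf-length : ∀ cs φ x → length (proj₂ (conf cs φ x)) ≤ φ + length (proj₂ x)
  conf-length cs       zero    x = ≤-refl
  conf-length []       (suc φ) x = m≤n+m _ _
  conf-length (c ∷ cs) (suc φ) x = ≤-trans (conf-length cs φ (perform c x))
    (≤-trans (+-monoʳ-≤ φ (exec-length x (c (proj₂ x) (deg (proj₁ x))))) (≤-reflexive (+-suc φ _)))

  conf-retreat : ∀ a x → length (proj₂ x) ≤ a → proj₂ (conf (replicate a retreat) a x) ≡ []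
  conf-retreat zero    (u , [])     _       = refl
  conf-retreat (suc a) (u , [])     _       = conf-retreat a (u , []) z≤n
  conf-retreat (suc a) (u , _ ∷ tr) (s≤s l) = conf-retreat a (moveTo G u _ , tr) l

  tour-returns : ∀ cs home → proj₂ (conf (tour cs) (length (tour cs)) (home , [])) ≡ []
  tour-returns cs home = begin
    proj₂ (conf (tour cs) (length (tour cs)) (home , []))
      ≡⟨ cong (λ z → proj₂ (conf (tour cs) z (home , []))) (length-tour cs) ⟩
    proj₂ (conf (tour cs) (length cs + length cs) (home , []))
      ≡⟨ cong proj₂ (conf-++ʳ cs (replicate (length cs) retreat) (length cs) (home , [])) ⟩
    proj₂ (conf (replicate (length cs) retreat) (length cs) (conf cs (length cs) (home , [])))
      ≡⟨ conf-retreat (length cs) _ (≤-trans (conf-length cs (length cs) (home , [])) (≤-reflexive (+-identityʳ _))) ⟩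
    [] ∎
    where open ≡-Reasoning

walkCmd : ℕ → Cmd
walkCmd p _ _ = fwd p

module _ {n : ℕ} (G : PortGraph n) where
  open Motion G

  conf-walk : ∀ ps φ x → φ ≤ length ps → proj₁ (conf (map walkCmd ps) φ x) ≡ walk G (proj₁ x) (take φ ps)
  conf-walk ps       zero    x _ = refl
  conf-walk (p ∷ ps) (suc φ) (u , tr) (s≤s l) =
    trans (conf-walk ps φ (exec (u , tr) (fwd p)) l) (cong (λ z → walk G z (take φ ps)) lemma)
    where
    lemma : proj₁ (exec (u , tr) (fwd p)) ≡ moveTo G u p
    lemma with p <? PortGraph.deg G u
    ... | yes _ = refl
    ... | no _  = refl

asked : Message → Search → Bool
asked μ ([] , _)    = false
asked μ (x ∷ _ , _) = does (matches? x μ)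

exhausted : Search → Bool
exhausted ([] , _)    = true
exhausted (_ ∷ _ , _) = false

module Exploring (X : List ℕ) (P>0 : 0 < length X) where

  P : ℕ
  P = length X

  cycle : List Cmd
  cycle = tour (map walkCmd X)

  -- In slot 0 everybody tours, in order to wake the others. The tour starts after two rounds and
  -- visits every home within P more, so wake-up times differ by at most 2 + P, the guard of all
  -- later slots.
  known : Protocol
  known = record
    { Mem     = Message × Search
    ; init    = λ _ μ → μ , searchStart
    ; guard   = λ { zero → 0 ; (suc _) → 2 + P }
    ; pace    = λ _ → 0
    ; main    = λ _ → cycle
    ; returns = λ _ G → tour-returns G (map walkCmd X)
    ; moves   = λ { zero _ → true ; (suc _) (μ , s) → asked μ s }
    ; update  = λ { zero mem _ _ → mem
                  ; (suc _) (μ , s) _ cs →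
                      -- 3 + P and the sum after it are `D` and `T` of this slot, written out
                      -- because these are computed from the protocol.
                      μ , advance (asked μ s ∨ does (heard? (3 + P) ((3 + P + (3 + P)) + (length cycle * 1 + (3 + P))) cs)) s }
    ; halted  = λ (_ , s) → exhausted s
    ; out     = λ (_ , _ , found) → found
    }

  length-cycle : length cycle ≡ P + P
  length-cycle = trans (length-tour (map walkCmd X)) (cong₂ _+_ (length-map walkCmd X) (length-map walkCmd X))

  module Round {n k : ℕ} (G : PortGraph n) (covers : ∀ u v → ∃ λ j → j ≤ P × walk G u (take j X) ≡ v)
           (start : Fin k → Fin n) (start-inj : Injective start)
           (label : Fin k → ℕ) (msg : Fin k → Message) (wake : Fin k → Maybe ℕ)
           (i0 : Fin k) (t0 : ℕ) (i0-wakes : wake i0 ≡ just t0) where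
    open Controller known
    open Motion G
    open World known G start start-inj label msg wake
    open Searching msg

    visits : ∀ i v → ∃ λ φ → φ ≤ P × proj₁ (conf cycle φ (home i)) ≡ v
    visits i v with covers (start i) v
    ... | φ , φ≤P , e = φ , φ≤P , trans (cong proj₁ (conf-++ˡ (map walkCmd X) _ φ (home i)
                                           (subst (φ ≤_) (sym (length-map walkCmd X)) φ≤P)))
                                   (trans (conf-walk G X φ (home i) φ≤P) e)

    -- A node may be reached only after all P forward commands; the way back, not empty as P > 0,
    -- keeps this index below the length of the tour.
    inside : ∀ {φ} → φ ≤ P → φ < length cycle
    inside φ≤P = ≤-<-trans φ≤P (subst (P <_) (sym length-cycle) (m<m+n P P>0))

    explores : ∀ q → Explores q
    explores q i v with visits i v
    ... | φ , φ≤P , e = φ , inside φ≤P , e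

    rouse : ∀ {i w} → Woken i w → ∀ j → ∃ λ w′ → w′ ≤ 2 + P + w × Woken j w′
    rouse {i} {w} woken j with visits i (start j)
    ... | φ , φ≤P , e with arouses woken 0 (λ { zero _ → refl ; (suc _) (s≤s ()) }) refl φ (inside φ≤P) j e
    ... | w′ , w′≤ , W′ = w′ , ≤-trans w′≤ (+-monoˡ-≤ w (+-monoʳ-≤ 2 (≤-trans (≤-reflexive (*-identityʳ φ)) φ≤P))) , W′

    first : ∃ λ w → w ≤ t0 × Woken i0 w
    first = woken-by i0 t0 (wakeNow-adversary (stateAt t0) t0 i0 i0-wakes)

    w : Fin k → ℕ
    w j = proj₁ (rouse (proj₂ (proj₂ first)) j)

    woken : ∀ j → Woken j (w j)
    woken j = proj₂ (proj₂ (rouse (proj₂ (proj₂ first)) j))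

    w≤ : ∀ j → w j ≤ 2 + P + t0
    w≤ j = ≤-trans (proj₁ (proj₂ (rouse (proj₂ (proj₂ first)) j))) (+-monoʳ-≤ (2 + P) (proj₁ (proj₂ first)))

    open Together w woken

    sync : ∀ q → Sync (suc q)
    sync q i j = subst (_< w j + (3 + P)) (woken-unique (proj₂ (proj₂ aroused)) (woken i))
                   (≤-trans (s≤s (proj₁ (proj₂ aroused))) (≤-reflexive (+-comm (3 + P) (w j))))
      where aroused = rouse (woken j) i

    D-mono : ∀ {q r} → q ≤ r → D q ≤ D r
    D-mono {zero}  {zero}  _ = ≤-refl
    D-mono {zero}  {suc r} _ = s≤s z≤n
    D-mono {suc q} {suc r} _ = ≤-refl

    record Agreed (q : ℕ) (s : Search) : Set where
      field
        memory≡ : ∀ i → Of.memory i q ≡ (msg i , s)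
        alive   : ∀ i → Of.Alive i q
        sound   : Sound s

    next-agreed : ∀ {q x todo found} → Agreed (suc q) (x ∷ todo , found) →
                  ∃ λ s → Agreed (suc (suc q)) s × work (proj₁ s) < work (x ∷ todo)
    next-agreed {q} {x} {todo} {found} ag = advance b s , record
        { memory≡ = λ i → trans (cong (λ mem → update (suc q) mem (deg (start i)) (hears i)) (memory≡ i))
                                 (cong (λ c → msg i , advance c s)
                                   (trans (cong (_∨ does (heard? (D (suc q)) (T (suc q)) (hears i))) (sym (moves≡ i))) (common-answer (λ j → matches? x (msg j)) moves≡ i)))
        ; alive   = alive′
        ; sound   = sound-advance b x todo found (does-iff someone) sound }
      , work-advance b x todo found (Equivalence.to (does-iff someone))
      where
      open Agreed ag
      open Protocol known using (moves; update)
      open PortGraph G using (deg)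
      s = x ∷ todo , found
      someone = F.any? (λ j → matches? x (msg j))
      b = does someone
      alive′ : ∀ i → Of.Alive i (suc (suc q))
      alive′ i = Of.alive-suc i (alive i) (cong (λ mem → exhausted (proj₂ mem)) (memory≡ i))
      open Query D-mono (sync q) alive′ (explores (suc q))
      moves≡ : ∀ i → moves (suc q) (Of.memory i (suc q)) ≡ does (matches? x (msg i))
      moves≡ i = cong (λ (μ , s) → asked μ s) (memory≡ i)

    agreed-1 : Agreed 1 searchStart
    agreed-1 = record { memory≡ = λ _ → refl ; alive = λ { i zero _ → refl ; i (suc _) (s≤s ()) } ; sound = sound-start }

    finish : ∀ fuel {q s} → work (proj₁ s) ≤ fuel → Agreed (suc q) s →
             ∃ λ r → r ≤ suc q + fuel × ∃ λ found → Agreed r ([] , found)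
    finish fuel {q} {[] , found} _ ag = suc q , m≤m+n (suc q) fuel , found , ag
    finish zero {q} {starts _ ∷ _ , _} () ag
    finish zero {q} {equals _ ∷ _ , _} () ag
    finish (suc fuel) {q} {x ∷ todo , found} le ag =
      let s′ , ag′ , lt = next-agreed ag
          r , r≤ , res  = finish fuel (≤-pred (≤-trans lt le)) ag′
      in r , ≤-trans r≤ (≤-reflexive (sym (+-suc (suc q) fuel))) , res

    effort : ℕ
    effort = work (proj₁ searchStart)

    duration : ℕ
    duration = suc (begins (suc effort) + (2 + P))

    conclude : ∀ {r found} → r ≤ suc effort → Agreed r ([] , found) → ∀ i → CorrectlyDone msg (stateAt (t0 + duration) i)
    conclude {r} {found} r≤ ag i = subst (CorrectlyDone msg) (sym final) (sound-final (Agreed.sound ag))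
      where
      open ≤-Reasoning hiding (start)
      late : begins r + w i < t0 + duration
      late = begin-strict
        begins r + w i ≤⟨ +-mono-≤ (begins-mono r≤) (w≤ i) ⟩
        begins (suc effort) + (2 + P + t0) <⟨ n<1+n _ ⟩
        suc (begins (suc effort) + (2 + P + t0)) ≡⟨ rot (begins (suc effort)) P t0 ⟩
        t0 + duration ∎
        where
        rot : ∀ a b c → 1 + (a + (2 + b + c)) ≡ c + (1 + (a + (2 + b)))
        rot = solve-∀
      final : stateAt (t0 + duration) i ≡ done (start i) found
      final = trans (Of.finished i r (Agreed.alive ag i) (cong (λ mem → exhausted (proj₂ mem)) (Agreed.memory≡ ag i)) (t0 + duration) late)
                    (cong (λ (_ , _ , f) → done (start i) f) (Agreed.memory≡ ag i))

    all-done : AllDoneAt G algorithm start label msg wake (t0 + duration)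
    all-done = let r , r≤ , found , ag = finish effort ≤-refl agreed-1 in conclude r≤ ag

    -- A slot consists of three guard times of 3 + P rounds and a tour of 2 P, which makes 5 P + 9.
    -- Beyond one slot per unit of effort, one is slot 0 and one covers the wake-up delay.
    duration≤ : ∀ B → P + P + P + P + P + 9 ≤ B → duration ≤ (effort + 2) * B
    duration≤ B h = begin
      suc (begins (suc effort) + (2 + P)) ≤⟨ s≤s (+-monoˡ-≤ (2 + P) (begins≤ (suc effort))) ⟩
      suc (suc effort * B + (2 + P)) ≡⟨ rot (suc effort * B) P ⟩
      (P + 3) + suc effort * B ≤⟨ +-monoˡ-≤ (suc effort * B) (≤-trans (≤-trans (m≤m+n (P + 3) (P + P + P + P + 6)) (≤-reflexive (five P))) h) ⟩
      B + suc effort * B ≡⟨ cong (_* B) (+-comm 2 effort) ⟩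
      (effort + 2) * B ∎
      where
      open ≤-Reasoning hiding (start)
      rot : ∀ a b → 1 + (a + (2 + b)) ≡ (b + 3) + a
      rot = solve-∀
      five : ∀ a → a + 3 + (a + a + a + a + 6) ≡ a + a + a + a + a + 9
      five = solve-∀
      slot≤ : ∀ q → T q ≤ B
      slot≤ zero = begin
        2 + (length cycle * 1 + 1) ≡⟨ cong (λ z → 2 + (z + 1)) (trans (*-identityʳ (length cycle)) length-cycle) ⟩
        2 + (P + P + 1) ≤⟨ m≤m+n _ (P + P + P + 6) ⟩
        2 + (P + P + 1) + (P + P + P + 6) ≡⟨ sum0 P ⟩
        P + P + P + P + P + 9 ≤⟨ h ⟩
        B ∎
        where
        sum0 : ∀ a → 2 + (a + a + 1) + (a + a + a + 6) ≡ a + a + a + a + a + 9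
        sum0 = solve-∀
      slot≤ (suc q) = begin
        (3 + P + (3 + P)) + (length cycle * 1 + (3 + P)) ≡⟨ cong (λ z → (3 + P + (3 + P)) + (z + (3 + P))) (trans (*-identityʳ (length cycle)) length-cycle) ⟩
        (3 + P + (3 + P)) + (P + P + (3 + P)) ≡⟨ sum1 P ⟩
        P + P + P + P + P + 9 ≤⟨ h ⟩
        B ∎
        where
        sum1 : ∀ a → (3 + a + (3 + a)) + (a + a + (3 + a)) ≡ a + a + a + a + a + 9
        sum1 = solve-∀
      begins≤ : ∀ q → begins q ≤ q * B
      begins≤ zero    = z≤n
      begins≤ (suc q) = ≤-trans (+-mono-≤ (begins≤ q) (slot≤ q)) (≤-reflexive (+-comm (q * B) B))

    effort≤ : effort ≤ 1 + 3 * (k * suc (maxMsgLength msg))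
    effort≤ = ≤-trans (≤-reflexive (+-identityʳ _)) (s≤s (*-monoʳ-≤ 3 (sum-bound (λ j → s≤s (length≤max j)))))
      where
      below : ∀ (xs : List (Fin k)) {j} → j ∈ xs → length (msg j) ≤ foldr _⊔_ 0 (map (λ i → length (msg i)) xs)
      below (x ∷ xs) (here refl) = m≤m⊔n _ _
      below (x ∷ xs) (there j∈)  = ≤-trans (below xs j∈) (m≤n⊔m (length (msg x)) _)
      length≤max : ∀ j → length (msg j) ≤ maxMsgLength msg
      length≤max j = below (allFin k) (∈-allFin j)

    agents≤ : k ≤ n
    agents≤ = F.injective⇒≤ (λ {i} {j} → start-inj i j)

uts-length≤ : ∀ N B .{{_ : NonZero N}} → N ≤ B → 1 ≤ B → utsLength N ≤ 8 * B ^ 7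
uts-length≤ N B N≤B 1≤B = begin
  suc (cube N + (N + N)) * (N * (2 * cube N)) ≤⟨ *-mono-≤ first (*-mono-≤ N≤B (*-monoʳ-≤ 2 cube≤)) ⟩
  (4 * cube B) * (B * (2 * cube B)) ≡⟨ expand B ⟩
  8 * B ^ 7 ∎
  where
  open ≤-Reasoning
  instance
    B≢0 : NonZero B
    B≢0 = >-nonZero 1≤B
  cube≤ : cube N ≤ cube B
  cube≤ = *-mono-≤ N≤B (*-mono-≤ N≤B N≤B)
  B≤cube : B ≤ cube B
  B≤cube = m≤m*n B (B * B) {{m*n≢0 B B}}
  first : suc (cube N + (N + N)) ≤ 4 * cube B
  first = begin
    1 + (cube N + (N + N)) ≤⟨ +-mono-≤ (≤-trans 1≤B B≤cube) (+-mono-≤ cube≤ (+-mono-≤ (≤-trans N≤B B≤cube) (≤-trans N≤B B≤cube))) ⟩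
    cube B + (cube B + (cube B + cube B)) ≡⟨ four (cube B) ⟩
    4 * cube B ∎
    where
    four : ∀ a → a + (a + (a + a)) ≡ 4 * a
    four = solve-∀
  expand : ∀ b → (4 * (b * (b * b))) * (b * (2 * (b * (b * b)))) ≡ 8 * (b * (b * (b * (b * (b * (b * (b * 1)))))))
  expand = solve-∀

uts>0 : ∀ N → 0 < length (uts (suc N))
uts>0 N = subst (0 <_) (sym (length-uts (suc N))) (s≤s z≤n)

knownAlgorithm : ℕ → Algorithm
knownAlgorithm zero    = λ _ _ _ → stay
knownAlgorithm (suc N) = Controller.algorithm (Exploring.known (uts (suc N)) (uts>0 N))

abstract
  -- The statement uses one constant as factor and as degree. The time is at most 6 B² slots of 49 B
  -- ^ 7 rounds, hence 294 B ^ 9, and 300 is rounded up from 294.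
  exponent : ℕ
  exponent = 300

  exponent-bound : ∀ B .{{_ : NonZero B}} → 300 * B ^ 9 ≤ exponent * B ^ exponent
  exponent-bound B = *-monoʳ-≤ 300 (^-monoʳ-≤ B (m≤m+n 9 291))

polynomial : ∀ B e p .{{_ : NonZero B}} → e ≤ 1 + 3 * (B * B) → p ≤ 8 * B ^ 7 →
             (e + 2) * (p + p + p + p + p + 9) ≤ exponent * B ^ exponent
polynomial B e p he hp = begin
  (e + 2) * (p + p + p + p + p + 9) ≤⟨ *-mono-≤ six (+-mono-≤ (+-mono-≤ (+-mono-≤ (+-mono-≤ (+-mono-≤ hp hp) hp) hp) hp) nine) ⟩
  (6 * (B * B)) * (b + b + b + b + b + 9 * B ^ 7) ≡⟨ collect B (B ^ 7) ⟩
  294 * (B * (B * B ^ 7)) ≤⟨ *-monoˡ-≤ (B ^ 9) (m≤m+n 294 6) ⟩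
  300 * B ^ 9 ≤⟨ exponent-bound B ⟩
  exponent * B ^ exponent ∎
  where
  open ≤-Reasoning
  b = 8 * B ^ 7
  nine : 9 ≤ 9 * B ^ 7
  nine = m≤m*n 9 (B ^ 7) {{m^n≢0 B 7}}
  six : e + 2 ≤ 6 * (B * B)
  six = begin
    e + 2 ≤⟨ +-monoˡ-≤ 2 he ⟩
    1 + 3 * (B * B) + 2 ≡⟨ +-comm (1 + 3 * (B * B)) 2 ⟩
    3 + 3 * (B * B) ≤⟨ +-monoˡ-≤ (3 * (B * B)) (m≤m*n 3 (B * B) {{m*n≢0 B B}}) ⟩
    3 * (B * B) + 3 * (B * B) ≡⟨ sym (*-distribʳ-+ (B * B) 3 3) ⟩
    6 * (B * B) ∎
  collect : ∀ x y → (6 * (x * x)) * (8 * y + 8 * y + 8 * y + 8 * y + 8 * y + 9 * y) ≡ 294 * (x * (x * y))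
  collect = solve-∀

known-bound : KnownBoundPoly
known-bound = knownAlgorithm , exponent , bound
  where
  bound : ∀ (N : ℕ) → 2 ≤ N → ∀ {n k} (G : PortGraph n) → n ≤ N →
          ∀ (start : Fin k → Fin n) (label : Fin k → ℕ) (msg : Fin k → Message)
            (wake : Fin k → Maybe ℕ) (i0 : Fin k) (t0 : ℕ) → Instance start label wake i0 t0 →
          ∀ (imin : Fin k) → (∀ j → label imin ≤ label j) →
          Σ ℕ λ t → t ≤ exponent * (1 + N + binLength (label imin) + maxMsgLength msg) ^ exponent ×
                    AllDoneAt G (knownAlgorithm N) start label msg wake (t0 + t)
  bound (suc N) _ {n} {k} G n≤N start label msg wake i0 t0 inst imin _ =
      E.duration , ≤-trans (E.duration≤ _ ≤-refl) (polynomial B E.effort (length X) effort≤B (≤-trans (≤-reflexive (length-uts (suc N))) (uts-length≤ (suc N) B N≤B (s≤s z≤n)))) , E.all-done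
    where
    X = uts (suc N)
    L = maxMsgLength msg
    B = 1 + suc N + binLength (label imin) + L
    covers : ∀ u v → ∃ λ j → j ≤ length X × walk G u (take j X) ≡ v
    covers u v = subst (λ z → ∃ λ j → j ≤ z × walk G u (take j X) ≡ v) (sym (length-uts (suc N))) (uts-visits G n≤N u v)
    module E = Exploring.Round X (uts>0 N) G covers start (Instance.start-inj inst) label msg wake i0 t0 (Instance.i0-wakes inst)
    N≤B : suc N ≤ B
    N≤B = ≤-trans (n≤1+n (suc N)) (≤-trans (m≤m+n (1 + suc N) (binLength (label imin))) (m≤m+n _ L))
    L<B : suc L ≤ B
    L<B = s≤s (m≤n+m L _)
    effort≤B : E.effort ≤ 1 + 3 * (B * B)
    effort≤B = ≤-trans E.effort≤ (s≤s (*-monoʳ-≤ 3 (*-mono-≤ (≤-trans E.agents≤ (≤-trans n≤N N≤B)) L<B)))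

-- Enumerations

diagonal : ℕ × ℕ → ℕ × ℕ
diagonal (zero  , y) = suc y , 0
diagonal (suc x , y) = x , suc y

-- Cantor's enumeration of pairs, as the iteration of the step to the next pair on the diagonals.
unpair : ℕ → ℕ × ℕ
unpair zero    = 0 , 0
unpair (suc n) = diagonal (unpair n)

unpair-onto : ∀ x y → ∃ λ n → unpair n ≡ (x , y)
unpair-onto x y = subst (λ z → ∃ λ n → unpair n ≡ (z , y)) (m+n∸n≡m x y) (along (x + y) y (m≤n+m y x))
  where
  along : ∀ s y → y ≤ s → ∃ λ n → unpair n ≡ (s ∸ y , y)
  along zero    zero    _ = 0 , refl
  along (suc s) zero    _ = let n , e = along s s ≤-refl in
    suc n , cong diagonal (trans e (cong (_, s) (n∸n≡0 s)))
  along s (suc y) y<s = let n , e = along s y (<⇒≤ y<s) in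
    suc n , trans (cong diagonal (trans e (cong (_, y) (sym (suc-pred (s ∸ y) {{>-nonZero (m<n⇒0<n∸m y<s)}})))))
                  (cong (_, suc y) (pred[m∸n]≡m∸[1+n] s y))

unpair-bound : ∀ n → proj₁ (unpair n) + proj₂ (unpair n) ≤ n
unpair-bound zero    = z≤n
unpair-bound (suc n) with unpair n | unpair-bound n
... | zero  , y | h = s≤s (≤-trans (≤-reflexive (+-identityʳ y)) h)
... | suc x , y | h = ≤-trans (≤-reflexive (+-suc x y)) (≤-trans h (n≤1+n n))

record Coded (A : Set) : Set where
  field
    decode : ℕ → A
    onto   : ∀ a → ∃ λ n → decode n ≡ a

open Coded

coded-ℕ : Coded ℕ
coded-ℕ = record { decode = λ n → n ; onto = λ n → n , refl }

coded-× : ∀ {A B} → Coded A → Coded B → Coded (A × B)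
coded-× {A} {B} CA CB = record { decode = dec ; onto = on }
  where
  dec : ℕ → A × B
  dec n = let x , y = unpair n in decode CA x , decode CB y
  on : ∀ p → ∃ λ n → dec n ≡ p
  on (a , b) = let x , ex = onto CA a ; y , ey = onto CB b ; n , en = unpair-onto x y in
    n , trans (cong (λ (x , y) → decode CA x , decode CB y) en) (cong₂ _,_ ex ey)

coded-List : ∀ {A} → Coded A → Coded (List A)
coded-List {A} CA = record { decode = λ n → let l , r = unpair n in dec l r ; onto = on }
  where
  dec : ℕ → ℕ → List A
  dec zero    n = []
  dec (suc l) n = let x , r = unpair n in decode CA x ∷ dec l r
  dec-onto : ∀ as → ∃ λ n → dec (length as) n ≡ as
  dec-onto []       = 0 , refl
  dec-onto (a ∷ as) = let x , ex = onto CA a ; r , er = dec-onto as ; n , en = unpair-onto x r in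
    n , trans (cong (λ (x , r) → decode CA x ∷ dec (length as) r) en) (cong₂ _∷_ ex er)
  on : ∀ as → ∃ λ n → dec (proj₁ (unpair n)) (proj₂ (unpair n)) ≡ as
  on as = let r , er = dec-onto as ; n , en = unpair-onto (length as) r in
    n , trans (cong (λ (l , r) → dec l r) en) er

-- Ignoring the second component of a pair makes every value recur.
recurring : ∀ {A} → Coded A → ℕ → A
recurring CA n = decode CA (proj₁ (unpair n))

recurs : ∀ {A} (CA : Coded A) a h → ∃ λ n → h ≤ n × recurring CA n ≡ a
recurs CA a h = let x , ex = onto CA a ; n , en = unpair-onto x h in
  n , ≤-trans (≤-trans (≤-reflexive (sym (cong proj₂ en))) (m≤n+m _ (proj₁ (unpair n)))) (unpair-bound n)
    , trans (cong (λ p → decode CA (proj₁ p)) en) ex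

-- Certificates for a bound on the size

Fact : Set
Fact = ℕ × Trace

hop-≟ : (x y : Hop) → Dec (x ≡ y)
hop-≟ = Product.≡-dec _≟_ (Product.≡-dec _≟_ _≟_)

trace-≟ : (x y : Trace) → Dec (x ≡ y)
trace-≟ = List.≡-dec hop-≟

fact-≟ : (x y : Fact) → Dec (x ≡ y)
fact-≟ = Product.≡-dec _≟_ trace-≟

open import Data.List.Membership.DecPropositional fact-≟ using () renaming (_∈?_ to _∈ᶠ?_)

coded-trace : Coded Trace
coded-trace = coded-List (coded-× coded-ℕ (coded-× coded-ℕ coded-ℕ))

coded-fact : Coded Fact
coded-fact = coded-× coded-ℕ coded-trace

-- A pair (x , s) stands for the node at the end of the trace x from the home
-- of the agent labelled b, from which the trace s leads to the own home.
Entry : Set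
Entry = Trace × Trace

-- A node is recognised by its return trace s: traces can be followed backwards, so two traces from
-- the home of b that both lead to the own home when continued by s end at the same node. The fact
-- thus says that port c leads to the node of the entry with return trace s.
Edge : ℕ → List Entry → List Fact → Trace → ℕ → ℕ → ℕ → Set
Edge b X Φ x d c e = Any (λ (_ , s) → (b , s ++ (d , c , e) ∷ x) ∈ Φ) X

-- A hop records the degree of the node it leaves, so a single edge confirms d; `0 < d` guarantees
-- that there is one.
Degree : ℕ → ℕ → List Entry → List Fact → Trace → ℕ → Set
Degree h b X Φ x d = 0 < d × (∀ {c} → c < d → ∃ λ e → e < h × Edge b X Φ x d c e)

-- The facts in Φ show that the nodes represented by X are closed under
-- taking neighbours.
record Certificate (h b : ℕ) (X : List Entry) (Φ : List Fact) : Set where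
  constructor certificate
  field
    size   : length X ≤ h
    origin : Any (λ (x , _) → x ≡ []) X
    facts  : All (λ (x , s) → (b , s ++ x) ∈ Φ) X
    edges  : All (λ (x , _) → ∃ λ d → d < h × Degree h b X Φ x d) X

certificate? : ∀ h b X Φ → Dec (Certificate h b X Φ)
certificate? h b X Φ
  with length X ≤? h
     | Any.any? (λ (x , _) → trace-≟ x []) X
     | All.all? (λ (x , s) → (b , s ++ x) ∈ᶠ? Φ) X
     | All.all? (λ (x , _) → anyUpTo? (λ d → (0 <? d) ×-dec allUpTo? (λ c → anyUpTo? (λ e →
         Any.any? (λ (_ , s) → (b , s ++ (d , c , e) ∷ x) ∈ᶠ? Φ) X) h) d) h) X
... | yes p | yes q | yes r | yes t = yes (certificate p q r t)
... | no ¬p | _     | _     | _     = no (¬p ∘ Certificate.size)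
... | _     | no ¬q | _     | _     = no (¬q ∘ Certificate.origin)
... | _     | _     | no ¬r | _     = no (¬r ∘ Certificate.facts)
... | _     | _     | _     | no ¬t = no (¬t ∘ Certificate.edges)

coded-claim : Coded (ℕ × List Entry)
coded-claim = coded-× coded-ℕ (coded-List (coded-× coded-trace coded-trace))

abstract
  claim : ℕ → ℕ × List Entry
  claim = Coded.decode coded-claim

  claim-onto : ∀ x → ∃ λ c → claim c ≡ x
  claim-onto = Coded.onto coded-claim

-- h bounds the size, all numbers in the certificate and the code of the claim, which makes the
-- property decidable; a valid claim is found once h is large enough.
Knows : List Fact → ℕ → Set
Knows Φ h = ∃ λ c → c < h × Certificate h (proj₁ (claim c)) (proj₂ (claim c)) Φ

abstract
  knows? : ∀ Φ h → Dec (Knows Φ h)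
  knows? Φ h = anyUpTo? (λ c → certificate? h (proj₁ (claim c)) (proj₂ (claim c)) Φ) h

Eventually : (ℕ → Set) → Set
Eventually P = ∃ λ H → ∀ h → H ≤ h → P h

eventually-× : ∀ {P Q} → Eventually P → Eventually Q → Eventually (λ h → P h × Q h)
eventually-× (H , p) (H′ , q) = H ⊔ H′ , λ h le →
  p h (≤-trans (m≤m⊔n H H′) le) , q h (≤-trans (m≤n⊔m H H′) le)

eventually-∀ : ∀ {m} {P : Fin m → ℕ → Set} → (∀ i → Eventually (P i)) → Eventually (λ h → ∀ i → P i h)
eventually-∀ {zero}  ev = 0 , λ _ _ ()
eventually-∀ {suc m} ev = let H , p = eventually-× (ev zero) (eventually-∀ (λ i → ev (suc i))) in
  H , λ h le → λ { zero → proj₁ (p h le) ; (suc i) → proj₂ (p h le) i }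

eventually-map : ∀ {P Q : ℕ → Set} → (∀ h → P h → Q h) → Eventually P → Eventually Q
eventually-map f (H , p) = H , λ h le → f h (p h le)

module Routes {n : ℕ} (G : PortGraph n) where
  open PortGraph G
  open Motion G

  -- Inversion of `hop` in terms of equations, as the indices of a `Route` contain function values
  -- that resist matching.
  record LastHop (home : Fin n) (d p e : ℕ) (tr : Trace) (v : Fin n) : Set where
    field
      from  : Fin n
      route : Route home tr from
      port  : Fin (deg from)
      d≡    : d ≡ deg from
      p≡    : p ≡ toℕ port
      e≡    : e ≡ toℕ (back from port)
      v≡    : v ≡ nbr from port

  last-hop : ∀ {home d p e tr v} → Route home ((d , p , e) ∷ tr) v → LastHop home d p e tr v
  last-hop (hop {u = u} r p) = record { from = u ; route = r ; port = p ; d≡ = refl ; p≡ = refl ; e≡ = refl ; v≡ = refl }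

  route-deterministic : ∀ {home v v′} tr → Route home tr v → Route home tr v′ → v ≡ v′
  route-deterministic [] root root = refl
  route-deterministic ((d , p , e) ∷ tr) r r′ = same (last-hop r) (last-hop r′)
    where
    same : LastHop _ d p e tr _ → LastHop _ d p e tr _ → _
    same record { from = u ; route = q ; port = x ; p≡ = a ; v≡ = b } record { from = u′ ; route = q′ ; port = y ; p≡ = a′ ; v≡ = b′ }
      with route-deterministic tr q q′
    ... | refl = trans b (trans (cong (nbr u) (F.toℕ-injective (trans (sym a) a′))) (sym b′))

  -- Each hop stores the port of entry, so from the end of a trace one can walk back.
  route-reversible : ∀ {u u′ v} tr → Route u tr v → Route u′ tr v → u ≡ u′
  route-reversible [] root root = refl
  route-reversible {v = v} ((d , p , e) ∷ tr) r r′ =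
    route-reversible tr (subst (Route _ tr) (before (last-hop r)) (LastHop.route (last-hop r)))
                        (subst (Route _ tr) (before (last-hop r′)) (LastHop.route (last-hop r′)))
    where
    before : ∀ {home} (l : LastHop home d p e tr v) → LastHop.from l ≡ moveTo G v e
    before record { from = u ; port = x ; e≡ = refl ; v≡ = refl } = sym (trans (moveTo-nbr G (nbr u x) (back u x)) (back-nbr u x))

  route-split : ∀ {home v} s x → Route home (s ++ x) v → ∃ λ u → Route home x u × Route u s v
  route-split [] x r = _ , r , root
  route-split (_ ∷ s) x (hop r p) = let u , q , q′ = route-split s x r in u , q , hop q′ p

  route-++ : ∀ {home u v} s x → Route home x u → Route u s v → Route home (s ++ x) v
  route-++ [] x r root = r
  route-++ (_ ∷ s) x r (hop q p) = hop (route-++ s x r q) p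

  walk-route : ∀ {u v} → Walk deg nbr u v → ∃ λ tr → Route u tr v
  walk-route w = extend [] root w
    where
    extend : ∀ {home u v} tr → Route home tr u → Walk deg nbr u v → ∃ λ tr′ → Route home tr′ v
    extend tr r here       = tr , r
    extend tr r (step p w) = extend _ (hop r p) w

  module Claims (own : Fin n) (place : ℕ → Fin n → Set) (unique : ∀ {b u v} → place b u → place b v → u ≡ v) where

    Truth : Fact → Set
    Truth (b , tr) = ∃ λ u → place b u × Route u tr own

    module _ {h b X Φ} (cert : Certificate h b X Φ) (sound : ∀ f → f ∈ Φ → Truth f) where
      open Certificate cert

      private
        entry : ∃ λ (x , s) → (x , s) ∈ X × x ≡ []
        entry = find origin

        home : Fin n
        home = proj₁ (sound _ (All.lookup facts (proj₁ (proj₂ entry))))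

        at-home : place b home
        at-home = proj₁ (proj₂ (sound _ (All.lookup facts (proj₁ (proj₂ entry)))))

        genuine : ∀ {tr} → (b , tr) ∈ Φ → Route home tr own
        genuine f∈ = let u , pu , r = sound _ f∈ in subst (λ z → Route z _ own) (unique pu at-home) r

        Reached : Fin n → Set
        Reached v = Any (λ (x , _) → Route home x v) X

        degree : ∀ {u x d} → Route home x u → Degree h b X Φ x d → d ≡ deg u
        degree {x = x} {d} r (0<d , covered) with covered 0<d
        ... | e , _ , edge with find edge
        ... | (y , t) , _ , f∈ with route-split t ((d , 0 , e) ∷ x) (genuine f∈)
        ... | v , rv , _ = trans (LastHop.d≡ l) (cong deg (route-deterministic x (LastHop.route l) r))
          where l = last-hop rv

        target : ∀ {u x d e v} p → Route home x u → Route home ((d , toℕ p , e) ∷ x) v → v ≡ nbr u p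
        target {u} {x} {d} {e} p r rv = arrive (last-hop rv)
          where
          arrive : ∀ {v} → LastHop home d (toℕ p) e x v → v ≡ nbr u p
          arrive record { from = u′ ; route = q ; port = y ; p≡ = a ; v≡ = c } with route-deterministic x q r
          ... | refl = trans c (cong (nbr u) (F.toℕ-injective (sym a)))

        reach-next : ∀ u p → Reached u → Reached (nbr u p)
        reach-next u p reached with find reached
        ... | (x , s) , x∈ , r with All.lookup edges x∈
        ... | d , _ , 0<d , covered with covered (subst (toℕ p <_) (sym (degree r (0<d , covered))) (F.toℕ<n p))
        ... | e , _ , edge with find edge
        ... | (y , t) , y∈ , f∈ with route-split t ((d , toℕ p , e) ∷ x) (genuine f∈) | route-split t y (genuine (All.lookup facts y∈))
        ... | v , rv , tv | v′ , ry , ty =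
          Any.map (λ { refl → subst (Route home y) (trans (route-reversible t ty tv) (target p r rv)) ry }) y∈

        reach-all : ∀ {u v} → Walk deg nbr u v → Reached u → Reached v
        reach-all here       r = r
        reach-all (step p w) r = reach-all w (reach-next _ p r)

        reached : ∀ v → Reached v
        reached v = reach-all (connected home v) (Any.map (λ { {_ , _} refl → root }) origin)

      -- Closure under neighbours and connectedness make every node the end of some entry's trace; a
      -- trace determines its end, so distinct nodes use distinct entries.
      certified : n ≤ h
      certified = ≤-trans (F.injective⇒≤ {f = λ v → Any.index (reached v)} inj) size
        where
        inj : ∀ {u v} → Any.index (reached u) ≡ Any.index (reached v) → u ≡ v
        inj {u} {v} e = route-deterministic _ (Any.lookup-index (reached u))
          (subst (λ i → Route home (proj₁ (lookup X i)) v) (sym e) (Any.lookup-index (reached v)))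

    knows-sound : ∀ {Φ h} → (∀ f → f ∈ Φ → Truth f) → Knows Φ h → n ≤ h
    knows-sound sound (c , _ , cert) = certified cert sound

    module _ {b other} (there-b : place b other) (other≢own : other ≢ own) (Allowed : ℕ → Set) (Φ : ℕ → List Fact)
             (learns : ∀ tr → Truth (b , tr) → Eventually (λ h → Allowed h → (b , tr) ∈ Φ h)) where

      private
        -- The home `other` is listed once more in front, with the empty trace that `origin`
        -- demands; repetitions in X do no harm.
        node : Fin (suc n) → Fin n
        node zero    = other
        node (suc v) = v

        out : ∀ i → ∃ λ x → Route other x (node i)
        out zero    = [] , root
        out (suc v) = walk-route (connected other v)

        home : ∀ i → ∃ λ s → Route (node i) s own
        home i = walk-route (connected (node i) own)

        x s : Fin (suc n) → Trace
        x i = proj₁ (out i)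
        s i = proj₁ (home i)

        entryOf : Fin (suc n) → Entry
        entryOf i = x i , s i

        X : List Entry
        X = tabulate entryOf

        node-fact : ∀ i → Truth (b , s i ++ x i)
        node-fact i = other , there-b , route-++ (s i) (x i) (proj₂ (out i)) (proj₂ (home i))

        edge-trace : ∀ i → Fin (deg (node i)) → Trace
        edge-trace i p = s (suc (nbr (node i) p)) ++ (deg (node i) , toℕ p , toℕ (back (node i) p)) ∷ x i

        edge-fact : ∀ i p → Truth (b , edge-trace i p)
        edge-fact i p = other , there-b ,
          route-++ (s (suc (nbr (node i) p))) _ (hop (proj₂ (out i)) p) (proj₂ (home (suc (nbr (node i) p))))

        first-port : ∀ {u v} → Walk deg nbr u v → u ≢ v → 0 < deg u
        first-port here       u≢v = contradiction refl u≢v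
        first-port (step p _) _   = ≤-<-trans z≤n (F.toℕ<n p)

        deg>0 : ∀ u → 0 < deg u
        deg>0 u with u F.≟ own
        ... | no u≢own = first-port (connected u own) u≢own
        ... | yes refl = first-port (connected u other) (λ e → other≢own (sym e))

        code : ∃ λ c → claim c ≡ (b , X)
        code = claim-onto (b , X)

      knows-complete : Eventually (λ h → Allowed h → Knows (Φ h) h)
      knows-complete = eventually-map assemble
        (eventually-× (eventually-∀ (λ i → learns _ (node-fact i)))
          (eventually-× (eventually-∀ (λ i → eventually-∀ (λ p → learns _ (edge-fact i p))))
            -- From here on h exceeds the n + 1 entries, all degrees and ports, and the code of the
            -- claim.
            (suc (suc n) ⊔ suc (proj₁ code) , λ h le → le)))
        where
        assemble : ∀ h → (∀ i → Allowed h → (b , s i ++ x i) ∈ Φ h) ×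
                         (∀ i p → Allowed h → (b , edge-trace i p) ∈ Φ h) × suc (suc n) ⊔ suc (proj₁ code) ≤ h →
                   Allowed h → Knows (Φ h) h
        assemble h (nodes , edges , le) al = proj₁ code , ≤-trans (m≤n⊔m (suc (suc n)) (suc (proj₁ code))) le ,
          subst (λ (b , X) → Certificate h b X (Φ h)) (sym (proj₂ code)) (certificate
            (≤-trans (≤-reflexive (length-tabulate entryOf)) (<⇒≤ n+1<h))
            (here refl)
            (All.tabulate⁺ {f = entryOf} (λ i → nodes i al))
            (All.tabulate⁺ {f = entryOf} (λ i → deg (node i) , small (<⇒≤ (deg<n G (node i))) , deg>0 (node i) , covered i)))
          where
          n+1<h : suc n < h
          n+1<h = ≤-trans (m≤m⊔n (suc (suc n)) (suc (proj₁ code))) le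
          small : ∀ {d} → d ≤ n → d < h
          small d≤n = ≤-<-trans d≤n (<-trans (n<1+n n) n+1<h)
          covered : ∀ i {c} → c < deg (node i) → ∃ λ e → e < h × Edge b X (Φ h) (x i) (deg (node i)) c e
          covered i {c} c<d =
            toℕ (back (node i) p) ,
            small (<⇒≤ (<-trans (F.toℕ<n (back (node i) p)) (deg<n G _))) ,
            Any.tabulate⁺ {f = entryOf} (suc (nbr (node i) p)) (subst (λ z → (b , s (suc (nbr (node i) p)) ++ (deg (node i) , z , toℕ (back (node i) p)) ∷ x i) ∈ Φ h)
              (F.toℕ-fromℕ< c<d) (edges i p al))
            where p = fromℕ< c<d

-- Sweeps and probes

-- In slot q agents leave only nodes of degree at most q, and go no further
-- than q hops from home.
Within : ℕ → Trace → ℕ → Set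
Within q tr d = d ≤ q × length tr < q

within? : ∀ q tr d → Dec (Within q tr d)
within? q tr d = (d ≤? q) ×-dec (length tr <? q)

Capped : ℕ → Cmd → Set
Capped q c = ∀ tr d p → c tr d ≡ fwd p → Within q tr d

stride : ℕ → ℕ → Cmd
stride q p tr d with within? q tr d
... | yes _ = fwd p
... | no _  = wait

stride-capped : ∀ q p → Capped q (stride q p)
stride-capped q p tr d p′ e with within? q tr d
... | yes ok = ok

words : ℕ → ℕ → List (List ℕ)
words zero    q = [] ∷ []
words (suc a) q = concatMap (λ p → map (p ∷_) (words a q)) (upTo q)

∈-words : ∀ {q} ps → All (_< q) ps → ps ∈ words (length ps) q
∈-words []       []         = here refl
∈-words {q} (p ∷ ps) (p<q ∷ al) =
  ∈-concatMap⁺ (λ p → map (p ∷_) (words (length ps) q)) (lose (∈-upTo⁺ p<q) (∈-map⁺ (p ∷_) (∈-words ps al)))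

outing : ℕ → List ℕ → List Cmd
outing q ps = tour (map (stride q) ps)

outings : ℕ → List (List ℕ) → List Cmd
outings q []         = []
outings q (ps ∷ pss) = outing q ps ++ outings q pss

-- Words of length q over the ports below q exhaust the walks that `Within` allows. The closing
-- `idle` makes every configuration of the outings occur at an index below the length.
sweep : ℕ → List Cmd
sweep q = outings q (words q q) ++ idle ∷ []

Advance : ℕ → Trace → ℕ → ℕ → Trace → ℕ → Set
Advance q tr₀ d₀ p tr d = tr ≡ tr₀ × d ≡ d₀ × p < d × Within q tr d

advance? : ∀ q tr₀ d₀ p tr d → Dec (Advance q tr₀ d₀ p tr d)
advance? q tr₀ d₀ p tr d = trace-≟ tr tr₀ ×-dec (d ≟ d₀) ×-dec (p <? d) ×-dec within? q tr d

-- Waiting after a deviation would look like the pause at the end of the trace, so the agent undoes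
-- a hop instead; `p < d` makes the forward command a real move.
advanceFrom : ℕ → Trace → ℕ → ℕ → Cmd
advanceFrom q tr₀ d₀ p tr d with advance? q tr₀ d₀ p tr d
... | yes _ = fwd p
... | no _  = undo

hold : Trace → Cmd
hold w tr d with trace-≟ tr w
... | yes _ = wait
... | no _  = undo

approach : ℕ → Trace → List Cmd
approach q []                = []
approach q ((d , p , e) ∷ tr) = approach q tr ++ advanceFrom q tr d p ∷ []

-- Walk along w, retreating as soon as the walk deviates from it, and stay
-- for one more phase at the end of w.
probe : ℕ → Trace → List Cmd
probe q w = tour (approach q w ++ hold w ∷ [])

length-approach : ∀ q w → length (approach q w) ≡ length w
length-approach q []                = refl
length-approach q ((d , p , e) ∷ w) = trans (length-++ (approach q w))
  (trans (+-comm _ 1) (cong suc (length-approach q w)))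

advanceFrom-capped : ∀ q tr₀ d₀ p → Capped q (advanceFrom q tr₀ d₀ p)
advanceFrom-capped q tr₀ d₀ p tr d p′ e with advance? q tr₀ d₀ p tr d
... | yes (_ , _ , _ , ok) = ok

hold-capped : ∀ q w → Capped q (hold w)
hold-capped q w tr d p e with trace-≟ tr w
hold-capped q w tr d p () | yes _
hold-capped q w tr d p () | no _

tour-all : ∀ {P : Cmd → Set} {cs} → P retreat → All P cs → All P (tour cs)
tour-all pr al = All.++⁺ al (All.replicate⁺ _ pr)

sweep-capped : ∀ q → All (Capped q) (sweep q)
sweep-capped q = All.++⁺ (each (words q q)) ((λ _ _ _ ()) ∷ [])
  where
  each : ∀ pss → All (Capped q) (outings q pss)
  each []         = []
  each (ps ∷ pss) = All.++⁺ (tour-all (λ _ _ _ ()) (All.map⁺ (All.universal (stride-capped q) ps))) (each pss)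

probe-capped : ∀ q w → All (Capped q) (probe q w)
probe-capped q w = tour-all (λ _ _ _ ()) (All.++⁺ (along w) (hold-capped q w ∷ []))
  where
  along : ∀ w → All (Capped q) (approach q w)
  along []                = []
  along ((d , p , e) ∷ w) = All.++⁺ (along w) (advanceFrom-capped q w d p ∷ [])

-- The only way to stay put away from home is to be at the end of w.
Restless : Trace → Cmd → Set
Restless w c = ∀ tr d → (∃ λ p → c tr d ≡ fwd p × p < d) ⊎ c tr d ≡ undo ⊎ tr ≡ w

probe-restless : ∀ q w → All (Restless w) (probe q w)
probe-restless q w = tour-all (λ _ _ → inj₂ (inj₁ refl)) (All.++⁺ (along w) (holding ∷ []))
  where
  advancing : ∀ tr₀ d₀ p → Restless w (advanceFrom q tr₀ d₀ p)
  advancing tr₀ d₀ p tr d with advance? q tr₀ d₀ p tr d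
  ... | yes (_ , _ , p<d , _) = inj₁ (p , refl , p<d)
  ... | no _                  = inj₂ (inj₁ refl)
  holding : Restless w (hold w)
  holding tr d with trace-≟ tr w
  ... | yes e = inj₂ (inj₂ e)
  ... | no _  = inj₂ (inj₁ refl)
  along : ∀ v → All (Restless w) (approach q v)
  along []                = []
  along ((d , p , e) ∷ v) = All.++⁺ (along v) (advancing v d p ∷ [])

Inside : ℕ → Trace → Set
Inside q tr = All (λ (d , _) → d ≤ q) tr × length tr ≤ q

drop-at : ∀ {A : Set} {P : A → Set} {cs} φ → φ < length cs → All P cs → ∃ λ c → ∃ λ ds → drop φ cs ≡ c ∷ ds × P c
drop-at zero    _       (p ∷ _)  = _ , _ , refl , p
drop-at (suc φ) (s≤s l) (_ ∷ ps) = drop-at φ l ps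

module SweepMotion {n : ℕ} (G : PortGraph n) where
  open PortGraph G
  open Motion G

  tour-home : ∀ cs u → conf (tour cs) (length (tour cs)) (u , []) ≡ (u , [])
  tour-home cs u = cong₂ _,_ (route-[] (subst (λ z → Route u z (proj₁ (conf (tour cs) (length (tour cs)) (u , [])))) returned (conf-route (tour cs) (length (tour cs)) {u , []} root))) returned
    where returned = tour-returns G cs u

  outings-home : ∀ q pss u → conf (outings q pss) (length (outings q pss)) (u , []) ≡ (u , [])
  outings-home q []         u = refl
  outings-home q (ps ∷ pss) u = begin
    conf (outing q ps ++ outings q pss) (length (outing q ps ++ outings q pss)) (u , [])
      ≡⟨ cong (λ z → conf (outing q ps ++ outings q pss) z (u , [])) (length-++ (outing q ps)) ⟩
    conf (outing q ps ++ outings q pss) (length (outing q ps) + length (outings q pss)) (u , [])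
      ≡⟨ conf-++ʳ (outing q ps) (outings q pss) (length (outings q pss)) (u , []) ⟩
    conf (outings q pss) (length (outings q pss)) (conf (outing q ps) (length (outing q ps)) (u , []))
      ≡⟨ cong (conf (outings q pss) (length (outings q pss))) (tour-home (map (stride q) ps) u) ⟩
    conf (outings q pss) (length (outings q pss)) (u , [])
      ≡⟨ outings-home q pss u ⟩
    (u , []) ∎
    where open ≡-Reasoning

  sweep-returns : ∀ q u → proj₂ (conf (sweep q) (length (sweep q)) (u , [])) ≡ []
  sweep-returns q u = begin
    proj₂ (conf (sweep q) (length (sweep q)) (u , []))
      ≡⟨ cong (λ z → proj₂ (conf (sweep q) z (u , []))) (length-++ (outings q (words q q))) ⟩
    proj₂ (conf (sweep q) (length (outings q (words q q)) + 1) (u , []))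
      ≡⟨ cong proj₂ (conf-++ʳ (outings q (words q q)) (idle ∷ []) 1 (u , [])) ⟩
    proj₂ (conf (outings q (words q q)) (length (outings q (words q q))) (u , []))
      ≡⟨ cong proj₂ (outings-home q (words q q) u) ⟩
    [] ∎
    where open ≡-Reasoning

  probe-returns : ∀ q w u → proj₂ (conf (probe q w) (length (probe q w)) (u , [])) ≡ []
  probe-returns q w u = tour-returns G (approach q w ++ hold w ∷ []) u

  exec-inside : ∀ {q} u tr d → (∀ p → d ≡ fwd p → Within q tr (deg u)) → Inside q tr → Inside q (proj₂ (exec (u , tr) d))
  exec-inside u tr wait cap ins = ins
  exec-inside u tr (fwd p) cap (al , len) with p <? deg u
  ... | yes _ = (proj₁ (cap p refl) ∷ al) , proj₂ (cap p refl)
  ... | no _  = al , len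
  exec-inside u []       undo cap ins = ins
  exec-inside u (_ ∷ tr) undo cap (_ ∷ al , len) = al , <⇒≤ len

  conf-inside : ∀ {q} cs φ x → All (Capped q) cs → Inside q (proj₂ x) → Inside q (proj₂ (conf cs φ x))
  conf-inside cs       zero    x        al       ins = ins
  conf-inside []       (suc φ) x        al       ins = ins
  conf-inside (c ∷ cs) (suc φ) (u , tr) (a ∷ al) ins =
    conf-inside cs φ (perform c (u , tr)) al (exec-inside u tr (c tr (deg u)) (λ p e → a tr (deg u) p e) ins)

  moveTo-leaves : ∀ u p → p < deg u → moveTo G u p ≢ u
  moveTo-leaves u p p<d e with p <? deg u
  ... | yes q = no-loop u (fromℕ< q) e
  ... | no ¬q = contradiction p<d ¬q

  exec-fwd-leaves : ∀ u tr p → p < deg u → proj₁ (exec (u , tr) (fwd p)) ≢ u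
  exec-fwd-leaves u tr p p<d e with p <? deg u
  ... | yes q = no-loop u (fromℕ< q) e
  ... | no ¬q = contradiction p<d ¬q

  exec-undo-leaves : ∀ {home} u tr → Route home tr u → u ≢ home → proj₁ (exec (u , tr) undo) ≢ u
  exec-undo-leaves u .[] root u≢ e = u≢ refl
  exec-undo-leaves ._ ._ (hop {u = v} r p) u≢ e = moveTo-leaves (nbr v p) (toℕ (back v p)) (F.toℕ<n (back v p)) e

  -- The graph has no loops, so every real move changes the node, and `probe-restless` leaves the
  -- end of w as the only place to pause.
  probe-stays : ∀ q w {home} φ → φ < length (probe q w) → let x = conf (probe q w) φ (home , []) in
                proj₁ x ≢ home → proj₁ (conf (probe q w) (suc φ) (home , [])) ≡ proj₁ x → Route home w (proj₁ x)
  probe-stays q w {home} φ φ< away same with drop-at φ φ< (probe-restless q w)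
  ... | c , ds , eq , restless = conclude (restless (proj₂ x) (deg (proj₁ x)))
    where
    x = conf (probe q w) φ (home , [])
    r : Route home (proj₂ x) (proj₁ x)
    r = conf-route (probe q w) φ {home , []} root
    same′ : proj₁ (perform c x) ≡ proj₁ x
    same′ = trans (cong proj₁ (sym (conf-suc (probe q w) φ (home , []) c eq))) same
    conclude : (∃ λ p → c (proj₂ x) (deg (proj₁ x)) ≡ fwd p × p < deg (proj₁ x)) ⊎
               c (proj₂ x) (deg (proj₁ x)) ≡ undo ⊎ proj₂ x ≡ w → Route home w (proj₁ x)
    conclude (inj₁ (p , e , p<d)) = contradiction (trans (cong (λ z → proj₁ (exec x z)) (sym e)) same′) (exec-fwd-leaves _ _ p p<d)
    conclude (inj₂ (inj₁ e)) = contradiction (trans (cong (λ z → proj₁ (exec x z)) (sym e)) same′) (exec-undo-leaves _ _ r away)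
    conclude (inj₂ (inj₂ e)) = subst (λ z → Route home z (proj₁ x)) e r

  exec-fwd : ∀ u tr (p : Fin (deg u)) → exec (u , tr) (fwd (toℕ p)) ≡ (nbr u p , (deg u , toℕ p , toℕ (back u p)) ∷ tr)
  exec-fwd u tr p with toℕ p <? deg u
  ... | yes q = cong (λ z → nbr u z , (deg u , toℕ p , toℕ (back u z)) ∷ tr) (F.fromℕ<-toℕ p q)
  ... | no ¬q = contradiction (F.toℕ<n p) ¬q

  approach-reaches : ∀ q {home w v} → Route home w v → Inside q w → conf (approach q w) (length w) (home , []) ≡ (v , w)
  approach-reaches q root ins = refl
  approach-reaches q {home} (hop {tr} {u} r p) (d≤q ∷ al , len) = begin
    conf (approach q tr ++ c ∷ []) (suc (length tr)) (home , [])
      ≡⟨ cong (λ z → conf (approach q tr ++ c ∷ []) z (home , [])) (trans (cong suc (sym (length-approach q tr))) (+-comm 1 _)) ⟩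
    conf (approach q tr ++ c ∷ []) (length (approach q tr) + 1) (home , [])
      ≡⟨ conf-++ʳ (approach q tr) (c ∷ []) 1 (home , []) ⟩
    perform c (conf (approach q tr) (length (approach q tr)) (home , []))
      ≡⟨ cong (perform c) (trans (cong (λ z → conf (approach q tr) z (home , [])) (length-approach q tr)) (approach-reaches q r (al , <⇒≤ len))) ⟩
    perform c (u , tr)
      ≡⟨ cong (exec (u , tr)) chosen ⟩
    exec (u , tr) (fwd (toℕ p))
      ≡⟨ exec-fwd u tr p ⟩
    (nbr u p , (deg u , toℕ p , toℕ (back u p)) ∷ tr) ∎
    where
    open ≡-Reasoning
    c = advanceFrom q tr (deg u) (toℕ p)
    chosen : c tr (deg u) ≡ fwd (toℕ p)
    chosen with advance? q tr (deg u) (toℕ p) tr (deg u)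
    ... | yes _ = refl
    ... | no ¬a = contradiction (refl , refl , F.toℕ<n p , d≤q , len) ¬a

  module _ (q : ℕ) {home v : Fin n} {w : Trace} (r : Route home w v) (ins : Inside q w) where
    private
      cs = approach q w ++ hold w ∷ []

      length-cs : length cs ≡ suc (length w)
      length-cs = trans (length-++ (approach q w)) (trans (+-comm _ 1) (cong suc (length-approach q w)))

    probe-length : suc (length w) < length (probe q w)
    probe-length = subst (suc (length w) <_) (sym (trans (length-tour cs) (cong₂ _+_ length-cs length-cs))) (m<m+n (suc (length w)) (s≤s z≤n))

    probe-arrives : conf (probe q w) (length w) (home , []) ≡ (v , w)
    probe-arrives = trans (conf-++ˡ cs _ (length w) (home , []) (subst (length w ≤_) (sym length-cs) (n≤1+n _)))
      (trans (conf-++ˡ (approach q w) _ (length w) (home , []) (≤-reflexive (sym (length-approach q w))))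
             (approach-reaches q r ins))

    probe-holds : conf (probe q w) (suc (length w)) (home , []) ≡ (v , w)
    probe-holds = begin
      conf (probe q w) (suc (length w)) (home , []) ≡⟨ conf-++ˡ cs _ (suc (length w)) (home , []) (≤-reflexive (sym length-cs)) ⟩
      conf cs (suc (length w)) (home , []) ≡⟨ cong (λ z → conf cs z (home , [])) (trans (cong suc (sym (length-approach q w))) (+-comm 1 _)) ⟩
      conf cs (length (approach q w) + 1) (home , []) ≡⟨ conf-++ʳ (approach q w) (hold w ∷ []) 1 (home , []) ⟩
      perform (hold w) (conf (approach q w) (length (approach q w)) (home , []))
        ≡⟨ cong (perform (hold w)) (trans (cong (λ z → conf (approach q w) z (home , [])) (length-approach q w)) (approach-reaches q r ins)) ⟩
      perform (hold w) (v , w) ≡⟨ cong (exec (v , w)) holding ⟩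
      (v , w) ∎
      where
      open ≡-Reasoning
      holding : hold w w (deg v) ≡ wait
      holding with trace-≟ w w
      ... | yes _ = refl
      ... | no ¬e = contradiction refl ¬e

  Low : ℕ → ∀ {u v} → Walk deg nbr u v → Set
  Low q here           = ⊤
  Low q (step {u} p w) = deg u ≤ q × Low q w

  portsOf : ∀ {u v} → Walk deg nbr u v → List ℕ
  portsOf here       = []
  portsOf (step p w) = toℕ p ∷ portsOf w

  length-portsOf : ∀ {u v} (w : Walk deg nbr u v) → length (portsOf w) ≡ walkLength G w
  length-portsOf here       = refl
  length-portsOf (step p w) = cong suc (length-portsOf w)

  ports-low : ∀ q {u v} (w : Walk deg nbr u v) → Low q w → All (_< q) (portsOf w)
  ports-low q here       _           = []
  ports-low q (step p w) (d≤q , low) = <-≤-trans (F.toℕ<n p) d≤q ∷ ports-low q w low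

  strides : ∀ q {u v} (w : Walk deg nbr u v) pad tr → Low q w → length tr + walkLength G w ≤ q →
            proj₁ (conf (map (stride q) (portsOf w ++ pad)) (walkLength G w) (u , tr)) ≡ v
  strides q here       pad tr low len = refl
  strides q {v = v} (step {u} p w) pad tr (d≤q , low) len = begin
    proj₁ (conf cs (walkLength G w) (perform (stride q (toℕ p)) (u , tr)))
      ≡⟨ cong (λ z → proj₁ (conf cs (walkLength G w) (exec (u , tr) z))) chosen ⟩
    proj₁ (conf cs (walkLength G w) (exec (u , tr) (fwd (toℕ p))))
      ≡⟨ cong (λ z → proj₁ (conf cs (walkLength G w) z)) (exec-fwd u tr p) ⟩
    proj₁ (conf cs (walkLength G w) (nbr u p , (deg u , toℕ p , toℕ (back u p)) ∷ tr))
      ≡⟨ strides q w pad _ low (≤-trans (≤-reflexive (sym (+-suc (length tr) _))) len) ⟩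
    v ∎
    where
    open ≡-Reasoning
    cs = map (stride q) (portsOf w ++ pad)
    short : length tr < q
    short = ≤-trans (s≤s (m≤m+n (length tr) (walkLength G w))) (≤-trans (≤-reflexive (sym (+-suc (length tr) _))) len)
    chosen : stride q (toℕ p) tr (deg u) ≡ fwd (toℕ p)
    chosen with within? q tr (deg u)
    ... | yes _ = refl
    ... | no ¬w = contradiction (d≤q , short) ¬w

  outings-visit : ∀ q pss ps u j → ps ∈ pss → j ≤ length (outing q ps) →
                  ∃ λ φ → φ ≤ length (outings q pss) × conf (outings q pss) φ (u , []) ≡ conf (outing q ps) j (u , [])
  outings-visit q (ps ∷ pss) .ps u j (here refl) j≤ =
    j , ≤-trans j≤ (≤-trans (m≤m+n _ _) (≤-reflexive (sym (length-++ (outing q ps))))) , conf-++ˡ (outing q ps) _ j (u , []) j≤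
  outings-visit q (ps′ ∷ pss) ps u j (there ps∈) j≤ =
    let φ , φ≤ , e = outings-visit q pss ps u j ps∈ j≤ in
    length (outing q ps′) + φ , ≤-trans (+-monoʳ-≤ (length (outing q ps′)) φ≤) (≤-reflexive (sym (length-++ (outing q ps′)))) ,
    trans (conf-++ʳ (outing q ps′) (outings q pss) φ (u , []))
          (trans (cong (conf (outings q pss) φ) (tour-home (map (stride q) ps′) u)) e)

  sweep-visits : ∀ q {u v} (w : Walk deg nbr u v) → Low q w → walkLength G w ≤ q →
                 ∃ λ φ → φ < length (sweep q) × proj₁ (conf (sweep q) φ (u , [])) ≡ v
  sweep-visits q {u} {v} w low len = let φ , φ≤ , e = outings-visit q (words q q) ps u (walkLength G w) ps∈ j≤ in
    φ , ≤-<-trans φ≤ (subst (length (outings q (words q q)) <_) (sym (length-++ (outings q (words q q)))) (m<m+n _ (s≤s z≤n))) ,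
    trans (cong proj₁ (conf-++ˡ (outings q (words q q)) _ φ (u , []) φ≤))
      (trans (cong proj₁ e) (trans (cong proj₁ (conf-++ˡ (map (stride q) ps) _ (walkLength G w) (u , []) j≤′))
        (strides q w pad [] low len)))
    where
    -- Words have length exactly q; what follows the walk comes after the visit.
    pad = replicate (q ∸ walkLength G w) 0
    ps = portsOf w ++ pad
    length-ps : length ps ≡ q
    length-ps = trans (length-++ (portsOf w)) (trans (cong₂ _+_ (length-portsOf w) (length-replicate (q ∸ walkLength G w))) (m+[n∸m]≡n len))
    pad-low : ∀ a → 0 < a → a ≤ q → All (_< q) (replicate a 0)
    pad-low a 0<a a≤q = All.replicate⁺ a (<-≤-trans 0<a a≤q)
    pads : ∀ a → a ≤ q → All (_< q) (replicate a 0)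
    pads zero    _ = []
    pads (suc a) l = pad-low (suc a) (s≤s z≤n) l
    ps∈ : ps ∈ words q q
    ps∈ = subst (λ z → ps ∈ words z q) length-ps (∈-words ps (All.++⁺ (ports-low q w low) (pads _ (m∸n≤m q (walkLength G w)))))
    j≤′ : walkLength G w ≤ length (map (stride q) ps)
    j≤′ = subst (walkLength G w ≤_) (sym (trans (length-map (stride q) ps) length-ps)) len
    j≤ : walkLength G w ≤ length (outing q ps)
    j≤ = ≤-trans j≤′ (≤-trans (m≤m+n _ _) (≤-reflexive (sym (length-++ (map (stride q) ps)))))

  sweep-explores : ∀ q → n ≤ q → ∀ u v → ∃ λ φ → φ < length (sweep q) × proj₁ (conf (sweep q) φ (u , [])) ≡ v
  sweep-explores q n≤q u v = let w , l≤n = short-walk G u v in sweep-visits q w (low w) (≤-trans l≤n n≤q)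
    where
    low : ∀ {u v} (w : Walk deg nbr u v) → Low q w
    low here           = tt
    low (step {u} p w) = ≤-trans (<⇒≤ (deg<n G u)) n≤q , low w

  stepTo : ∀ {u x v} (p : Fin (deg u)) → nbr u p ≡ x → Walk deg nbr x v → Walk deg nbr u v
  stepTo p refl w = step p w

  -- Being able to walk from home to v within bounds is symmetric.
  route-back : ∀ q {home tr v} → Route home tr v → Inside q tr → deg v ≤ q →
               Σ (Walk deg nbr v home) λ w → Low q w × walkLength G w ≤ q
  route-back q r (al , len) dv = let w , low , e = reverse r al dv in w , low , subst (_≤ q) (sym e) len
    where
    reverse : ∀ {home tr v} → Route home tr v → All (λ (d , _) → d ≤ q) tr → deg v ≤ q →
              Σ (Walk deg nbr v home) λ w → Low q w × walkLength G w ≡ length tr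
    reverse root al dv = here , tt , refl
    reverse (hop {u = u} r p) (d ∷ al) dv = let w , low , e = reverse r al d in
      stepTo (back u p) (back-nbr u p) w , lift (back-nbr u p) w dv low , trans (stepTo-length (back-nbr u p) w) (cong suc e)
      where
      lift : ∀ {u x v} {p : Fin (deg u)} (e : nbr u p ≡ x) (w : Walk deg nbr x v) → deg u ≤ q → Low q w → Low q (stepTo p e w)
      lift refl w d low = d , low
      stepTo-length : ∀ {u x v} {p : Fin (deg u)} (e : nbr u p ≡ x) (w : Walk deg nbr x v) → walkLength G (stepTo p e w) ≡ suc (walkLength G w)
      stepTo-length refl w = refl

-- Detecting a probe

-- Two adjacent intervals that together are shorter than the period contain at most one multiple of
-- it.
quotient-jump : ∀ y x₁ x₃ p → x₁ + x₃ < suc p →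
                y / suc p ≡ (y + x₁) / suc p ⊎ (y + x₁ + x₃) / suc p ≡ (y + x₁) / suc p
quotient-jump y x₁ x₃ p lt with m≤n⇒m<n∨m≡n (/-monoˡ-≤ (suc p) (m≤m+n y x₁))
... | inj₂ e = inj₁ e
... | inj₁ l = inj₂ (≤-antisym (≤-trans bound l) (/-monoˡ-≤ (suc p) (m≤m+n (y + x₁) x₃)))
  where
  open ≤-Reasoning
  bound : (y + x₁ + x₃) / suc p ≤ suc (y / suc p)
  bound = begin
    (y + x₁ + x₃) / suc p ≤⟨ /-monoˡ-≤ (suc p) (≤-trans (≤-reflexive (+-assoc y x₁ x₃)) (+-monoʳ-≤ y (<⇒≤ lt))) ⟩
    (y + suc p) / suc p ≡⟨ m/n≡1+[m∸n]/n (m≤n+m (suc p) y) ⟩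
    suc ((y + suc p ∸ suc p) / suc p) ≡⟨ cong (λ z → suc (z / suc p)) (m+n∸n≡m y (suc p)) ⟩
    suc (y / suc p) ∎

module Detecting (Π : Protocol) {n k : ℕ} (G : PortGraph n) (start : Fin k → Fin n)
                 (start-inj : Injective start) (label : Fin k → ℕ) (msg : Fin k → Message)
                 (wake : Fin k → Maybe ℕ)
                 (slow-guard : ∀ q → Protocol.guard Π q ≡ Controller.begins Π q)
                 (slow-pace : ∀ q → Protocol.pace Π q ≡ Controller.begins Π q)
                 (capped : ∀ q → All (Capped q) (Protocol.main Π q)) where
  open Protocol Π
  open Controller Π
  open PortGraph G
  open Motion G
  open SweepMotion G
  open World Π G start start-inj label msg wake

  Awake : Fin k → Set
  Awake z = ∃ λ w → Woken z w

  module At (z : Fin k) (Wz : Awake z) = Agent z (proj₁ Wz) (proj₂ Wz)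

  touring : ∀ z t → place z t ≢ start z → Σ (Awake z) λ Wz → At.Touring z Wz t
  touring z t away with sleeping-or-woken z t
  ... | inj₁ asleep       = contradiction (cong (position z) (asleep t ≤-refl)) away
  ... | inj₂ (w , _ , Wz) = (w , Wz) , Agent.away z w Wz t away

  T≤begins : ∀ {q r} → q < r → T q ≤ begins r
  T≤begins {q} q<r = ≤-trans (m≤n+m (T q) (begins q)) (begins-mono q<r)

  -- An agent in a later slot moves at most once during a slot.
  settled : ∀ z (Wz : Awake z) t (tz : At.Touring z Wz t) x₁ x₃ t₁ → t ≡ x₁ + t₁ →
            x₁ + x₃ ≤ begins (At.Touring.q tz) → place z t₁ ≡ place z t ⊎ place z (x₃ + t) ≡ place z t
  settled z Wz t tz x₁ x₃ t₁ t≡ le = conclude (quotient-jump y x₁ x₃ (pace r) (subst (x₁ + x₃ <_) (cong suc (sym (slow-pace r))) (s≤s le)))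
    where
    open At.Touring z Wz tz renaming (q to r)
    module Z = At z Wz
    s = Z.slotTime r
    D2 = D r + D r
    x₁<W : x₁ < W r
    x₁<W = subst (x₁ <_) (cong suc (sym (slow-pace r))) (s≤s (≤-trans (m≤m+n x₁ x₃) le))
    x₃<D : x₃ < D r
    x₃<D = subst (x₃ <_) (cong suc (sym (slow-guard r))) (s≤s (≤-trans (m≤n+m x₃ x₁) le))
    enough : D2 + x₁ ≤ θ
    enough = ≤-trans (+-monoʳ-≤ D2 (<⇒≤ x₁<W)) after
    y = θ ∸ (D2 + x₁)
    θ≡ : θ ≡ D2 + (y + x₁)
    θ≡ = trans (sym (m∸n+n≡m enough)) (rot y D2 x₁)
      where
      rot : ∀ a b c → a + (b + c) ≡ b + (a + c)
      rot = solve-∀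
    t₁≡ : t₁ ≡ (D2 + y) + s
    t₁≡ = +-cancelˡ-≡ x₁ t₁ ((D2 + y) + s) (trans (sym t≡) (trans time (trans (cong (_+ s) θ≡) (rot D2 y x₁ s))))
      where
      rot : ∀ a b c d → a + (b + c) + d ≡ c + (a + b + d)
      rot = solve-∀
    t₃≡ : x₃ + t ≡ (D2 + (y + x₁ + x₃)) + s
    t₃≡ = trans (cong (x₃ +_) (trans time (cong (_+ s) θ≡))) (rot x₃ D2 (y + x₁) s)
      where
      rot : ∀ a b c d → a + (b + c + d) ≡ b + (c + a) + d
      rot = solve-∀
    at : ∀ x → D2 + x < T r → place z ((D2 + x) + s) ≡ proj₁ (conf (commands r (Z.memory r)) (x / W r) (home z))
    at x lt = trans (Z.place-in-slot r alive (D2 + x) lt)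
                    (cong (λ i → proj₁ (conf (commands r (Z.memory r)) (i / W r) (home z))) (m+n∸m≡n D2 x))
    limit₂ : D2 + (y + x₁) < T r
    limit₂ = subst (_< T r) θ≡ θ<T
    limit₁ : D2 + y < T r
    limit₁ = ≤-<-trans (+-monoʳ-≤ D2 (m≤m+n y x₁)) limit₂
    limit₃ : D2 + (y + x₁ + x₃) < T r
    limit₃ = subst₂ _<_ (+-assoc D2 (y + x₁) x₃) (+-assoc D2 (m r * W r) (D r)) (+-mono-< (subst (_< D2 + m r * W r) θ≡ before) x₃<D)
    now : place z t ≡ proj₁ (conf (commands r (Z.memory r)) ((y + x₁) / W r) (home z))
    now = trans (cong (place z) (trans time (cong (_+ s) θ≡))) (at (y + x₁) limit₂)
    conclude : y / W r ≡ (y + x₁) / W r ⊎ (y + x₁ + x₃) / W r ≡ (y + x₁) / W r →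
               place z t₁ ≡ place z t ⊎ place z (x₃ + t) ≡ place z t
    conclude (inj₁ e) = inj₁ (trans (trans (cong (place z) t₁≡) (at y limit₁))
      (trans (cong (λ i → proj₁ (conf (commands r (Z.memory r)) i (home z))) e) (sym now)))
    conclude (inj₂ e) = inj₂ (trans (trans (cong (place z) t₃≡) (at (y + x₁ + x₃) limit₃))
      (trans (cong (λ i → proj₁ (conf (commands r (Z.memory r)) i (home z))) e) (sym now)))

  module Listener (a : Fin k) (Wa : Awake a) (r₀ : ℕ) (sweeps : main r₀ ≡ sweep r₀) where
    module A = At a Wa

    q : ℕ
    q = suc r₀

    t : ℕ → ℕ
    t θ = θ + A.slotTime q

    module _ (alive : A.Alive (suc q)) (swept : moves r₀ (A.memory r₀) ≡ true)
             (low : deg (start a) ≤ r₀) (listens : moves q (A.memory q) ≡ false)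
             (first : sight a (t (D q)) < 2) (last : sight a (t (pred (T q))) < 2) where

      at-home : ∀ θ → θ < T q → place a (t θ) ≡ start a
      at-home θ θ<T = trans (A.place-in-slot q alive θ θ<T)
        (trans (cong (λ b → proj₁ (conf (if b then main q else Data.List.replicate (m q) idle) (index q θ) (home a))) listens)
               (cong proj₁ (conf-idle (m q) (index q θ) (home a))))

      module Seen (θ : ℕ) (D≤θ : D q ≤ θ) (θ<T : θ < T q) (z : Fin k) (z≢a : z ≢ a)
                  (arrived : place z (t θ) ≡ start a) (Wz : Awake z) (tz : At.Touring z Wz (t θ)) where
        private
          module Z = At z Wz
          r = At.Touring.q tz

        -- The only possible move of such a visitor falls on one side of θ. It would therefore also
        -- be present at `D q` or in the last round, both of which are quiet.
        not-later : ¬ (q < r)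
        not-later q<r = refute (settled z Wz (t θ) tz x₁ x₃ (t (D q)) t≡ le)
          where
          x₁ = θ ∸ D q
          x₃ = pred (T q) ∸ θ
          t≡ : t θ ≡ x₁ + t (D q)
          t≡ = trans (cong (_+ A.slotTime q) (sym (m∸n+n≡m D≤θ))) (+-assoc x₁ (D q) _)
          θ≤ : θ ≤ pred (T q)
          θ≤ = ≤-pred θ<T
          t₃≡ : x₃ + t θ ≡ t (pred (T q))
          t₃≡ = trans (sym (+-assoc x₃ θ _)) (cong (_+ A.slotTime q) (m∸n+n≡m θ≤))
          le : x₁ + x₃ ≤ begins r
          le = ≤-trans (+-monoˡ-≤ x₃ (m∸n≤m θ (D q))) (≤-trans (≤-reflexive (m+[n∸m]≡n θ≤)) (≤-trans (pred[n]≤n {T q}) (T≤begins q<r)))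
          refute : ¬ (place z (t (D q)) ≡ place z (t θ) ⊎ place z (x₃ + t θ) ≡ place z (t θ))
          refute (inj₁ e) = <⇒≱ first (meeting (t (D q)) z≢a (trans e (trans arrived (sym (at-home (D q) (D<T q))))))
          refute (inj₂ e) = <⇒≱ last (meeting (t (pred (T q))) z≢a
            (trans (cong (place z) (sym t₃≡)) (trans e (trans arrived (sym (at-home (pred (T q)) (≤-reflexive refl)))))))

        -- The sweep preceding the slot has woken every agent that could come
        -- in an earlier slot, so these agents have reached the slot by now.
        not-earlier : ¬ (r < q)
        not-earlier r<q = contradiction (begin-strict
            At.Touring.θ tz + (begins r + w) <⟨ +-monoˡ-< _ (At.Touring.θ<T tz) ⟩
            T r + (begins r + w) ≡⟨ rot (T r) (begins r) w ⟩
            begins (suc r) + w ≤⟨ +-mono-≤ (begins-mono r<q) early ⟩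
            begins q + A.slotTime q ≤⟨ +-monoˡ-≤ (A.slotTime q) (≤-trans (n≤1+n _) (≤-reflexive (cong suc (sym (slow-guard q))))) ⟩
            D q + A.slotTime q ≤⟨ +-monoˡ-≤ (A.slotTime q) D≤θ ⟩
            t θ ≡⟨ At.Touring.time tz ⟩
            At.Touring.θ tz + (begins r + w) ∎) (<-irrefl refl)
          where
          open ≤-Reasoning hiding (start)
          w = proj₁ Wz
          rot : ∀ x y z → x + (y + z) ≡ y + x + z
          rot = solve-∀
          x = conf (main r) (index r (At.Touring.θ tz)) (home z)
          route : Route (start z) (proj₂ x) (start a)
          route = subst (Route (start z) (proj₂ x)) (trans (sym (At.Touring.seat tz)) arrived)
                    (conf-route (main r) (index r (At.Touring.θ tz)) {home z} root)
          inside : Inside r₀ (proj₂ x)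
          inside = let al , len = conf-inside (main r) (index r (At.Touring.θ tz)) (home z) (capped r) ([] , z≤n) in
                   All.map (λ d≤r → ≤-trans d≤r (≤-pred r<q)) al , ≤-trans len (≤-pred r<q)
          visit : ∃ λ φ → φ < m r₀ × proj₁ (conf (main r₀) φ (home a)) ≡ start z
          visit = let w , lw , len = route-back r₀ route inside low in
                  subst (λ cs → ∃ λ φ → φ < length cs × proj₁ (conf cs φ (home a)) ≡ start z) (sym sweeps) (sweep-visits r₀ w lw len)
          early : w ≤ A.slotTime q
          early = let φ , φ<m , e = visit
                      w′ , le , W′ = arouses (proj₂ Wa) r₀ (λ q′ l → alive q′ (m<n⇒m<1+n l)) swept φ φ<m z e
                  in ≤-trans (≤-reflexive (woken-unique (proj₂ Wz) W′)) (≤-trans le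
                     (≤-trans (+-monoˡ-≤ (A.slotTime r₀) (<⇒≤ (tour-time<T r₀ φ φ<m))) (≤-reflexive (rot (T r₀) (begins r₀) (proj₁ Wa)))))

        same-slot′ : r ≡ q
        same-slot′ with <-cmp r q
        ... | tri< l _ _ = contradiction l not-earlier
        ... | tri≈ _ e _ = e
        ... | tri> _ _ g = contradiction g not-later

      record Sighting (θ : ℕ) : Set where
        field
          z     : Fin k
          z≢a   : z ≢ a
          Wz    : Awake z
          moved : moves q (At.memory z Wz q) ≡ true
          arrived  : place z (t θ) ≡ start a
          θz    : ℕ
          time  : t θ ≡ θz + At.slotTime z Wz q
          seat  : place z (t θ) ≡ proj₁ (conf (main q) (index q θz) (home z))
          after : D q + D q ≤ θz
          before : θz < D q + D q + m q * W q

      sighting : ∀ θ → D q ≤ θ → θ < T q → 2 ≤ sight a (t θ) → Sighting θ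
      sighting θ D≤θ θ<T two with company (t θ) a two
      ... | z , z≢a , e with touring z (t θ) (λ e′ → z≢a (start-inj z a (trans (sym e′) (trans e (at-home θ θ<T)))))
      ... | Wz , tz = build (At.Touring.q tz) refl (Seen.same-slot′ θ D≤θ θ<T z z≢a arrived Wz tz)
        where
        arrived = trans e (at-home θ θ<T)
        build : ∀ r → At.Touring.q tz ≡ r → r ≡ q → Sighting θ
        build _ refl e = record
          { z = z ; z≢a = z≢a ; Wz = Wz ; arrived = arrived
          ; moved  = subst (λ r → moves r (At.memory z Wz r) ≡ true) e (At.Touring.moving tz)
          ; θz     = At.Touring.θ tz
          ; time   = subst (λ r → t θ ≡ At.Touring.θ tz + At.slotTime z Wz r) e (At.Touring.time tz)
          ; seat   = subst (λ r → place z (t θ) ≡ proj₁ (conf (main r) (index r (At.Touring.θ tz)) (home z))) e (At.Touring.seat tz)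
          ; after  = subst (λ r → D r + D r ≤ At.Touring.θ tz) e (≤-trans (m≤m+n _ _) (At.Touring.after tz))
          ; before = subst (λ r → At.Touring.θ tz < D r + D r + m r * W r) e (At.Touring.before tz) }

      -- Both sightings are of an agent in slot q, hence of the sole mover. They lie one phase
      -- apart, so its numbers of performed commands are consecutive, and `probe-stays` applies.
      detects : ∀ tr → main q ≡ probe q tr →
                (∀ z (Wz : Awake z) z′ (Wz′ : Awake z′) → moves q (At.memory z Wz q) ≡ true → moves q (At.memory z′ Wz′ q) ≡ true → z ≡ z′) →
                ∀ θ → D q ≤ θ → W q + θ < T q → 2 ≤ sight a (t θ) → 2 ≤ sight a (t (W q + θ)) →
                ∃ λ z → Σ (Awake z) λ Wz → moves q (At.memory z Wz q) ≡ true × Route (start z) tr (start a)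
      detects tr probes sole θ D≤θ θ<T two two′ =
        conclude (sighting θ D≤θ (≤-<-trans (m≤n+m θ (W q)) θ<T) two)
                 (sighting (W q + θ) (≤-trans D≤θ (m≤n+m θ (W q))) θ<T two′)
        where
        conclude : Sighting θ → Sighting (W q + θ) →
                   ∃ λ z → Σ (Awake z) λ Wz → moves q (At.memory z Wz q) ≡ true × Route (start z) tr (start a)
        conclude s s′ = Sighting.z s , Sighting.Wz s , Sighting.moved s ,
            found (sole (Sighting.z s) (Sighting.Wz s) (Sighting.z s′) (Sighting.Wz s′) (Sighting.moved s) (Sighting.moved s′))
          where
          open Sighting s
          φ = index q θz
          found : z ≡ Sighting.z s′ → Route (start z) tr (start a)
          found refl = subst (Route (start z) tr) at-φ
              (probe-stays q tr φ (subst (λ cs → φ < length cs) probes φ<m)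
                 (λ e → z≢a (start-inj z a (trans (sym e) at-φ)))
                 (trans at-φ+1 (sym at-φ)))
            where
            w≡ : proj₁ Wz ≡ proj₁ (Sighting.Wz s′)
            w≡ = woken-unique (proj₂ Wz) (proj₂ (Sighting.Wz s′))
            later : Sighting.θz s′ ≡ W q + θz
            later = +-cancelʳ-≡ (begins q + proj₁ Wz) (Sighting.θz s′) (W q + θz)
              (trans (cong (λ w → Sighting.θz s′ + (begins q + w)) w≡)
                (trans (sym (Sighting.time s′)) (trans (+-assoc (W q) θ _) (trans (cong (W q +_) time) (sym (+-assoc (W q) θz _))))))
            index-next : index q (W q + θz) ≡ suc φ
            index-next = trans (cong (_/ W q) (+-∸-assoc (W q) after))
              (trans (m/n≡1+[m∸n]/n (m≤m+n (W q) (θz ∸ (D q + D q))))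
                     (cong (λ x → suc (x / W q)) (m+n∸m≡n (W q) (θz ∸ (D q + D q)))))
            at-φ : proj₁ (conf (probe q tr) φ (start z , [])) ≡ start a
            at-φ = trans (cong (λ cs → proj₁ (conf cs φ (home z))) (sym probes)) (trans (sym seat) (Sighting.arrived s))
            at-φ+1 : proj₁ (conf (probe q tr) (suc φ) (start z , [])) ≡ start a
            at-φ+1 = trans (cong₂ (λ cs i → proj₁ (conf cs i (home z))) (sym probes) (sym (trans (cong (index q) later) index-next)))
                           (trans (sym (Sighting.seat s′)) (Sighting.arrived s′))
            φ<m : φ < length (main q)
            φ<m = m<n*o⇒m/o<n (subst (θz ∸ (D q + D q) <_) (m+n∸m≡n (D q + D q) (m q * W q)) (∸-monoˡ-< before after))

-- No bound on the size

data Kind : Set where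
  sweeping probing talking : ℕ → Kind

later : Kind → Kind
later (sweeping h) = sweeping (suc h)
later (probing h)  = probing (suc h)
later (talking h)  = talking (suc h)

kind : ℕ → Kind
kind 0 = sweeping 0
kind 1 = probing 0
kind 2 = talking 0
kind (suc (suc (suc q))) = later (kind q)

sweepAt : ℕ → ℕ
sweepAt zero    = 0
sweepAt (suc h) = suc (suc (suc (sweepAt h)))

kind-sweep : ∀ h → kind (sweepAt h) ≡ sweeping h
kind-sweep zero    = refl
kind-sweep (suc h) = cong later (kind-sweep h)

kind-probe : ∀ h → kind (suc (sweepAt h)) ≡ probing h
kind-probe zero    = refl
kind-probe (suc h) = cong later (kind-probe h)

kind-talk : ∀ h → kind (suc (suc (sweepAt h))) ≡ talking h
kind-talk zero    = refl
kind-talk (suc h) = cong later (kind-talk h)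

slotOf : Kind → ℕ
slotOf (sweeping h) = sweepAt h
slotOf (probing h)  = suc (sweepAt h)
slotOf (talking h)  = suc (suc (sweepAt h))

slotOf-kind : ∀ q → slotOf (kind q) ≡ q
slotOf-kind 0 = refl
slotOf-kind 1 = refl
slotOf-kind 2 = refl
slotOf-kind (suc (suc (suc q))) = trans (shift (kind q)) (cong (λ z → suc (suc (suc z))) (slotOf-kind q))
  where
  shift : ∀ K → slotOf (later K) ≡ suc (suc (suc (slotOf K)))
  shift (sweeping h) = refl
  shift (probing h)  = refl
  shift (talking h)  = refl

h≤sweepAt : ∀ h → h ≤ sweepAt h
h≤sweepAt zero    = z≤n
h≤sweepAt (suc h) = s≤s (≤-trans (h≤sweepAt h) (≤-trans (n≤1+n _) (n≤1+n _)))

sweepAt-mono : ∀ {h h′} → h ≤ h′ → sweepAt h ≤ sweepAt h′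
sweepAt-mono z≤n     = z≤n
sweepAt-mono (s≤s l) = s≤s (s≤s (s≤s (sweepAt-mono l)))

abstract
  fact : ℕ → Fact
  fact = recurring coded-fact

  fact-recurs : ∀ f h → ∃ λ h′ → h ≤ h′ × fact h′ ≡ f
  fact-recurs = recurs coded-fact

script : Kind → ℕ → List Cmd
script (sweeping h) q = sweep q
script (probing h)  q = probe q (proj₂ (fact h))
script (talking h)  q = sweep q

-- Each slot is so slow that a single phase outlasts all earlier slots.
origin : ℕ → ℕ
origin zero    = 0
origin (suc q) = origin q + ((d + d) + (length (script (kind q) q) * d + d))
  where d = suc (origin q)

EchoHeard : ℕ → ℕ → ℕ → List ℕ → Set
EchoHeard d v L cs = nth cs d < 2 × nth cs (pred L) < 2 ×
  ∃ λ θ → θ < L × d ≤ θ × v + θ < L × 2 ≤ nth cs θ × 2 ≤ nth cs (v + θ)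

abstract
  echo? : ∀ d v L cs → Dec (EchoHeard d v L cs)
  echo? d v L cs = (nth cs d <? 2) ×-dec (nth cs (pred L) <? 2) ×-dec
    anyUpTo? (λ θ → (d ≤? θ) ×-dec (v + θ <? L) ×-dec (2 ≤? nth cs θ) ×-dec (2 ≤? nth cs (v + θ))) L

record Memory : Set where
  constructor memories
  field
    name    : ℕ
    message : Message
    facts   : List Fact
    search  : Maybe Search
open Memory

-- An agent speaks up as long as it does not know a bound on the size; once
-- nobody does, the search for the messages starts.
talks : ℕ → Memory → Bool
talks h (memories _ _ Φ nothing)  = not (does (knows? Φ h))
talks h (memories _ μ _ (just s)) = asked μ s

respond : Bool → Maybe Search → Maybe Search
respond b     (just s) = just (advance b s)
respond true  nothing  = nothing
respond false nothing  = just searchStart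

speaks : Kind → Memory → Bool
speaks (sweeping h) mem = true
speaks (probing h)  mem = does (name mem ≟ proj₁ (fact h))
speaks (talking h)  mem = talks h mem

heed : Bool → Bool → Fact → List Fact → List Fact
heed false true f Φ = f ∷ Φ
heed _     _    f Φ = Φ

revise : Kind → ℕ → ℕ → ℕ → Memory → ℕ → List ℕ → Memory
revise (sweeping h) q v L mem d cs = mem
revise (probing h)  q v L mem d cs = record mem
  -- The preceding sweep leaves only nodes of degree below q. With a home of larger degree it would
  -- have woken nobody, and visitors from earlier slots could not be excluded.
  { facts = heed (speaks (probing h) mem) (does ((d <? q) ×-dec echo? v v L cs)) (fact h) (facts mem) }
revise (talking h)  q v L mem d cs = record mem
  { search = respond (talks h mem ∨ does (heard? v L cs)) (search mem) }

over : Maybe Search → Bool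
over nothing  = false
over (just s) = exhausted s

outcomes : Maybe Search → List Message
outcomes nothing            = []
outcomes (just (_ , found)) = found

script-returns : ∀ K q {n} (G : PortGraph n) home →
                 proj₂ (Motion.conf G (script K q) (length (script K q)) (home , [])) ≡ []
script-returns (sweeping h) q G home = SweepMotion.sweep-returns G q home
script-returns (probing h)  q G home = SweepMotion.probe-returns G q (proj₂ (fact h)) home
script-returns (talking h)  q G home = SweepMotion.sweep-returns G q home

script-capped : ∀ K q → All (Capped q) (script K q)
script-capped (sweeping h) q = sweep-capped q
script-capped (probing h)  q = probe-capped q (proj₂ (fact h))
script-capped (talking h)  q = sweep-capped q

unknown : Protocol
unknown = record
  { Mem     = Memory
  ; init    = λ l μ → memories l μ [] nothing
  ; guard   = origin
  ; pace    = origin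
  ; main    = λ q → script (kind q) q
  ; returns = λ q → script-returns (kind q) q
  ; moves   = λ q → speaks (kind q)
  ; update  = λ q → revise (kind q) q (suc (origin q))
                      ((suc (origin q) + suc (origin q)) + (length (script (kind q) q) * suc (origin q) + suc (origin q)))
  ; halted  = λ mem → over (search mem)
  ; out     = λ mem → outcomes (search mem)
  }

-- `begins` is computed from guard and pace, so it could not be used to define them; `origin`
-- repeats its recursion.
begins≡origin : ∀ q → origin q ≡ Controller.begins unknown q
begins≡origin zero    = refl
begins≡origin (suc q) = cong (_+ Controller.T unknown q) (begins≡origin q)

origin-mono : ∀ {q r} → q ≤ r → origin q ≤ origin r
origin-mono {q} {r} l with m≤n⇒m<n∨m≡n l
origin-mono {q} {suc r} _ | inj₁ (s≤s l) = ≤-trans (origin-mono l) (m≤m+n _ _)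
origin-mono {q} {.q} _ | inj₂ refl = ≤-refl

revise-name : ∀ K q v L mem d cs → name (revise K q v L mem d cs) ≡ name mem
revise-name (sweeping h) q v L mem d cs = refl
revise-name (probing h)  q v L mem d cs = refl
revise-name (talking h)  q v L mem d cs = refl

revise-message : ∀ K q v L mem d cs → message (revise K q v L mem d cs) ≡ message mem
revise-message (sweeping h) q v L mem d cs = refl
revise-message (probing h)  q v L mem d cs = refl
revise-message (talking h)  q v L mem d cs = refl

heed-⊆ : ∀ b c f Φ {g} → g ∈ Φ → g ∈ heed b c f Φ
heed-⊆ true  c     f Φ g∈ = g∈
heed-⊆ false true  f Φ g∈ = there g∈
heed-⊆ false false f Φ g∈ = g∈

heed-∈ : ∀ b c f Φ {g} → g ∈ heed b c f Φ → g ∈ Φ ⊎ (g ≡ f × b ≡ false × c ≡ true)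
heed-∈ true  c     f Φ g∈         = inj₁ g∈
heed-∈ false true  f Φ (here e)   = inj₂ (e , refl , refl)
heed-∈ false true  f Φ (there g∈) = inj₁ g∈
heed-∈ false false f Φ g∈         = inj₁ g∈

revise-⊆ : ∀ K q v L mem d cs {f} → f ∈ facts mem → f ∈ facts (revise K q v L mem d cs)
revise-⊆ (sweeping h) q v L mem d cs f∈ = f∈
revise-⊆ (probing h)  q v L mem d cs f∈ = heed-⊆ (speaks (probing h) mem) _ (fact h) (facts mem) f∈
revise-⊆ (talking h)  q v L mem d cs f∈ = f∈

respond-just : ∀ b c {s} → respond b c ≡ just s → (∃ λ s′ → c ≡ just s′) ⊎ (b ≡ false × c ≡ nothing)
respond-just b     (just s) e = inj₁ (s , refl)
respond-just false nothing  e = inj₂ (refl , refl)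

talks-false : ∀ h {mem} → search mem ≡ nothing → talks h mem ≡ false → Knows (facts mem) h
talks-false h {memories _ _ Φ nothing} refl e = decide (knows? Φ h) e
  where
  decide : ∀ {A : Set} (d : Dec A) → not (does d) ≡ false → A
  decide (yes a) _ = a

∨-falseˡ : ∀ a {b} → a ∨ b ≡ false → a ≡ false
∨-falseˡ false _ = refl

-- Correctness of gossiping without a bound

module Gossiping {n k : ℕ} (G : PortGraph n) (start : Fin k → Fin n) (start-inj : Injective start)
                 (label : Fin k → ℕ) (label-inj : Injective label) (msg : Fin k → Message)
                 (wake : Fin k → Maybe ℕ) where
  open Controller unknown
  open PortGraph G
  open Motion G
  open SweepMotion G
  open Routes G
  open World unknown G start start-inj label msg wake
  open Detecting unknown G start start-inj label msg wake begins≡origin begins≡origin (λ q → script-capped (kind q) q)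
    using (Awake; module At; module Listener)

  Lives : ℕ → Fin n → Set
  Lives b u = ∃ λ j → label j ≡ b × start j ≡ u

  lives-unique : ∀ {b u v} → Lives b u → Lives b v → u ≡ v
  lives-unique (i , ei , refl) (j , ej , refl) = cong start (label-inj i j (trans ei (sym ej)))

  module Local (a : Fin k) = Claims (start a) Lives lives-unique

  revised : ∀ i (Wi : Awake i) q {K} → kind q ≡ K → let open At i Wi in
            memory (suc q) ≡ revise K q (D q) (T q) (memory q) (deg (start i)) (counts i (slotTime q) (T q))
  revised i Wi q e = cong (λ K → revise K q (D q) (T q) (memory q) (deg (start i)) (counts i (slotTime q) (T q))) e
    where open At i Wi

  names : ∀ z (Wz : Awake z) q → name (At.memory z Wz q) ≡ label z
  names z Wz zero    = refl
  names z Wz (suc q) = trans (revise-name (kind q) q _ _ (At.memory z Wz q) _ _) (names z Wz q)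

  module _ (a : Fin k) (Wa : Awake a) where
    private module A = At a Wa

    message≡ : ∀ q → message (A.memory q) ≡ msg a
    message≡ zero    = refl
    message≡ (suc q) = trans (revise-message (kind q) q _ _ (A.memory q) _ _) (message≡ q)

    facts-⊆ : ∀ {q r f} → q ≤ r → f ∈ facts (A.memory q) → f ∈ facts (A.memory r)
    facts-⊆ {q} {r} l f∈ = grow (m≤n⇒m<n∨m≡n l)
      where
      grow : q < r ⊎ q ≡ r → _ ∈ facts (A.memory r)
      grow (inj₂ refl) = f∈
      grow (inj₁ (s≤s {n = r′} l′)) = revise-⊆ (kind r′) r′ _ _ (A.memory r′) _ _ (facts-⊆ l′ f∈)

    alive-< : ∀ {q r} → q ≤ r → A.Alive r → A.Alive q
    alive-< q≤r al q′ l = al q′ (<-≤-trans l q≤r)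

    heard-at : ∀ q θ → θ < T q → nth (counts a (A.slotTime q) (T q)) θ ≡ sight a (θ + A.slotTime q)
    heard-at q θ = nth-counts a (A.slotTime q) (T q) θ

    -- Labels are distinct, so only the agent named in the fact moves in its slot, and a detected
    -- pause can be attributed to that agent.
    record-sound : ∀ h → A.Alive (suc (suc (sweepAt h))) → speaks (probing h) (A.memory (suc (sweepAt h))) ≡ false →
                   deg (start a) < suc (sweepAt h) →
                   EchoHeard (D (suc (sweepAt h))) (W (suc (sweepAt h))) (T (suc (sweepAt h))) (counts a (A.slotTime (suc (sweepAt h))) (T (suc (sweepAt h)))) →
                   Local.Truth a (fact h)
    record-sound h alive silent low (first , last , θ , θ<T , D≤θ , Wθ<T , two , two′) = conclude
        (L.detects alive (cong (λ K → speaks K (A.memory (sweepAt h))) (kind-sweep h)) (≤-pred low)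
          (trans (cong (λ K → speaks K (A.memory q)) (kind-probe h)) silent)
          (subst (_< 2) (heard-at q (D q) (D<T q)) first)
          (subst (_< 2) (heard-at q (pred (T q)) ≤-refl) last)
          (proj₂ (fact h)) (cong (λ K → script K q) (kind-probe h)) sole θ D≤θ Wθ<T
          (subst (2 ≤_) (heard-at q θ θ<T) two) (subst (2 ≤_) (heard-at q (W q + θ) Wθ<T) two′))
      where
      q = suc (sweepAt h)
      module L = Listener a Wa (sweepAt h) (cong (λ K → script K (sweepAt h)) (kind-sweep h))
      named : ∀ z (Wz : Awake z) → speaks (kind q) (At.memory z Wz q) ≡ true → name (At.memory z Wz q) ≡ proj₁ (fact h)
      named z Wz e = Equivalence.to (does-iff (name (At.memory z Wz q) ≟ proj₁ (fact h)))
                       (trans (cong (λ K → speaks K (At.memory z Wz q)) (sym (kind-probe h))) e)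
      sole : ∀ z (Wz : Awake z) z′ (Wz′ : Awake z′) → speaks (kind q) (At.memory z Wz q) ≡ true →
             speaks (kind q) (At.memory z′ Wz′ q) ≡ true → z ≡ z′
      sole z Wz z′ Wz′ e e′ = label-inj z z′ (trans (sym (names z Wz q)) (trans (named z Wz e) (trans (sym (named z′ Wz′ e′)) (names z′ Wz′ q))))
      conclude : (∃ λ z → Σ (Awake z) λ Wz → speaks (kind q) (At.memory z Wz q) ≡ true × Route (start z) (proj₂ (fact h)) (start a)) →
                 Local.Truth a (fact h)
      conclude (z , Wz , e , r) = start z , (z , trans (sym (names z Wz q)) (named z Wz e) , refl) , r

    revise-sound : ∀ q K → kind q ≡ K → A.Alive (suc q) → (∀ f → f ∈ facts (A.memory q) → Local.Truth a f) →
                   ∀ f → f ∈ facts (revise K q (D q) (T q) (A.memory q) (deg (start a)) (counts a (A.slotTime q) (T q))) → Local.Truth a f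
    revise-sound q (sweeping h) e alive sound = sound
    revise-sound q (talking h)  e alive sound = sound
    revise-sound q (probing h)  e alive sound f f∈ =
      new (heed-∈ (speaks (probing h) (A.memory q)) _ (fact h) (facts (A.memory q)) f∈)
      where
      q≡ : suc (sweepAt h) ≡ q
      q≡ = trans (cong slotOf (sym e)) (slotOf-kind q)
      at : ∀ r → r ≡ q → A.Alive (suc r) → speaks (probing h) (A.memory r) ≡ false → deg (start a) < r →
           EchoHeard (D r) (W r) (T r) (counts a (A.slotTime r) (T r)) → r ≡ suc (sweepAt h) → Local.Truth a (fact h)
      at .(suc (sweepAt h)) _ al sp low ec refl = record-sound h al sp low ec
      new : f ∈ facts (A.memory q) ⊎ (f ≡ fact h × speaks (probing h) (A.memory q) ≡ false ×
              does ((deg (start a) <? q) ×-dec echo? (D q) (D q) (T q) (counts a (A.slotTime q) (T q))) ≡ true) → Local.Truth a f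
      new (inj₁ old) = sound f old
      new (inj₂ (refl , sp , ok)) = let low , ec = Equivalence.to (does-iff ((deg (start a) <? q) ×-dec echo? (D q) (D q) (T q) (counts a (A.slotTime q) (T q)))) ok in
        at q refl alive sp low ec (sym q≡)

    facts-sound : ∀ q → A.Alive q → ∀ f → f ∈ facts (A.memory q) → Local.Truth a f
    facts-sound zero    alive f ()
    facts-sound (suc q) alive f f∈ = revise-sound q (kind q) refl alive (facts-sound q (alive-< (n≤1+n q) alive)) f f∈

    knows⇒bound : ∀ q h → A.Alive q → Knows (facts (A.memory q)) h → n ≤ h
    knows⇒bound q h alive = Local.knows-sound a (facts-sound q alive)

    -- The search starts only after the bound has been learned, hence after a
    -- complete sweep.
    searching⇒bound : ∀ q → A.Alive q → ∀ s → search (A.memory q) ≡ just s → ∃ λ h → n ≤ h × sweepAt h < q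
    searching⇒bound (suc q) alive s e = by (kind q) refl e
      where
      alive′ = alive-< (n≤1+n q) alive
      again : ∀ s → search (A.memory q) ≡ just s → ∃ λ h → n ≤ h × sweepAt h < suc q
      again s e = let h , n≤h , l = searching⇒bound q alive′ s e in h , n≤h , m<n⇒m<1+n l
      by : ∀ K → kind q ≡ K → search (revise K q (D q) (T q) (A.memory q) (deg (start a)) (counts a (A.slotTime q) (T q))) ≡ just s →
           ∃ λ h → n ≤ h × sweepAt h < suc q
      by (sweeping h) _ e = again s e
      by (probing h)  _ e = again s e
      by (talking h)  K≡ e = start-or-again (respond-just _ (search (A.memory q)) e)
        where
        start-or-again : (∃ λ s′ → search (A.memory q) ≡ just s′) ⊎
                         (talks h (A.memory q) ∨ does (heard? (D q) (T q) (counts a (A.slotTime q) (T q))) ≡ false × search (A.memory q) ≡ nothing) →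
                         ∃ λ h → n ≤ h × sweepAt h < suc q
        start-or-again (inj₁ (s′ , e′)) = again s′ e′
        start-or-again (inj₂ (silent , none)) = h ,
          knows⇒bound q h alive′ (talks-false h {A.memory q} none (∨-falseˡ (talks h (A.memory q)) silent)) ,
          s≤s (≤-trans (≤-trans (n≤1+n _) (n≤1+n _)) (≤-reflexive (trans (cong slotOf (sym K≡)) (slotOf-kind q))))

  explores : ∀ q {K} → kind q ≡ K → script K q ≡ sweep q → n ≤ q → Explores q
  explores q e sweeps n≤q i v = subst (λ cs → ∃ λ φ → φ < length cs × proj₁ (conf cs φ (home i)) ≡ v)
    (sym (trans (cong (λ K → script K q) e) sweeps)) (sweep-explores q n≤q (start i) v)

  rouse : ∀ i (Wi : Awake i) h → n ≤ h → At.Alive i Wi (suc (sweepAt h)) → ∀ j → ∃ λ w → w ≤ begins (suc (sweepAt h)) + proj₁ Wi × Woken j w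
  rouse i Wi h n≤h alive j =
    let φ , φ<m , e = explores q (kind-sweep h) refl (≤-trans n≤h (h≤sweepAt h)) i (start j)
        w , w≤ , W  = arouses (proj₂ Wi) q alive (cong (λ K → speaks K (At.memory i Wi q)) (kind-sweep h)) φ φ<m j e
    in w , ≤-trans w≤ (≤-trans (+-monoˡ-≤ _ (<⇒≤ (tour-time<T q φ φ<m)))
             (≤-reflexive (trans (sym (+-assoc (T q) (begins q) (proj₁ Wi))) (cong (_+ proj₁ Wi) (+-comm (T q) (begins q)))))) , W
    where q = sweepAt h

  -- The agent i either lives through the sweep of index n, which reaches all homes, or halts
  -- before. Halting requires a search, hence a bound, hence an earlier sweep that was already
  -- complete.
  everyone : ∀ i → Awake i → ∀ j → Awake j
  everyone i Wi j = by (At.alive-or-halted i Wi (suc (sweepAt n)))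
    where
    module I = At i Wi
    wakes : ∀ h → n ≤ h → I.Alive (suc (sweepAt h)) → Awake j
    wakes h n≤h al = let w , _ , W = rouse i Wi h n≤h al j in w , W
    halted : ∀ q′ → I.Alive q′ → ∀ c → search (I.memory q′) ≡ c → over c ≡ true → Awake j
    halted q′ al (just s) e _ = let h , n≤h , l = searching⇒bound i Wi q′ al s e in wakes h n≤h (alive-< i Wi l al)
    by : I.Alive (suc (sweepAt n)) ⊎ (∃ λ q′ → q′ < suc (sweepAt n) × I.Alive q′ × over (search (I.memory q′)) ≡ true) → Awake j
    by (inj₁ al) = wakes n ≤-refl al
    by (inj₂ (q′ , _ , al , h)) = halted q′ al (search (I.memory q′)) refl h

  module Everybody (woken : ∀ i → Awake i) (i0 : Fin k) (other : (i : Fin k) → ∃ λ (j : Fin k) → j ≢ i) where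
    open Together (λ i → proj₁ (woken i)) (λ i → proj₂ (woken i))
    open Searching msg

    D-mono : ∀ {q r} → q ≤ r → D q ≤ D r
    D-mono l = s≤s (origin-mono l)

    Living : ℕ → Set
    Living q = ∀ i → Of.Alive i q

    living-< : ∀ {q r} → q ≤ r → Living r → Living q
    living-< l al i = alive-< i (woken i) l (al i)

    -- After a complete sweep all agents are awake, so wake-up times differ by at most the time
    -- before slot q, and the guard time of slot q is longer than that.
    sync : ∀ h q → n ≤ h → Living (suc (sweepAt h)) → sweepAt h < q → Sync q
    sync h q n≤h al l i j =
      let w , w≤ , W = rouse j (woken j) h n≤h (al j) i in
      subst (_< proj₁ (woken j) + D q) (woken-unique W (proj₂ (woken i)))
        (≤-trans (s≤s (≤-trans w≤ (+-monoˡ-≤ (proj₁ (woken j)) (≤-trans (begins-mono l) (≤-reflexive (sym (begins≡origin q)))))))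
                 (≤-reflexive (+-comm (D q) (proj₁ (woken j)))))

    known : Fin k → ℕ → List Fact
    known a h = facts (Of.memory a (suc (suc (sweepAt h))))

    module Learn (a z : Fin k) (z≢a : z ≢ a) (tr : Trace) (route : Route (start z) tr (start a))
                 (h : ℕ) (fact≡ : fact h ≡ (label z , tr)) (n≤h : n ≤ h) (short : length tr ≤ h)
                 (living : Living (suc (suc (sweepAt h)))) where
      private
        q : ℕ
        q = suc (sweepAt h)

        h≤q : h ≤ q
        h≤q = ≤-trans (h≤sweepAt h) (n≤1+n _)

        inside : Inside q tr
        inside = degrees route , ≤-trans short h≤q
          where
          degrees : ∀ {home tr v} → Route home tr v → All.All (λ (d , _) → d ≤ q) tr
          degrees root = []
          degrees (hop {u = u} r p) = ≤-trans (<⇒≤ (deg<n G u)) (≤-trans n≤h h≤q) ∷ degrees r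

        listens : speaks (kind q) (Of.memory a q) ≡ false
        listens = trans (cong (λ K → speaks K (Of.memory a q)) (kind-probe h))
          (dec-false (name (Of.memory a q) ≟ proj₁ (fact h))
            (λ e → z≢a (label-inj z a (sym (trans (sym (names a (woken a) q)) (trans e (cong proj₁ fact≡)))))))

        moved : speaks (kind q) (Of.memory z q) ≡ true
        moved = trans (cong (λ K → speaks K (Of.memory z q)) (kind-probe h))
          (dec-true (name (Of.memory z q) ≟ proj₁ (fact h)) (trans (names z (woken z) q) (cong proj₁ (sym fact≡))))

        script≡ : script (kind q) q ≡ probe q tr
        script≡ = trans (cong (λ K → script K q) (kind-probe h)) (cong (λ f → probe q (proj₂ f)) fact≡)

        module E = Echo D-mono (sync h q n≤h (living-< (n≤1+n _) living) ≤-refl) living a z listens moved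

        cs = counts a (Of.slotTime a q) (T q)

        at : ∀ θ → θ < T q → nth cs θ ≡ sight a (E.t θ)
        at θ θ<T = nth-counts a (Of.slotTime a q) (T q) θ θ<T

        heard : EchoHeard (D q) (W q) (T q) cs
        heard = let θ , D≤θ , Wθ<T , two , two′ = E.echo (length tr)
                      (subst (λ c → suc (length tr) < length c) (sym script≡) (probe-length q route inside))
                      (trans (cong (λ c → proj₁ (conf c (length tr) (home z))) script≡) (cong proj₁ (probe-arrives q route inside)))
                      (trans (cong (λ c → proj₁ (conf c (suc (length tr)) (home z))) script≡) (cong proj₁ (probe-holds q route inside)))
                    θ<T = ≤-<-trans (m≤n+m θ (W q)) Wθ<T
                in subst (_< 2) (sym (at (D q) (D<T q))) E.quiet-first ,
                   subst (_< 2) (sym (at (pred (T q)) ≤-refl)) E.quiet-last ,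
                   θ , θ<T , D≤θ , Wθ<T ,
                   subst (2 ≤_) (sym (at θ θ<T)) two , subst (2 ≤_) (sym (at (W q + θ) Wθ<T)) two′

      recorded : (label z , tr) ∈ known a h
      recorded = subst (λ mem → (label z , tr) ∈ facts mem) (sym (revised a (woken a) q (kind-probe h)))
        (subst₂ (λ b c → (label z , tr) ∈ heed b c (fact h) (facts (Of.memory a q)))
          (sym (trans (cong (λ K → speaks K (Of.memory a q)) (sym (kind-probe h))) listens))
          (sym (dec-true ((deg (start a) <? q) ×-dec echo? (D q) (D q) (T q) cs)
                  (s≤s (≤-trans (<⇒≤ (deg<n G (start a))) (≤-trans n≤h (h≤sweepAt h))) , heard)))
          (here (sym fact≡)))

    -- The fact comes up again after the index has passed n and the length of its trace; by then the
    -- clocks agree up to a guard time and the probe fits its bounds. Facts are never forgotten.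
    learns : ∀ a z → z ≢ a → ∀ tr → Local.Truth a (label z , tr) →
             Eventually (λ h → Living (suc (suc (sweepAt h))) → (label z , tr) ∈ known a h)
    learns a z z≢a tr (u , (j , j≡ , refl) , route) =
      let h₁ , le , e = fact-recurs (label z , tr) (n ⊔ length tr) in
      h₁ , λ h h₁≤h living → facts-⊆ a (woken a) (s≤s (s≤s (sweepAt-mono h₁≤h)))
        (Learn.recorded a z z≢a tr (subst (λ i → Route (start i) tr (start a)) (label-inj j z j≡) route) h₁ e
          (≤-trans (m≤m⊔n n (length tr)) le) (≤-trans (m≤n⊔m n (length tr)) le)
          (living-< (s≤s (s≤s (sweepAt-mono h₁≤h))) living))

    all-know : Eventually (λ h → ∀ a → Living (suc (suc (sweepAt h))) → Knows (known a h) h)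
    all-know = eventually-∀ (λ a → let z , z≢a = other a in
      Local.knows-complete a (z , refl , refl) (λ e → z≢a (start-inj z a e)) (λ h → Living (suc (suc (sweepAt h)))) (known a) (learns a z z≢a))

    record Agreed (h : ℕ) (c : Maybe Search) : Set where
      field
        living  : Living (sweepAt h)
        search≡ : ∀ i → search (Of.memory i (sweepAt h)) ≡ c

    module Talk {h c} (agreed : Agreed h c) (going : over c ≡ false) where
      open Agreed agreed

      q : ℕ
      q = suc (suc (sweepAt h))

      search₁ : ∀ i → search (Of.memory i (suc (sweepAt h))) ≡ c
      search₁ i = trans (cong search (revised i (woken i) (sweepAt h) (kind-sweep h))) (search≡ i)

      search₂ : ∀ i → search (Of.memory i q) ≡ c
      search₂ i = trans (cong search (revised i (woken i) (suc (sweepAt h)) (kind-probe h))) (search₁ i)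

      living₃ : Living (suc q)
      living₃ i = Of.alive-suc i (Of.alive-suc i (Of.alive-suc i (living i)
        (trans (cong over (search≡ i)) going)) (trans (cong over (search₁ i)) going)) (trans (cong over (search₂ i)) going)

      hears : Fin k → List ℕ
      hears i = counts i (Of.slotTime i q) (T q)

      reply : Fin k → Bool
      reply i = talks h (Of.memory i q) ∨ does (heard? (D q) (T q) (hears i))

      agreed-next : ∀ c′ → (∀ i → respond (reply i) c ≡ c′) → Agreed (suc h) c′
      agreed-next c′ same = record
        { living  = living₃
        ; search≡ = λ i → trans (cong search (revised i (woken i) q (kind-talk h)))
                            (trans (cong (respond (reply i)) (search₂ i)) (same i)) }

      talks≡ : ∀ i → speaks (kind q) (Of.memory i q) ≡ talks h (Of.memory i q)
      talks≡ i = cong (λ K → speaks K (Of.memory i q)) (kind-talk h)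

      module Synchronous (n≤h : n ≤ h) where

        h≤q : h ≤ q
        h≤q = ≤-trans (h≤sweepAt h) (≤-trans (n≤1+n _) (n≤1+n _))

        common : ∀ {A : Fin k → Set} (A? : ∀ i → Dec (A i)) → (∀ i → talks h (Of.memory i q) ≡ does (A? i)) →
                 ∀ i → reply i ≡ does (F.any? A?)
        common A? e i = trans (cong (_∨ does (heard? (D q) (T q) (hears i))) (sym (talks≡ i)))
          (Query.common-answer D-mono (sync h q n≤h (living-< (s≤s (≤-trans (n≤1+n _) (n≤1+n _))) living₃) (s≤s (n≤1+n _)))
             living₃ (explores q (kind-talk h) refl (≤-trans n≤h h≤q)) A? (λ i → trans (talks≡ i) (e i)) i)

    module Learning {h} (agreed : Agreed h nothing) where
      open Talk agreed refl

      ignorant? : ∀ i → Dec (¬ Knows (facts (Of.memory i q)) h)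
      ignorant? i = ¬? (knows? (facts (Of.memory i q)) h)

      talks-ignorant : ∀ i → talks h (Of.memory i q) ≡ does (ignorant? i)
      talks-ignorant i = by (Of.memory i q) (search₂ i)
        where
        by : ∀ mem → search mem ≡ nothing → talks h mem ≡ does (¬? (knows? (facts mem) h))
        by (memories _ _ _ nothing) refl = refl

      bound : ∀ i → Knows (facts (Of.memory i q)) h → n ≤ h
      bound i = knows⇒bound i (woken i) q h (living-< (n≤1+n q) living₃ i)

      -- The channel need not be reliable yet. An ignorant agent speaks itself, so its reply is yes
      -- whatever it hears. An agent that knows a bound has n ≤ h, so all are synchronised and it
      -- does hear the ignorant one.
      continue : (∃ λ i → ¬ Knows (facts (Of.memory i q)) h) → Agreed (suc h) nothing
      continue some = agreed-next nothing (λ i → cong (λ b → respond b nothing) (true-reply i (ignorant? i) refl))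
        where
        true-reply : ∀ i (d : Dec (¬ Knows (facts (Of.memory i q)) h)) → ignorant? i ≡ d → reply i ≡ true
        true-reply i (yes _)  e = cong (_∨ does (heard? (D q) (T q) (hears i))) (trans (talks-ignorant i) (cong does e))
        true-reply i (no ¬¬k) e = trans (Synchronous.common (bound i (stable (knows? (facts (Of.memory i q)) h) ¬¬k)) ignorant? talks-ignorant i)
                                        (dec-true (F.any? ignorant?) some)
          where
          stable : ∀ {A : Set} → Dec A → ¬ ¬ A → A
          stable (yes a) _   = a
          stable (no ¬a) ¬¬a = contradiction ¬a ¬¬a

      begin-search : (∀ i → Knows (facts (Of.memory i q)) h) → n ≤ h × Agreed (suc h) (just searchStart)
      begin-search knows = bound i0 (knows i0) , agreed-next (just searchStart) (λ i → cong (λ b → respond b nothing)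
        (trans (Synchronous.common (bound i0 (knows i0)) ignorant? talks-ignorant i)
               (dec-false (F.any? ignorant?) (λ (i , ¬k) → ¬k (knows i)))))

    module Asking {h x todo found} (agreed : Agreed h (just (x ∷ todo , found))) (n≤h : n ≤ h) where
      open Talk agreed refl

      someone = F.any? (λ j → matches? x (msg j))
      b = does someone

      s : Search
      s = x ∷ todo , found

      talks-matches : ∀ i → talks h (Of.memory i q) ≡ does (matches? x (msg i))
      talks-matches i = by (Of.memory i q) (search₂ i) (message≡ i (woken i) q)
        where
        by : ∀ mem → search mem ≡ just s → message mem ≡ msg i → talks h mem ≡ does (matches? x (msg i))
        by (memories _ _ _ (just _)) refl refl = refl

      asked-next : Agreed (suc h) (just (advance b s))
      asked-next = agreed-next (just (advance b s)) (λ i →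
        cong (λ c → respond c (just s)) (Synchronous.common n≤h (λ j → matches? x (msg j)) talks-matches i) )

      asked-sound : Sound s → Sound (advance b s)
      asked-sound = sound-advance b x todo found (does-iff someone)

      asked-work : work (proj₁ (advance b s)) < work (x ∷ todo)
      asked-work = work-advance b x todo found (Equivalence.to (does-iff someone))

    Started : ℕ → Set
    Started h = ∃ λ s → n ≤ h × Sound s × Agreed h (just s)

    finish : ∀ fuel {h s} → work (proj₁ s) ≤ fuel → n ≤ h → Sound s → Agreed h (just s) →
             ∃ λ r → ∃ λ found → Sound ([] , found) × Agreed r (just ([] , found))
    finish fuel {h} {[] , found} _ _ so ag = h , found , so , ag
    finish zero {s = starts _ ∷ _ , _} () _ _ _
    finish zero {s = equals _ ∷ _ , _} () _ _ _
    finish (suc fuel) {h} {x ∷ todo , found} le n≤h so ag =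
      finish fuel (≤-pred (≤-trans (Asking.asked-work ag n≤h) le)) (≤-trans n≤h (n≤1+n h))
             (Asking.asked-sound ag n≤h so) (Asking.asked-next ag n≤h)

    learning-or-started : ∀ h → Agreed h nothing ⊎ ∃ Started
    learning-or-started zero = inj₁ (record { living = λ _ _ () ; search≡ = λ _ → refl })
    learning-or-started (suc h) = next-step (learning-or-started h)
      where
      decide-step : (ag : Agreed h nothing) → Dec (∃ λ i → ¬ Knows (facts (Of.memory i (suc (suc (sweepAt h))))) h) →
                    Agreed (suc h) nothing ⊎ ∃ Started
      decide-step ag (yes some) = inj₁ (Learning.continue ag some)
      decide-step ag (no none)  =
        let n≤h , ag′ = Learning.begin-search ag (λ i → known-by i (knows? (facts (Of.memory i (suc (suc (sweepAt h))))) h))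
        in inj₂ (suc h , searchStart , ≤-trans n≤h (n≤1+n h) , sound-start , ag′)
        where
        known-by : ∀ i → Dec (Knows (facts (Of.memory i (suc (suc (sweepAt h))))) h) → Knows (facts (Of.memory i (suc (suc (sweepAt h))))) h
        known-by i (yes k) = k
        known-by i (no ¬k) = contradiction (i , ¬k) none
      next-step : Agreed h nothing ⊎ ∃ Started → Agreed (suc h) nothing ⊎ ∃ Started
      next-step (inj₂ st) = inj₂ st
      next-step (inj₁ ag) = decide-step ag (F.any? (Learning.ignorant? ag))

    -- If the agents are still learning at the index given by `all-know`, they all live, so all of
    -- them know a bound and that talking slot is silent.
    started : ∃ Started
    started = from-learning (learning-or-started (proj₁ all-know))
      where
      from-learning : Agreed (proj₁ all-know) nothing ⊎ ∃ Started → ∃ Started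
      from-learning (inj₂ st) = st
      from-learning (inj₁ ag) =
        let H = proj₁ all-know
            n≤h , ag′ = Learning.begin-search ag (λ i → proj₂ all-know H ≤-refl i (living-< (n≤1+n _) (Talk.living₃ ag refl)))
        in suc H , searchStart , ≤-trans n≤h (n≤1+n H) , sound-start , ag′

    DoneFrom : ℕ → Set
    DoneFrom t = ∀ x → t ≤ x → AllDoneAt G algorithm start label msg wake x

    all-done : ∃ DoneFrom
    all-done = let h , s , n≤h , so , ag = started
                   r , found , so′ , ag′ = finish (work (proj₁ s)) ≤-refl n≤h so ag
               in conclude r found so′ ag′
      where
      conclude : ∀ r found → Sound ([] , found) → Agreed r (just ([] , found)) → ∃ DoneFrom
      -- The sum of the wake-up times serves as a common upper bound for them.
      conclude r found so ag = suc (begins (sweepAt r) + sum (λ i → proj₁ (woken i))) , λ x le i →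
        subst (CorrectlyDone msg) (sym (final i x le)) (sound-final so)
        where
        final : ∀ i x → suc (begins (sweepAt r) + sum (λ i → proj₁ (woken i))) ≤ x → stateAt x i ≡ done (start i) found
        final i x le = trans (Of.finished i (sweepAt r) (Agreed.living ag i) (cong over (Agreed.search≡ ag i)) x
                          (≤-trans (s≤s (+-monoʳ-≤ (begins (sweepAt r)) (term≤sum (λ i → proj₁ (woken i)) i))) le))
                        (cong (λ c → done (start i) (outcomes c)) (Agreed.search≡ ag i))

unknown-bound : UnknownBound
unknown-bound = Controller.algorithm unknown , bound
  where
  bound : ∀ {n k} (G : PortGraph n) (start : Fin k → Fin n) (label : Fin k → ℕ) (msg : Fin k → Message)
          (wake : Fin k → Maybe ℕ) (i0 : Fin k) (t0 : ℕ) → Instance start label wake i0 t0 →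
          Σ ℕ λ T → AllDoneAt G (Controller.algorithm unknown) start label msg wake (t0 + T)
  -- Completion holds at every time from `proj₁ finally` on, so adding t0 is harmless.
  bound {n} {k} G start label msg wake i0 t0 inst = proj₁ finally , proj₂ finally (t0 + proj₁ finally) (m≤n+m _ t0)
    where
    open Instance inst
    module M = Gossiping G start start-inj label label-inj msg wake
    open World unknown G start start-inj label msg wake using (woken-by; wakeNow-adversary; stateAt)
    first : ∃ λ w → w ≤ t0 × World.Woken unknown G start start-inj label msg wake i0 w
    first = woken-by i0 t0 (wakeNow-adversary (stateAt t0) t0 i0 i0-wakes)
    other : ∀ {k} → 2 ≤ k → ∀ (i : Fin k) → ∃ λ j → j ≢ i
    other (s≤s (s≤s z≤n)) zero    = suc zero , λ ()
    other (s≤s (s≤s z≤n)) (suc i) = zero , λ ()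
    finally = M.Everybody.all-done (M.everyone i0 (proj₁ first , proj₂ (proj₂ first))) i0 (other two-agents)

theorem3 : KnownBoundPoly × UnknownBound
theorem3 = known-bound , unknown-bound
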